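{- For every integer $t\geq1$ there exists an integer $s=s(t)\geq1$ with the following property. Let $G$ be a (theta, prism)-free graph with no clique of cardinality $t$ and let $a\in V(G)$. Assume that there is an $a$-seed in $G$. Then for every vertex $x\in V(G)\setminus N_G[a]$ there exists $S_x\subseteq V(G)\setminus\{a,x\}$ with $|S_x|<s$ such that $S_x$ separates $a$ and $x$ in $G$.
   Context: Graphs finite simple. A set $M\subseteq V(G)\setminus\{x,y\}$ separates $x$ and $y$ in $G$ if there is a partition $(L,M,R)$ of $V(G)$ with $x\in L$, $y\in R$ and no edges between $L$ and $R$. Theta: two non-adjacent vertices joined by three internally disjoint induced paths of length $\ge2$ with pairwise anticomplete interiors. Prism: two disjoint triangles $\{a_1,a_2,a_3\},\{b_1,b_2,b_3\}$, disjoint induced paths $P_i$ from $a_i$ to $b_i$, with $a_ia_j,b_ib_j$ the only edges between $P_i,P_j$. (Theta, prism)-free: no induced subgraph is a theta or prism. A caterpillar is a tree of maximum degree three containing a path that contains all vertices of degree more than two. The $1$-subdivision of a graph is obtained by subdividing each edge once. The line graph $L(F)$ has vertex set $E(F)$, two vertices adjacent iff the edges share an end. A vertex is simplicial in $H$ if its neighborhood is a clique; $\mathcal{Z}(H)$ is the set of simplicial vertices of $H$. A vertex $a$ is trapped in an induced subgraph $H'$ of $G$ if every vertex at distance at most two from $a$ in $G$ lies in $H'$ and every neighbor of $a$ has degree two in $H'$. An induced subgraph $H$ of $G\setminus\{a\}$ is an $a$-seed in $G$ if $H$ is (isomorphic to) the line graph of a $1$-subdivision of some caterpillar, $N_G(a)=\mathcal{Z}(H)$,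 and $a$ is trapped in $G[V(H)\cup\{a\}]$. -}

module Defs where

open import Data.Nat using (ℕ; zero; suc; _≤_; _<_)
open import Data.Bool using (Bool; true; false; T)
open import Data.Fin using (Fin; toℕ; fromℕ)
import Data.Fin as Fin
open import Data.Fin.Subset using (Subset; _∈_; _∉_; _∪_; _∩_; ⁅_⁆; ∣_∣)
open import Data.Vec using (tabulate)
open import Data.Product using (Σ; Σ-syntax; ∃; _×_; _,_; proj₁; proj₂)
open import Data.Sum using (_⊎_; inj₁; inj₂)
open import Data.Empty using (⊥)
open import Relation.Nullary using (¬_)
open import Relation.Binary.PropositionalEquality using (_≡_; _≢_)
open import Function.Definitions using (Injective)

record Graph : Set where
  field
    n     : ℕ
    adj   : Fin n → Fin n → Bool
    sym   : ∀ u v → adj u v ≡ adj v u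
    irrefl : ∀ u → adj u u ≡ false

open Graph public

V : Graph → Set
V G = Fin (n G)

E : (G : Graph) → V G → V G → Set
E G u v = T (adj G u v)

N : (G : Graph) → V G → Subset (n G)
N G v = tabulate (adj G v)

degIn : (G : Graph) → Subset (n G) → V G → ℕ
degIn G H v = ∣ N G v ∩ H ∣

deg : (G : Graph) → V G → ℕ
deg G v = ∣ N G v ∣

Consecutive : ∀ {k} → Fin k → Fin k → Set
Consecutive i j = toℕ i ≡ suc (toℕ j) ⊎ toℕ j ≡ suc (toℕ i)

record Path {A : Set} (R : A → A → Set) (k : ℕ) : Set where
  field
    vtx  : Fin (suc k) → A
    inj  : Injective _≡_ _≡_ vtx
    cons : ∀ i j → Consecutive i j → R (vtx i) (vtx j)

open Path public

first : ∀ {A R k} → Path {A} R k → A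
first P = vtx P Fin.zero

last : ∀ {A R k} → Path {A} R k → A
last {k = k} P = vtx P (fromℕ k)

record InducedPath (G : Graph) (k : ℕ) : Set where
  field
    path    : Path (E G) k
    induced : ∀ i j → E G (vtx path i) (vtx path j) → Consecutive i j

open InducedPath public

ipv : ∀ {G k} → InducedPath G k → Fin (suc k) → V G
ipv P = vtx (path P)

Interior : ∀ {k} → Fin (suc k) → Set
Interior {k} i = 0 < toℕ i × toℕ i < k

InteriorsApart : ∀ {G k l} → InducedPath G k → InducedPath G l → Set
InteriorsApart {G} P Q =
  ∀ i j → Interior i → Interior j →
    (ipv P i ≢ ipv Q j) × ¬ E G (ipv P i) (ipv Q j)

record Theta (G : Graph) : Set where
  field
    x y : V G
    nonadj : ¬ E G x y
    k₁ k₂ k₃ : ℕ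
    len₁ : 2 ≤ k₁
    len₂ : 2 ≤ k₂
    len₃ : 2 ≤ k₃
    P₁ : InducedPath G k₁
    P₂ : InducedPath G k₂
    P₃ : InducedPath G k₃
    ends₁ : first (path P₁) ≡ x × last (path P₁) ≡ y
    ends₂ : first (path P₂) ≡ x × last (path P₂) ≡ y
    ends₃ : first (path P₃) ≡ x × last (path P₃) ≡ y
    apart₁₂ : InteriorsApart P₁ P₂
    apart₁₃ : InteriorsApart P₁ P₃
    apart₂₃ : InteriorsApart P₂ P₃

ThetaFree : Graph → Set
ThetaFree G = ¬ Theta G

-- Prism: P_i runs from a_i = first to b_i = last.

PrismRungs : ∀ {G k l} → InducedPath G k → InducedPath G l → Set
PrismRungs {G} P Q =
  (∀ i j → ipv P i ≢ ipv Q j) ×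
  E G (first (path P)) (first (path Q)) ×
  E G (last (path P)) (last (path Q)) ×
  (∀ i j → E G (ipv P i) (ipv Q j) →
     (ipv P i ≡ first (path P) × ipv Q j ≡ first (path Q)) ⊎
     (ipv P i ≡ last (path P) × ipv Q j ≡ last (path Q)))

record Prism (G : Graph) : Set where
  field
    k₁ k₂ k₃ : ℕ
    P₁ : InducedPath G k₁
    P₂ : InducedPath G k₂
    P₃ : InducedPath G k₃
    -- the triangles {a1,a2,a3} and {b1,b2,b3} are disjoint
    -- (a_i /= b_j for i /= j already follows from disjointness of the paths)
    disj₁ : first (path P₁) ≢ last (path P₁)
    disj₂ : first (path P₂) ≢ last (path P₂)
    disj₃ : first (path P₃) ≢ last (path P₃)
    r₁₂ : PrismRungs P₁ P₂
    r₁₃ : PrismRungs P₁ P₃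
    r₂₃ : PrismRungs P₂ P₃

PrismFree : Graph → Set
PrismFree G = ¬ Prism G

HasClique : (G : Graph) → ℕ → Set
HasClique G t =
  Σ (Fin t → V G) λ f → Injective _≡_ _≡_ f × (∀ i j → i ≢ j → E G (f i) (f j))

Separates : (G : Graph) → Subset (n G) → V G → V G → Set
Separates G M x y =
  x ∉ M × y ∉ M ×
  Σ (Subset (n G)) λ L → Σ (Subset (n G)) λ R →
    (∀ v → (v ∈ L × v ∉ M × v ∉ R) ⊎ (v ∉ L × v ∈ M × v ∉ R) ⊎ (v ∉ L × v ∉ M × v ∈ R)) ×
    x ∈ L × y ∈ R ×
    (∀ u v → u ∈ L → v ∈ R → ¬ E G u v)

record Cycle (F : Graph) : Set where
  field
    k   : ℕ
    len : 2 ≤ k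
    P   : Path (E F) k
    close : E F (last P) (first P)

IsTree : Graph → Set
IsTree F =
  1 ≤ n F ×
  (∀ u v → Σ ℕ λ k → Σ (Path (E F) k) λ P → first P ≡ u × last P ≡ v) ×
  ¬ Cycle F

IsCaterpillar : Graph → Set
IsCaterpillar F =
  IsTree F ×
  (∀ v → deg F v ≤ 3) ×
  Σ ℕ λ k → Σ (Path (E F) k) λ P → ∀ v → 2 < deg F v → Σ (Fin (suc k)) λ i → vtx P i ≡ v

record SGraph : Set₁ where
  field
    Vx  : Set
    _~_ : Vx → Vx → Set

open SGraph public

UEdge : Graph → Set
UEdge F = Σ (V F) λ u → Σ (V F) λ v → u Fin.< v × E F u v

subAdj : (F : Graph) → V F ⊎ UEdge F → V F ⊎ UEdge F → Set
subAdj F (inj₁ x) (inj₁ y) = ⊥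
subAdj F (inj₁ x) (inj₂ (u , v , _)) = x ≡ u ⊎ x ≡ v
subAdj F (inj₂ (u , v , _)) (inj₁ x) = x ≡ u ⊎ x ≡ v
subAdj F (inj₂ e) (inj₂ f) = ⊥

Subdivision : Graph → SGraph
Subdivision F = record { Vx = V F ⊎ UEdge F ; _~_ = subAdj F }

Arc : SGraph → Set
Arc K = Σ (Vx K) λ u → Σ (Vx K) λ v → _~_ K u v

src tgt : ∀ {K} → Arc K → Vx K
src (u , _ , _) = u
tgt (_ , v , _) = v

SameEdge : ∀ {K} → Arc K → Arc K → Set
SameEdge e f = (src e ≡ src f × tgt e ≡ tgt f) ⊎ (src e ≡ tgt f × tgt e ≡ src f)

ShareEnd : ∀ {K} → Arc K → Arc K → Set
ShareEnd e f = src e ≡ src f ⊎ src e ≡ tgt f ⊎ tgt e ≡ src f ⊎ tgt e ≡ tgt f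

-- (W, A) is isomorphic to the line graph L(K): φ is a bijection from W to
-- E(K) (each edge of K given by one of its orientations), and two vertices
-- are adjacent iff they are distinct and their edges share an end.
IsoToLineGraph : (W : Set) → (W → W → Set) → SGraph → Set
IsoToLineGraph W A K =
  Σ (W → Arc K) λ φ →
    (∀ w w' → SameEdge {K} (φ w) (φ w') → w ≡ w') ×
    (∀ (e : Arc K) → Σ W λ w → SameEdge {K} (φ w) e) ×
    (∀ w w' → (A w w' → w ≢ w' × ShareEnd {K} (φ w) (φ w')) ×
              (w ≢ w' × ShareEnd {K} (φ w) (φ w') → A w w'))

InducedV : (G : Graph) → Subset (n G) → Set
InducedV G H = Σ (V G) λ v → v ∈ H

InducedE : (G : Graph) (H : Subset (n G)) → InducedV G H → InducedV G H → Set
InducedE G H u v = E G (proj₁ u) (proj₁ v)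

Simplicial : (G : Graph) → Subset (n G) → V G → Set
Simplicial G H v =
  v ∈ H × (∀ u w → u ∈ H → w ∈ H → u ≢ w → E G v u → E G v w → E G u w)

Dist≤2 : (G : Graph) → V G → V G → Set
Dist≤2 G a u = a ≡ u ⊎ E G a u ⊎ Σ (V G) λ w → E G a w × E G w u

Trapped : (G : Graph) → V G → Subset (n G) → Set
Trapped G a H' =
  (∀ u → Dist≤2 G a u → u ∈ H') ×
  (∀ u → E G a u → degIn G H' u ≡ 2)

IsSeed : (G : Graph) → V G → Subset (n G) → Set
IsSeed G a H =
  a ∉ H ×
  (Σ Graph λ F → IsCaterpillar F ×
     IsoToLineGraph (InducedV G H) (InducedE G H) (Subdivision F)) ×
  (∀ v → (E G a v → Simplicial G H v) × (Simplicial G H v → E G a v)) ×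
  Trapped G a (H ∪ ⁅ a ⁆)

{-# OPTIONS --safe #-}
-- Write G′ = G ∖ a.  The neighbours of a ("terminals") have one neighbour in G′, and
-- three pairwise anticomplete arms from a vertex to terminals make a theta through a
-- (`claw`).  At a triangle b₁b₂b₃ of the seed, coming from a degree-three vertex of the
-- caterpillar, let C₁ be the largest connected set on b₁'s side that stays away from the
-- other two sides, and A = N(C₁).  Claws, and one prism, show that A is complete to the
-- boundary B of the right-hand component of G′ ∖ N[C₁ ∪ A] — or else, if some vertex of A
-- bypasses b₂ (or b₃), to the boundary B between A and the left terminals.  Either way A
-- and B both separate the left from the right terminals, and one of them is small: otherwise
-- Ramsey gives stable triples in both and a K₃,₃, hence a theta.  A small separator that
-- misses x cuts x off from the left or from the right terminals.  It can contain x for at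
-- most four spine positions, since x is then adjacent to that triangle and three such
-- triangles far apart form a claw at x.  Scanning along the spine, take consecutive usable
-- positions where x is cut off first from the left and then from the right; only boundedly
-- many terminals hang in between, and they join the separator.
module Submission where

open import Defs
open import Data.Nat using (ℕ; zero; suc; _+_; _*_; _≤_; _<_; _>_; z≤n; s≤s; z<s)
import Data.Nat.Properties as ℕₚ
open import Data.Bool using (Bool; true; false; T)
open import Data.Bool.Properties using (T?; T-irrelevant)
open import Data.Fin using (Fin; toℕ; fromℕ)
import Data.Fin as Fin
import Data.Fin.Properties as Finₚ
open import Data.Fin.Subset using (Subset; _∈_; _∉_; _∪_; ⁅_⁆; ∣_∣) renaming (⊥ to ∅)
open import Data.Fin.Subset.Properties
  using (_∈?_; ∣⁅x⁆∣≡1; ∣⊥∣≡0; x∈p∪q⁺; x∈p∪q⁻; x∈⁅x⁆; x∈⁅y⁆⇒x≡y; ∉⊥)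
open import Data.List using (List; []; _∷_; _++_; length; filter; concatMap; allFin; lookup)
import Data.List as List
open import Data.List.Properties using (length-++)
open import Data.List.Membership.Propositional using () renaming (_∈_ to _∈ₗ_; _∉_ to _∉ₗ_)
open import Data.List.Membership.Propositional.Properties
  using (∈-filter⁺; ∈-allFin; ∈-lookup; ∈-++⁺ˡ; ∈-++⁺ʳ; ∈-++⁻; ∈-concatMap⁺)
import Data.List.Membership.DecPropositional as DecMembership
open import Data.List.Relation.Unary.All as All using (All; []; _∷_)
import Data.List.Relation.Unary.All.Properties as Allₚ
open import Data.List.Relation.Unary.AllPairs using (AllPairs; []; _∷_)
import Data.List.Relation.Unary.AllPairs.Properties as AllPairsₚ
open import Data.List.Relation.Unary.Any as Any using () renaming (here to hereₐ; there to thereₐ)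
open import Data.List.Relation.Unary.Unique.Propositional using (Unique)
open import Data.List.Relation.Unary.Unique.Propositional.Properties using (allFin⁺)
import Data.Vec as Vec
import Data.Vec.Properties as Vecₚ
open import Data.Vec.Properties.WithK using ([]=-irrelevant)
open import Data.Product using (Σ; ∃₂; ∃-syntax; _×_; _,_; proj₁; proj₂)
open import Data.Sum using (_⊎_; inj₁; inj₂; [_,_]′)
open import Data.Empty using (⊥; ⊥-elim)
open import Data.Unit using (⊤; tt)
open import Function using (_∘_; id; case_of_)
open import Relation.Nullary using (¬_; Dec; yes; no; does; contradiction)
open import Relation.Nullary.Decidable using (_×-dec_; _⊎-dec_; ¬?; map′; decidable-stable; dec-true)
open import Relation.Unary using (Decidable)
open import Relation.Binary.Definitions using (tri<; tri≈; tri>)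
open import Relation.Binary.PropositionalEquality
  using (_≡_; _≢_; refl; trans; cong; cong₂; subst; subst₂) renaming (sym to ≡-sym)

-- As `x` is not adjacent to `a`, separating `a` from `x` means cutting `x` off, in the graph
-- without `a`, from every terminal; and no terminal equals `x`, so terminals may be put into the
-- separator freely. A cut at one triangle disposes of one side only. Hence two cuts are combined,
-- and the terminals between them are paid for singly: at most four hang at a spine vertex, and at
-- most six spine vertices matter, the two ends of the stretch and up to four between them. This is
-- the constant 24. The obstacle in the choice of B is that a bypassing vertex of A has neighbours
-- in the lobe on the other side, so that lobe no longer survives the removal of N[A]. B is then
-- sought on the left of A instead, and what makes it complete to A is that regular and bypassing
-- vertices of A are adjacent, the one consequence drawn from prism-freeness. Every set involved is
-- decidable, so an adjacency may be proved by refuting its negation.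

E? : ∀ G (u v : V G) → Dec (E G u v)
E? G u v = T? (adj G u v)

E-sym : ∀ G {u v} → E G u v → E G v u
E-sym G {u} {v} = subst T (sym G u v)

E-irrefl : ∀ G {u} → ¬ E G u u
E-irrefl G {u} e = subst T (irrefl G u) e

E⇒≢ : ∀ G {u v} → E G u v → u ≢ v
E⇒≢ G e refl = E-irrefl G e

-- Walks inside a vertex set

data Reach (G : Graph) (X : V G → Set) : V G → V G → Set where
  here : ∀ {u} → X u → Reach G X u u
  step : ∀ {u v w} → X u → E G u v → Reach G X v w → Reach G X u w

module _ {G : Graph} where

  reach-start : ∀ {X u v} → Reach G X u v → X u
  reach-start (here x) = x
  reach-start (step x _ _) = x

  reach-end : ∀ {X u v} → Reach G X u v → X v
  reach-end (here x) = x
  reach-end (step _ _ r) = reach-end r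

  reach-mono : ∀ {X Y u v} → (∀ {w} → X w → Y w) → Reach G X u v → Reach G Y u v
  reach-mono f (here x) = here (f x)
  reach-mono f (step x e r) = step (f x) e (reach-mono f r)

  reach-trans : ∀ {X u v w} → Reach G X u v → Reach G X v w → Reach G X u w
  reach-trans (here _) s = s
  reach-trans (step x e r) s = step x e (reach-trans r s)

  reach-snoc : ∀ {X u v w} → Reach G X u v → E G v w → X w → Reach G X u w
  reach-snoc r e x = reach-trans r (step (reach-end r) e (here x))

  reach-sym : ∀ {X u v} → Reach G X u v → Reach G X v u
  reach-sym (here x) = here x
  reach-sym (step x e r) = reach-snoc (reach-sym r) (E-sym G e) x

  reach-within : ∀ {X u v} → Reach G X u v → Reach G (Reach G X u) u v
  reach-within (here x) = here (here x)
  reach-within (step x e r) =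
    step (here x) e (reach-mono (step x e) (reach-within r))

  -- Cutting at the first vertex in `Hit` leaves a stretch that misses `Hit` altogether. With `Hit`
  -- chosen as a set together with its neighbours, that stretch is anticomplete to the set being
  -- approached.
  first-hit : ∀ {X Hit} → Decidable Hit → ∀ {u v} → Reach G X u v → Hit v →
    ∃[ w ] X w × Hit w ×
      (u ≡ w ⊎ ∃[ q ] Reach G (λ y → X y × ¬ Hit y) u q × E G q w)
  first-hit hit? {u} r h with hit? u
  ... | yes hu = u , reach-start r , hu , inj₁ refl
  first-hit hit? (here x) h | no ¬hu = contradiction h ¬hu
  first-hit hit? (step {u} x e r) h | no ¬hu with first-hit hit? r h
  ... | w , xw , hw , inj₁ refl = w , xw , hw , inj₂ (u , here (x , ¬hu) , e)
  ... | w , xw , hw , inj₂ (q , s , e′) = w , xw , hw , inj₂ (q , step (x , ¬hu) e s , e′)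

  last-exit : ∀ {X u v} → Reach G X u v → u ≢ v →
    ∃[ q ] E G u q × Reach G (λ y → X y × y ≢ u) q v
  last-exit {X} {u} r u≢v with go r
    where
    go : ∀ {w v} → Reach G X w v → u ≡ v ⊎ Reach G (λ y → X y × y ≢ u) w v ⊎
           ∃[ q ] E G u q × Reach G (λ y → X y × y ≢ u) q v
    go {w} (here x) with u Finₚ.≟ w
    ... | yes eq = inj₁ eq
    ... | no u≢w = inj₂ (inj₁ (here (x , u≢w ∘ ≡-sym)))
    go {w} (step x e r) with go r
    ... | inj₁ eq = inj₁ eq
    ... | inj₂ (inj₂ q) = inj₂ (inj₂ q)
    ... | inj₂ (inj₁ s) with u Finₚ.≟ w
    ...   | yes refl = inj₂ (inj₂ (_ , e , s))
    ...   | no u≢w = inj₂ (inj₁ (step (x , u≢w ∘ ≡-sym) e s))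
  ... | inj₁ eq = contradiction eq u≢v
  ... | inj₂ (inj₁ s) = contradiction refl (proj₂ (reach-start s))
  ... | inj₂ (inj₂ q) = q

-- Induced paths and the decidability of reachability

Off : ∀ G → V G → V G → Set
Off G u v = u ≢ v × ¬ E G u v

off-sym : ∀ G {u v} → Off G u v → Off G v u
off-sym G (ne , na) = ne ∘ ≡-sym , na ∘ E-sym G

Ind : ∀ G → V G → List (V G) → Set
Ind G u [] = ⊤
Ind G u (v ∷ xs) = E G u v × All (Off G u) xs × Ind G v xs

end : {A : Set} → A → List A → A
end u [] = u
end u (v ∷ xs) = end v xs

-- An index past the end gives the last vertex, so `at-all` needs no bound on the index.
at : {A : Set} → A → List A → ℕ → A
at u xs zero = u
at u [] (suc i) = u
at u (v ∷ xs) (suc i) = at v xs i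

at-all : ∀ {A : Set} {X : A → Set} {u xs} → All X (u ∷ xs) → ∀ i → X (at u xs i)
at-all (x ∷ _) zero = x
at-all (x ∷ []) (suc i) = x
at-all (_ ∷ (y ∷ ys)) (suc i) = at-all (y ∷ ys) i

at-end : ∀ {A : Set} (u : A) xs → at u xs (length xs) ≡ end u xs
at-end u [] = refl
at-end u (v ∷ xs) = at-end v xs

-- Indexed by all of ℕ to spare `Fin` arithmetic. `gap` combines distinctness with chordlessness,
-- for positions up to `len`.
record InducedWalk (G : Graph) (X : V G → Set) (u t : V G) : Set where
  field
    len    : ℕ
    r      : ℕ → V G
    r-0    : r 0 ≡ u
    r-len  : r len ≡ t
    inside : ∀ i → X (r i)
    link   : ∀ {i} → i < len → E G (r i) (r (suc i))
    gap    : ∀ {i j} → i < j → j ≤ len → r i ≢ r j × (E G (r i) (r j) → j ≡ suc i)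

module _ {G : Graph} where

  -- Prepending u to an induced path shortcuts to the last vertex adjacent to u.
  attach : ∀ {X : V G → Set} u v xs → All X (v ∷ xs) → Ind G v xs →
    All (Off G u) (v ∷ xs) ⊎ (∃[ ys ] Ind G u ys × end u ys ≡ end v xs × All X ys)
  attach u v [] (x ∷ []) _ with u Finₚ.≟ v
  ... | yes refl = inj₂ ([] , tt , refl , [])
  ... | no u≢v with E? G u v
  ...   | yes e = inj₂ (v ∷ [] , (e , [] , tt) , refl , x ∷ [])
  ...   | no ¬e = inj₁ ((u≢v , ¬e) ∷ [])
  attach u v (w ∷ xs) (x ∷ al) (e , off , ind) with attach u w xs al ind
  ... | inj₂ found = inj₂ found
  ... | inj₁ none with E? G u v
  ...   | yes uv = inj₂ (v ∷ w ∷ xs , (uv , none , e , off , ind) , refl , x ∷ al)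
  ...   | no ¬uv with u Finₚ.≟ v
  ...     | yes refl = contradiction e (proj₂ (All.head none))
  ...     | no u≢v = inj₁ ((u≢v , ¬uv) ∷ none)

  induced-list : ∀ {X u t} → Reach G X u t → ∃[ xs ] Ind G u xs × end u xs ≡ t × All X (u ∷ xs)
  induced-list (here x) = [] , tt , refl , x ∷ []
  induced-list {X} {u} (step {v = v} x e r) with induced-list r
  ... | xs , ind , en , al with attach u v xs al ind
  ...   | inj₁ none = contradiction e (proj₂ (All.head none))
  ...   | inj₂ (ys , ind′ , en′ , al′) = ys , ind′ , trans en′ en , x ∷ al′

  ind-link : ∀ u xs → Ind G u xs → ∀ {i} → i < length xs → E G (at u xs i) (at u xs (suc i))
  ind-link u (v ∷ xs) (e , _) {zero} _ = e
  ind-link u (v ∷ xs) (_ , _ , ind) {suc i} (s≤s lt) = ind-link v xs ind lt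

  all-at : ∀ {P : V G → Set} v xs → All P xs → ∀ i → i < length xs → P (at v xs (suc i))
  all-at v (w ∷ xs) (p ∷ ps) zero _ = p
  all-at v (w ∷ xs) (p ∷ ps) (suc i) (s≤s lt) = all-at w xs ps i lt

  ind-gap : ∀ u xs → Ind G u xs → ∀ {i j} → i < j → j ≤ length xs →
    at u xs i ≢ at u xs j × (E G (at u xs i) (at u xs j) → j ≡ suc i)
  ind-gap u (v ∷ xs) (e , off , ind) {zero} {suc zero} _ _ = E⇒≢ G e , λ _ → refl
  ind-gap u (v ∷ xs) (e , off , ind) {zero} {suc (suc j)} _ (s≤s le)
    with all-at v xs off j le
  ... | ne , na = ne , λ e′ → contradiction e′ na
  ind-gap u (v ∷ xs) (e , off , ind) {suc i} {suc j} (s≤s lt) (s≤s le)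
    with ind-gap v xs ind lt le
  ... | ne , f = ne , cong suc ∘ f

  induced-walk : ∀ {X u t} → Reach G X u t → InducedWalk G X u t
  induced-walk {u = u} reach with induced-list reach
  ... | xs , ind , en , al = record
    { len = length xs ; r = at u xs ; r-0 = refl ; r-len = trans (at-end u xs) en
    ; inside = at-all al ; link = ind-link u xs ind ; gap = ind-gap u xs ind }

  module _ {X : V G → Set} {u t : V G} (W : InducedWalk G X u t) where
    open InducedWalk W

    private
      bound : ∀ (i : Fin (suc len)) → toℕ i ≤ len
      bound i = ℕₚ.≤-pred (Finₚ.toℕ<n i)

    walk-injective : ∀ {i j} → i ≤ len → j ≤ len → r i ≡ r j → i ≡ j
    walk-injective {i} {j} i≤ j≤ eq with ℕₚ.<-cmp i j
    ... | tri< lt _ _ = contradiction eq (proj₁ (gap lt j≤))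
    ... | tri≈ _ e _ = e
    ... | tri> _ _ gt = contradiction (≡-sym eq) (proj₁ (gap gt i≤))

    walk-consecutive : ∀ {i j} → i ≤ len → j ≤ len → E G (r i) (r j) → i ≡ suc j ⊎ j ≡ suc i
    walk-consecutive {i} {j} i≤ j≤ e with ℕₚ.<-cmp i j
    ... | tri< lt _ _ = inj₂ (proj₂ (gap lt j≤) e)
    ... | tri≈ _ refl _ = ⊥-elim (E-irrefl G e)
    ... | tri> _ _ gt = inj₁ (proj₂ (gap gt i≤) (E-sym G e))

    to-path : InducedPath G len
    to-path = record
      { path = record
        { vtx = r ∘ toℕ
        ; inj = λ {i} {j} eq → Finₚ.toℕ-injective (walk-injective (bound i) (bound j) eq)
        ; cons = links }
      ; induced = λ i j → walk-consecutive (bound i) (bound j) }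
      where
      links : ∀ (i j : Fin (suc len)) → Consecutive i j → E G (r (toℕ i)) (r (toℕ j))
      links i j (inj₁ eq) rewrite eq = E-sym G (link (subst (_≤ len) eq (bound i)))
      links i j (inj₂ eq) rewrite eq = link (subst (_≤ len) eq (bound j))

    to-path-ends : first (path to-path) ≡ u × last (path to-path) ≡ t
    to-path-ends = r-0 , trans (cong r (Finₚ.toℕ-fromℕ len)) r-len

    segment : ∀ {Y : V G → Set} {lo hi} → lo ≤ hi → hi ≤ len →
      (∀ {m} → lo ≤ m → m ≤ hi → Y (r m)) → Reach G Y (r lo) (r hi)
    segment {Y} {lo} {zero} z≤n _ f = here (f z≤n z≤n)
    segment {Y} {lo} {suc hi} le hi≤ f with ℕₚ.m≤n⇒m<n∨m≡n le
    ... | inj₂ refl = here (f ℕₚ.≤-refl ℕₚ.≤-refl)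
    ... | inj₁ (s≤s lo≤) =
      reach-snoc (segment lo≤ (ℕₚ.<⇒≤ hi≤) (λ a b → f a (ℕₚ.m≤n⇒m≤1+n b))) (link hi≤) (f le ℕₚ.≤-refl)

  within : (V G → Set) → ℕ → V G → V G → Set
  within X zero u v = X u × u ≡ v
  within X (suc k) u v = X u × (u ≡ v ⊎ ∃[ w ] E G u w × within X k w v)

  within? : ∀ {X} → Decidable X → ∀ k u v → Dec (within X k u v)
  within? X? zero u v = X? u ×-dec (u Finₚ.≟ v)
  within? X? (suc k) u v =
    X? u ×-dec ((u Finₚ.≟ v) ⊎-dec Finₚ.any? (λ w → E? G u w ×-dec within? X? k w v))

  within⇒reach : ∀ {X} k {u v} → within X k u v → Reach G X u v
  within⇒reach zero (x , refl) = here x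
  within⇒reach (suc k) (x , inj₁ refl) = here x
  within⇒reach (suc k) (x , inj₂ (w , e , p)) = step x e (within⇒reach k p)

  ind⇒within : ∀ {X} k u xs → length xs ≤ k → Ind G u xs → All X (u ∷ xs) →
    within X k u (end u xs)
  ind⇒within zero u [] _ _ (x ∷ _) = x , refl
  ind⇒within (suc k) u [] _ _ (x ∷ _) = x , inj₁ refl
  ind⇒within (suc k) u (v ∷ xs) (s≤s le) (e , _ , ind) (x ∷ al) =
    x , inj₂ (v , e , ind⇒within k v xs le ind al)

  ind-length : ∀ u xs → Ind G u xs → length xs ≤ n G
  ind-length u xs ind = ℕₚ.<⇒≤ (Finₚ.injective⇒≤ {f = at u xs ∘ toℕ} inject)
    where
    bound : ∀ (i : Fin (suc (length xs))) → toℕ i ≤ length xs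
    bound i = ℕₚ.≤-pred (Finₚ.toℕ<n i)
    inject : ∀ {i j : Fin (suc (length xs))} → at u xs (toℕ i) ≡ at u xs (toℕ j) → i ≡ j
    inject {i} {j} eq with ℕₚ.<-cmp (toℕ i) (toℕ j)
    ... | tri< lt _ _ = contradiction eq (proj₁ (ind-gap u xs ind lt (bound j)))
    ... | tri≈ _ e _ = Finₚ.toℕ-injective e
    ... | tri> _ _ gt = contradiction (≡-sym eq) (proj₁ (ind-gap u xs ind gt (bound i)))

  -- A walk shortens to an induced path, whose vertices are distinct, so a search of depth `n G`
  -- suffices. All components and boundaries below become decidable through this.
  reach? : ∀ {X} → Decidable X → ∀ u v → Dec (Reach G X u v)
  reach? X? u v = map′ (within⇒reach (n G)) bounded (within? X? (n G) u v)
    where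
    bounded : Reach G _ u v → within _ (n G) u v
    bounded reach with induced-list reach
    ... | xs , ind , refl , al = ind⇒within (n G) u xs (ind-length u xs ind) ind al

-- Anticomplete sets, thetas and prisms

Apart : ∀ G → (V G → Set) → (V G → Set) → Set
Apart G X Y = ∀ {p q} → X p → Y q → Off G p q

apart-sym : ∀ G {X Y} → Apart G X Y → Apart G Y X
apart-sym G f y x = off-sym G (f x y)

_▹_ : {A : Set} → A → (A → Set) → A → Set
(v ▹ X) w = w ≡ v ⊎ X w

infixr 5 _▹_

_⋓_ : {A : Set} → (A → Set) → (A → Set) → A → Set
(X ⋓ Y) w = X w ⊎ Y w

apart-▹ : ∀ G {v X Y} → (∀ {q} → Y q → Off G v q) → Apart G X Y → Apart G (v ▹ X) Y
apart-▹ G f g (inj₁ refl) = f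
apart-▹ G f g (inj₂ x) = g x

module _ {G : Graph} where

  walk-interior : ∀ {X x y} (W : InducedWalk G (x ▹ y ▹ X) x y) →
    ∀ {i} → 0 < i → i < InducedWalk.len W → X (InducedWalk.r W i)
  walk-interior W {i} 0<i i<k with InducedWalk.inside W i
  ... | inj₁ eq = contradiction (trans (InducedWalk.r-0 W) (≡-sym eq))
                    (proj₁ (InducedWalk.gap W 0<i (ℕₚ.<⇒≤ i<k)))
  ... | inj₂ (inj₁ eq) = contradiction (trans eq (≡-sym (InducedWalk.r-len W)))
                    (proj₁ (InducedWalk.gap W i<k ℕₚ.≤-refl))
  ... | inj₂ (inj₂ p) = p

  module _ {x y : V G} (x≢y : x ≢ y) (x≁y : ¬ E G x y) where

    walk-length≥2 : ∀ {X} (W : InducedWalk G X x y) → 2 ≤ InducedWalk.len W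
    walk-length≥2 W = go len r-len link
      where
      open InducedWalk W
      go : ∀ k → r k ≡ y → (∀ {i} → i < k → E G (r i) (r (suc i))) → 2 ≤ k
      go 0 eq _ = contradiction (trans (≡-sym r-0) eq) x≢y
      go 1 eq l = contradiction (subst₂ (E G) r-0 eq (l z<s)) x≁y
      go (suc (suc k)) _ _ = s≤s (s≤s z≤n)

    -- Only the carrier sets have to be anticomplete: the walks are shortened to induced paths,
    -- which visit `x` and `y` just at their ends, so their interiors stay in `X`, `Y` and `Z`.
    build-theta : ∀ {X Y Z} → Reach G (x ▹ y ▹ X) x y → Reach G (x ▹ y ▹ Y) x y →
      Reach G (x ▹ y ▹ Z) x y → Apart G X Y → Apart G X Z → Apart G Y Z → Theta G
    build-theta {X} {Y} {Z} p q s XY XZ YZ = record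
      { x = x ; y = y ; nonadj = x≁y
      ; len₁ = walk-length≥2 P ; len₂ = walk-length≥2 Q ; len₃ = walk-length≥2 S
      ; P₁ = to-path P ; P₂ = to-path Q ; P₃ = to-path S
      ; ends₁ = to-path-ends P ; ends₂ = to-path-ends Q ; ends₃ = to-path-ends S
      ; apart₁₂ = apart P Q XY ; apart₁₃ = apart P S XZ ; apart₂₃ = apart Q S YZ }
      where
      P : InducedWalk G (x ▹ y ▹ X) x y
      P = induced-walk p
      Q : InducedWalk G (x ▹ y ▹ Y) x y
      Q = induced-walk q
      S : InducedWalk G (x ▹ y ▹ Z) x y
      S = induced-walk s
      apart : ∀ {X Y} (P : InducedWalk G (x ▹ y ▹ X) x y) (Q : InducedWalk G (x ▹ y ▹ Y) x y) →
        Apart G X Y → InteriorsApart (to-path P) (to-path Q)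
      apart P Q f i j (0<i , i<k) (0<j , j<l) =
        f (walk-interior P 0<i i<k) (walk-interior Q 0<j j<l)

  -- Stated for whole sets because the paths of the prism are obtained only afterwards, by
  -- shortening walks inside these sets.
  record Rung (X Y : V G → Set) (u₁ v₁ u₂ v₂ : V G) : Set where
    field
      top : E G u₁ u₂
      bot : E G v₁ v₂
      only : ∀ {p q} → X p → Y q → p ≢ q × (E G p q → (p ≡ u₁ × q ≡ u₂) ⊎ (p ≡ v₁ × q ≡ v₂))

  build-prism : ∀ {X Y Z u₁ v₁ u₂ v₂ u₃ v₃} →
    Reach G X u₁ v₁ → Reach G Y u₂ v₂ → Reach G Z u₃ v₃ →
    u₁ ≢ v₁ → u₂ ≢ v₂ → u₃ ≢ v₃ →
    Rung X Y u₁ v₁ u₂ v₂ → Rung X Z u₁ v₁ u₃ v₃ → Rung Y Z u₂ v₂ u₃ v₃ → Prism G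
  build-prism {X} {Y} {Z} p q s n₁ n₂ n₃ XY XZ YZ = record
    { P₁ = to-path P ; P₂ = to-path Q ; P₃ = to-path S
    ; disj₁ = disj P n₁ ; disj₂ = disj Q n₂ ; disj₃ = disj S n₃
    ; r₁₂ = rungs P Q XY ; r₁₃ = rungs P S XZ ; r₂₃ = rungs Q S YZ }
    where
    P : InducedWalk G X _ _
    P = induced-walk p
    Q : InducedWalk G Y _ _
    Q = induced-walk q
    S : InducedWalk G Z _ _
    S = induced-walk s
    disj : ∀ {X u v} (P : InducedWalk G X u v) → u ≢ v →
      first (path (to-path P)) ≢ last (path (to-path P))
    disj P ne eq = ne (trans (≡-sym (proj₁ (to-path-ends P))) (trans eq (proj₂ (to-path-ends P))))
    rungs : ∀ {X Y u v u′ v′} (P : InducedWalk G X u v) (Q : InducedWalk G Y u′ v′) →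
      Rung X Y u v u′ v′ → PrismRungs (to-path P) (to-path Q)
    rungs P Q R =
        (λ i j → proj₁ (Rung.only R (inside P (toℕ i)) (inside Q (toℕ j))))
      , subst₂ (E G) (≡-sym P0) (≡-sym Q0) (Rung.top R)
      , subst₂ (E G) (≡-sym P1) (≡-sym Q1) (Rung.bot R)
      , λ i j e → case proj₂ (Rung.only R (inside P (toℕ i)) (inside Q (toℕ j))) e of λ where
          (inj₁ (a , b)) → inj₁ (trans a (≡-sym P0) , trans b (≡-sym Q0))
          (inj₂ (a , b)) → inj₂ (trans a (≡-sym P1) , trans b (≡-sym Q1))
      where
      open InducedWalk using (inside)
      P0 = proj₁ (to-path-ends P)
      P1 = proj₂ (to-path-ends P)
      Q0 = proj₁ (to-path-ends Q)
      Q1 = proj₂ (to-path-ends Q)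

-- Extremal indices and a Ramsey bound

least : ∀ {P : ℕ → Set} → Decidable P → ∀ {m} → P m →
  ∃[ i ] P i × i ≤ m × (∀ {l} → l < i → ¬ P l)
least P? {zero} p = 0 , p , z≤n , λ ()
least {P} P? {suc m} p with P? 0
... | yes p₀ = 0 , p₀ , z≤n , λ ()
... | no ¬p₀ with least {P ∘ suc} (P? ∘ suc) p
...   | i , pi , i≤m , f = suc i , pi , s≤s i≤m , below
  where
  below : ∀ {l} → l < suc i → ¬ P l
  below {zero} _ = ¬p₀
  below {suc l} (s≤s lt) = f lt

greatest : ∀ {P : ℕ → Set} → Decidable P → ∀ k {m} → m ≤ k → P m →
  ∃[ j ] P j × m ≤ j × j ≤ k × (∀ {l} → j < l → l ≤ k → ¬ P l)
greatest P? zero z≤n p = 0 , p , z≤n , z≤n , λ where (s≤s _) ()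
greatest P? (suc k) {m} m≤ p with P? (suc k)
... | yes q = suc k , q , m≤ , ℕₚ.≤-refl , λ lt le → contradiction (ℕₚ.<-≤-trans lt le) (ℕₚ.<-irrefl refl)
... | no ¬q with ℕₚ.m≤n⇒m<n∨m≡n m≤
...   | inj₂ refl = contradiction p ¬q
...   | inj₁ (s≤s m≤k) with greatest P? k m≤k p
...     | j , pj , m≤j , j≤k , f = j , pj , m≤j , ℕₚ.m≤n⇒m≤1+n j≤k , λ {l} lt le →
          case ℕₚ.m≤n⇒m<n∨m≡n le of λ where
            (inj₂ refl) → ¬q
            (inj₁ (s≤s le′)) → f lt le′

-- The bound t(t+1)/2 for a clique of size t against a stable triple: one chosen vertex, up to `t`
-- non-neighbours of it, and `ramsey t` neighbours to recurse on.
ramsey : ℕ → ℕ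
ramsey zero = 0
ramsey (suc t) = suc (t + ramsey t)

length-filter-split : ∀ {A : Set} {P : A → Set} (P? : Decidable P) xs →
  length (filter P? xs) + length (filter (¬? ∘ P?) xs) ≡ length xs
length-filter-split P? [] = refl
length-filter-split P? (x ∷ xs) with P? x
... | yes _ = cong suc (length-filter-split P? xs)
... | no _ = trans (ℕₚ.+-suc _ _) (cong suc (length-filter-split P? xs))

module _ (G : Graph) where

  Clique : (V G → Set) → ℕ → Set
  Clique X t = ∃[ ys ] t ≤ length ys × AllPairs (E G) ys × All X ys

  StablePair StableTriple : (V G → Set) → Set
  StablePair X = ∃₂ λ p q → X p × X q × Off G p q
  StableTriple X = ∃[ p ] X p × StablePair (λ q → X q × Off G p q)

  all-adjacent : ∀ {X} xs → All X xs → Unique xs → AllPairs (E G) xs ⊎ StablePair X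
  all-adjacent [] _ _ = inj₁ []
  all-adjacent (x ∷ xs) (px ∷ pxs) (ne ∷ u) with all-adjacent xs pxs u
  ... | inj₂ pair = inj₂ pair
  ... | inj₁ ap with All.all? (E? G x) xs
  ...   | yes al = inj₁ (al ∷ ap)
  ...   | no ¬al = inj₂ (found xs pxs ne ¬al)
    where
    found : ∀ ys → All _ ys → All (x ≢_) ys → ¬ All (E G x) ys → StablePair _
    found [] _ _ ¬al = contradiction [] ¬al
    found (y ∷ ys) (py ∷ pys) (x≢y ∷ ne) ¬al with E? G x y
    ... | yes e = found ys pys ne (λ al → ¬al (e ∷ al))
    ... | no ¬e = x , y , px , py , x≢y , ¬e

  -- The non-neighbours of a vertex contain a non-adjacent pair or form a clique.
  clique-or-stable-triple : ∀ t {X} xs → All X xs → Unique xs → ramsey t ≤ length xs →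
    Clique X t ⊎ StableTriple X
  clique-or-stable-triple zero xs _ _ _ = inj₁ ([] , z≤n , [] , [])
  clique-or-stable-triple (suc t) {X} (x ∷ xs) (px ∷ pxs) (ne ∷ u) (s≤s le)
    with ℕₚ.≤-<-connex (suc t) (length (filter (¬? ∘ E? G x) xs))
  ... | inj₁ many with all-adjacent (filter (¬? ∘ E? G x) xs)
                         (All.zip (All.zip (Allₚ.filter⁺ (¬? ∘ E? G x) pxs ,
                           Allₚ.filter⁺ (¬? ∘ E? G x) ne) , Allₚ.all-filter (¬? ∘ E? G x) xs))
                         (AllPairsₚ.filter⁺ (¬? ∘ E? G x) u)
  ...   | inj₁ ap = inj₁ (_ , many , ap , Allₚ.filter⁺ (¬? ∘ E? G x) pxs)
  ...   | inj₂ (p , q , ((Xp , x≢p) , x≁p) , ((Xq , x≢q) , x≁q) , off) =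
          inj₂ (x , px , p , q , (Xp , x≢p , x≁p) , (Xq , x≢q , x≁q) , off)
  clique-or-stable-triple (suc t) {X} (x ∷ xs) (px ∷ pxs) (ne ∷ u) (s≤s le)
    | inj₂ (s≤s few) = extend (clique-or-stable-triple t (filter (E? G x) xs)
        (All.zip (Allₚ.filter⁺ (E? G x) pxs , Allₚ.all-filter (E? G x) xs))
        (AllPairsₚ.filter⁺ (E? G x) u) enough)
    where
    open ℕₚ.≤-Reasoning
    enough : ramsey t ≤ length (filter (E? G x) xs)
    enough = ℕₚ.+-cancelˡ-≤ t _ _ (begin
      t + ramsey t ≤⟨ le ⟩
      length xs ≡⟨ length-filter-split (E? G x) xs ⟨
      length (filter (E? G x) xs) + length (filter (¬? ∘ E? G x) xs) ≤⟨ ℕₚ.+-monoʳ-≤ _ few ⟩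
      length (filter (E? G x) xs) + t ≡⟨ ℕₚ.+-comm _ t ⟩
      t + length (filter (E? G x) xs) ∎)
    extend : Clique (λ y → X y × E G x y) t ⊎ StableTriple (λ y → X y × E G x y) →
      Clique X (suc t) ⊎ StableTriple X
    extend (inj₁ (ys , t≤ , ap , al)) =
      inj₁ (x ∷ ys , s≤s t≤ , All.map proj₂ al ∷ ap , px ∷ All.map proj₁ al)
    extend (inj₂ (p , (Xp , _) , q , r , ((Xq , _) , pq) , ((Xr , _) , pr) , off)) =
      inj₂ (p , Xp , q , r , (Xq , pq) , (Xr , pr) , off)

  clique⇒HasClique : ∀ {X t} → Clique X t → HasClique G t
  clique⇒HasClique {t = t} (ys , t≤ , ap , _) =
    f , (λ {i} {j} → injective {i} {j}) , λ i j i≢j → pair ys ap (λ eq → i≢j (Finₚ.inject≤-injective t≤ t≤ i j eq))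
    where
    f : Fin t → V G
    f i = lookup ys (Fin.inject≤ i t≤)
    pair : ∀ ys → AllPairs (E G) ys → ∀ {i j} → i ≢ j → E G (lookup ys i) (lookup ys j)
    pair (y ∷ ys) (al ∷ ap) {Fin.zero} {Fin.zero} ne = contradiction refl ne
    pair (y ∷ ys) (al ∷ ap) {Fin.zero} {Fin.suc j} ne = All.lookup al (∈-lookup j)
    pair (y ∷ ys) (al ∷ ap) {Fin.suc i} {Fin.zero} ne = E-sym G (All.lookup al (∈-lookup i))
    pair (y ∷ ys) (al ∷ ap) {Fin.suc i} {Fin.suc j} ne = pair ys ap (λ eq → ne (cong Fin.suc eq))
    injective : ∀ {i j} → f i ≡ f j → i ≡ j
    injective {i} {j} eq with i Finₚ.≟ j
    ... | yes e = e
    ... | no i≢j = contradiction eq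
            (E⇒≢ G (pair ys ap (λ e → i≢j (Finₚ.inject≤-injective t≤ t≤ i j e))))

  members : {X : V G → Set} → Decidable X → List (V G)
  members X? = filter X? (allFin (n G))

  members-all : ∀ {X} (X? : Decidable X) → All X (members X?)
  members-all X? = Allₚ.all-filter X? (allFin (n G))

  ∈-members : ∀ {X} (X? : Decidable X) {v} → X v → v ∈ₗ members X?
  ∈-members X? x = ∈-filter⁺ X? (∈-allFin _) x

  -- Stable triples on both sides of a complete pair would span a K₃,₃.
  complete-pair-small : ∀ {t A B} → ThetaFree G → ¬ HasClique G t →
    (A? : Decidable A) (B? : Decidable B) → (∀ {p q} → A p → B q → E G p q) →
    length (members A?) ≤ ramsey t ⊎ length (members B?) ≤ ramsey t
  complete-pair-small {t} {A} {B} tf nc A? B? complete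
    with ℕₚ.≤-total (length (members A?)) (ramsey t) | ℕₚ.≤-total (length (members B?)) (ramsey t)
  ... | inj₁ le | _ = inj₁ le
  ... | inj₂ _ | inj₁ le = inj₂ le
  ... | inj₂ manyA | inj₂ manyB = ⊥-elim (K₃₃ (triple A? manyA) (triple B? manyB))
    where
    triple : ∀ {X} (X? : Decidable X) → ramsey t ≤ length (members X?) → StableTriple X
    triple X? le with clique-or-stable-triple t (members X?) (members-all X?)
                        (AllPairsₚ.filter⁺ X? (allFin⁺ (n G))) le
    ... | inj₁ c = contradiction (clique⇒HasClique c) nc
    ... | inj₂ s = s
    K₃₃ : StableTriple A → StableTriple B → ⊥
    K₃₃ (x , Ax , y , _ , (Ay , x≢y , x≁y) , _) (p , Bp , q , r , (Bq , pq) , (Br , pr) , qr) =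
      tf (build-theta x≢y x≁y (via Bp) (via Bq) (via Br)
        (λ { refl refl → pq }) (λ { refl refl → pr }) (λ { refl refl → qr }))
      where
      via : ∀ {v} → B v → Reach G (x ▹ y ▹ (_≡ v)) x y
      via b = step (inj₁ refl) (complete Ax b) (step (inj₂ (inj₂ refl))
        (E-sym G (complete Ay b)) (here (inj₂ (inj₁ refl))))

-- Claws, and terminals attached to an induced path

module Rooted (G : Graph) (tf : ThetaFree G) (pf : PrismFree G) (a : V G)
  (pendant : ∀ {z u v} → E G a z → E G z u → E G z v → u ≢ a → v ≢ a → u ≡ v) where

  Term : V G → Set
  Term z = E G a z

  -- One leg of a claw at `v`. As `a` is adjacent to the tip, it extends to a walk from `v` to `a`.
  record Arm (v : V G) (X : V G → Set) : Set where
    constructor arm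
    field
      {start tip} : V G
      attached : E G v start
      walk     : Reach G X start tip
      terminal : Term tip

  arm-start : ∀ {v X} (A : Arm v X) → X (Arm.start A)
  arm-start A = reach-start (Arm.walk A)

  arm-mono : ∀ {v X Y} → (∀ {w} → X w → Y w) → Arm v X → Arm v Y
  arm-mono f (arm e r t) = arm e (reach-mono f r) t

  arm-▹ : ∀ {v w X} → E G v w → Arm w X → Arm v (w ▹ X)
  arm-▹ e (arm e′ r t) = arm e (step (inj₁ refl) e′ (reach-mono inj₂ r)) t

  Lobe : (V G → Set) → Set
  Lobe X = ∀ {u} → X u → ∃[ z ] Term z × Reach G X u z

  lobe-arm : ∀ {v u X} → Lobe X → X u → E G v u → Arm v X
  lobe-arm L x e with L x
  ... | _ , t , r = arm e r t

  not-term : ∀ {v u w} → E G v u → E G v w → u ≢ a → w ≢ a → u ≢ w → ¬ Term v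
  not-term vu vw u≢a w≢a u≢w t = u≢w (pendant t vu vw u≢a w≢a)

  -- The theta has ends `v` and `a`. They are non-adjacent because two arms already give `v` two
  -- neighbours other than `a`, more than a terminal has.
  claw : ∀ {v X Y Z} → v ≢ a → Arm v X → Arm v Y → Arm v Z →
    Apart G X Y → Apart G X Z → Apart G Y Z → ⊥
  claw {v} {X} {Y} {Z} v≢a A B C XY XZ YZ =
    tf (build-theta v≢a (nt ∘ E-sym G) (leg A) (leg B) (leg C) XY XZ YZ)
    where
    -- `a` is adjacent to the tip of every arm, so it lies in no set anticomplete to the carrier of
    -- an arm.
    ≢a : ∀ {W U u} → Apart G W U → Arm v U → W u → u ≢ a
    ≢a f D w refl = proj₂ (f w (reach-end (Arm.walk D))) (Arm.terminal D)
    nt : ¬ Term v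
    nt = not-term (Arm.attached A) (Arm.attached B)
      (≢a XY B (arm-start A)) (≢a (apart-sym G XY) A (arm-start B))
      (proj₁ (XY (arm-start A) (arm-start B)))
    leg : ∀ {X} → Arm v X → Reach G (v ▹ a ▹ X) v a
    leg (arm e r t) =
      step (inj₁ refl) e (reach-snoc (reach-mono (inj₂ ∘ inj₂) r) (E-sym G t) (inj₂ (inj₁ refl)))

  record Triangle {X p q} (W : InducedWalk G X p q) (C : V G → Set) : Set₁ where
    open InducedWalk W
    field
      i      : ℕ
      i<len  : i < len
      {s z}  : V G
      F      : V G → Set
      left   : E G s (r i)
      right  : E G s (r (suc i))
      only   : ∀ {m} → m ≤ len → E G s (r m) → m ≡ i ⊎ m ≡ suc i
      s-off  : ∀ {m} → m ≤ len → s ≢ r m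
      F-off  : ∀ {v m} → F v → m ≤ len → Off G v (r m)
      inC    : ∀ {v} → (s ▹ F) v → C v
      term   : Term z
      walk   : Reach G (s ▹ F) s z

  -- Three terminals attached to an induced path at both ends and somewhere in
  -- between avoid a claw only if the middle attachment is a triangle.
  module _ {C Ep Eq : V G → Set} {p q z c : V G} (W : InducedWalk G (p ▹ q ▹ C) p q)
    (p≢a : p ≢ a) (q≢a : q ≢ a) (C≢a : ∀ {v} → C v → v ≢ a) (p∉C : ¬ C p) (q∉C : ¬ C q)
    (reach : Reach G C z c) (tz : Term z) (pc : E G p c)
    (armp : Arm p Ep) (armq : Arm q Eq)
    (Ep-C : Apart G Ep C) (Eq-C : Apart G Eq C) (Ep-Eq : Apart G Ep Eq)
    (Ep-q : ∀ {v} → Ep v → Off G v q) (Eq-p : ∀ {v} → Eq v → Off G v p) where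
    open InducedWalk W

    private
      ≢a : ∀ i → r i ≢ a
      ≢a i eq with inside i
      ... | inj₁ e = p≢a (trans (≡-sym e) eq)
      ... | inj₂ (inj₁ e) = q≢a (trans (≡-sym e) eq)
      ... | inj₂ (inj₂ x) = C≢a x eq

      Adj : V G → ℕ → Set
      Adj v m = m ≤ len × E G v (r m)

      Adj? : ∀ v → Decidable (Adj v)
      Adj? v m = (m ℕₚ.≤? len) ×-dec E? G v (r m)

      Hit : V G → Set
      Hit v = ∃[ i ] (r (toℕ {suc len} i) ≡ v ⊎ E G v (r (toℕ i)))

      hit? : Decidable Hit
      hit? v = Finₚ.any? (λ i → (r (toℕ i) Finₚ.≟ v) ⊎-dec E? G v (r (toℕ i)))

      hit : ∀ {v m} → m ≤ len → r m ≡ v ⊎ E G v (r m) → Hit v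
      hit {v} {m} le h = Fin.fromℕ< (s≤s le) ,
        subst (λ k → r k ≡ v ⊎ E G v (r k)) (≡-sym (Finₚ.toℕ-fromℕ< (s≤s le))) h

      F : V G → Set
      F v = C v × ¬ Hit v

      F-off′ : ∀ {v m} → F v → m ≤ len → Off G v (r m)
      F-off′ (_ , ¬h) le = (λ eq → ¬h (hit le (inj₁ (≡-sym eq)))) , λ e → ¬h (hit le (inj₂ e))

      -- The path strictly before `l` with the arm at `p`, and the path from `l` on with the arm at
      -- `q`. Leaving out at least one path vertex between the two makes them anticomplete.
      Left Right : ℕ → V G → Set
      Left l v = Ep v ⊎ ∃[ m ] m < l × r m ≡ v
      Right l v = Eq v ⊎ ∃[ m ] l ≤ m × m ≤ len × r m ≡ v

      onC : ∀ {m} → 0 < m → m ≤ len → C (r m) ⊎ r m ≡ q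
      onC {m} 0<m le with inside m
      ... | inj₁ eq = contradiction (trans r-0 (≡-sym eq)) (proj₁ (gap 0<m le))
      ... | inj₂ (inj₁ eq) = inj₂ eq
      ... | inj₂ (inj₂ x) = inj₁ x

      onC′ : ∀ {m} → m < len → C (r m) ⊎ r m ≡ p
      onC′ {m} lt with inside m
      ... | inj₁ eq = inj₂ eq
      ... | inj₂ (inj₁ eq) = contradiction (trans eq (≡-sym r-len)) (proj₁ (gap lt ℕₚ.≤-refl))
      ... | inj₂ (inj₂ x) = inj₁ x

      left-arm : ∀ {v l} → l ≤ len → E G v (r l) → Arm v (Left (suc l))
      left-arm {l = l} le e = arm e
        (reach-trans (reach-sym (segment W z≤n le (λ _ m≤l → inj₂ (_ , s≤s m≤l , refl))))
          (step (inj₂ (0 , s≤s z≤n , refl)) (subst (λ v → E G v _) (≡-sym r-0) (Arm.attached armp))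
            (reach-mono inj₁ (Arm.walk armp)))) (Arm.terminal armp)

      right-arm : ∀ {v l} → l ≤ len → E G v (r l) → Arm v (Right l)
      right-arm {l = l} le e = arm e
        (reach-trans (segment W le ℕₚ.≤-refl (λ l≤m m≤ → inj₂ (_ , l≤m , m≤ , refl)))
          (step (inj₂ (len , le , ℕₚ.≤-refl , refl)) (subst (λ v → E G v _) (≡-sym r-len) (Arm.attached armq))
            (reach-mono inj₁ (Arm.walk armq)))) (Arm.terminal armq)

      left-arm-at : ∀ {l} → l ≤ len → Arm (r l) (Left l)
      left-arm-at {zero} _ = subst (λ v → Arm v (Left 0)) (≡-sym r-0) (arm-mono inj₁ armp)
      left-arm-at {suc l} le = left-arm (ℕₚ.<⇒≤ le) (E-sym G (link le))

      right-arm-at : ∀ {l} → l ≤ len → Arm (r l) (Right (suc l))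
      right-arm-at {l} le with ℕₚ.m≤n⇒m<n∨m≡n le
      ... | inj₁ lt = right-arm lt (link lt)
      ... | inj₂ refl = subst (λ v → Arm v (Right (suc l))) (≡-sym r-len) (arm-mono inj₁ armq)

      left-right : ∀ {l l′} → l < l′ → l ≤ len → Apart G (Left l) (Right l′)
      left-right lt l≤ (inj₁ x) (inj₁ y) = Ep-Eq x y
      left-right lt l≤ (inj₁ x) (inj₂ (m , l′≤m , m≤ , refl))
        with onC (ℕₚ.<-≤-trans (ℕₚ.≤-<-trans z≤n lt) l′≤m) m≤
      ... | inj₁ cm = Ep-C x cm
      ... | inj₂ eq = subst (Off G _) (≡-sym eq) (Ep-q x)
      left-right lt l≤ (inj₂ (m , m<l , refl)) (inj₁ y) with onC′ (ℕₚ.<-≤-trans m<l l≤)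
      ... | inj₁ cm = off-sym G (Eq-C y cm)
      ... | inj₂ eq = subst (λ v → Off G v _) (≡-sym eq) (off-sym G (Eq-p y))
      left-right lt l≤ (inj₂ (m , m<l , refl)) (inj₂ (m′ , l′≤m′ , m′≤ , refl)) =
        proj₁ (gap m<m′ m′≤) , λ e → ℕₚ.<⇒≢ 1+m<m′ (≡-sym (proj₂ (gap m<m′ m′≤) e))
        where
        1+m<m′ : suc m < m′
        1+m<m′ = ℕₚ.≤-<-trans m<l (ℕₚ.<-≤-trans lt l′≤m′)
        m<m′ : m < m′
        m<m′ = ℕₚ.<-trans (ℕₚ.n<1+n m) 1+m<m′

    attachment-triangle : Triangle W C
    attachment-triangle
      -- `s` is the first vertex of the walk from `z` that lies on the path or next to it; the walk
      -- before `s` stays in `F`.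
      with first-hit hit? reach (hit z≤n (inj₂ (subst (E G c) (≡-sym r-0) (E-sym G pc))))
    ... | s , sC , (k , sk) , from-z = result
      where
      -- The ends of the path are outside `C`. At an inner vertex of the path, the preceding vertex
      -- of the walk would have been a hit already, and if there is none, the terminal `z` would
      -- have two path neighbours.
      s∉R : ∀ m → m ≤ len → s ≢ r m
      s∉R zero le eq = p∉C (subst C (trans eq r-0) sC)
      s∉R (suc m) le eq with ℕₚ.m≤n⇒m<n∨m≡n le
      ... | inj₂ eq′ = q∉C (subst C (trans eq (trans (cong r eq′) r-len)) sC)
      ... | inj₁ lt = case from-z of λ where
              (inj₂ (y , w , e)) →
                proj₂ (reach-end w) (hit le (inj₂ (subst (E G y) eq e)))
              (inj₁ z≡s) → not-term (E-sym G (link le)) (link lt) (≢a m) (≢a (suc (suc m)))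
                (proj₁ (gap (ℕₚ.m<n⇒m<1+n (ℕₚ.n<1+n m)) lt)) (subst Term (trans z≡s eq) tz)
      s∉ : ∀ {m} → m ≤ len → s ≢ r m
      s∉ {m} = s∉R m
      sk′ : E G s (r (toℕ k))
      sk′ = case sk of λ where
        (inj₁ eq) → contradiction (≡-sym eq) (s∉ (ℕₚ.≤-pred (Finₚ.toℕ<n k)))
        (inj₂ e) → e
      F-walk : Reach G (s ▹ F) s z
      F-walk = case from-z of λ where
        (inj₁ z≡s) → subst (λ v → Reach G (s ▹ F) v z) z≡s (here (inj₁ z≡s))
        (inj₂ (y , w , e)) → step (inj₁ refl) (E-sym G e) (reach-sym (reach-mono inj₂ w))
      F-path : ∀ {P} → Apart G F P → ((∀ {v} → P v → Off G s v)) → Apart G (s ▹ F) P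
      F-path f g (inj₁ refl) = g
      F-path f g (inj₂ x) = f x
      inC′ : ∀ {v} → (s ▹ F) v → C v
      inC′ (inj₁ refl) = sC
      inC′ (inj₂ x) = proj₁ x
      F-left : ∀ {l} → l ≤ suc len → Apart G F (Left l)
      F-left l≤ f (inj₁ x) = off-sym G (Ep-C x (proj₁ f))
      F-left l≤ f (inj₂ (m , m<l , refl)) = F-off′ f (ℕₚ.≤-pred (ℕₚ.≤-trans m<l l≤))
      F-right : ∀ {l} → Apart G F (Right l)
      F-right f (inj₁ x) = off-sym G (Eq-C x (proj₁ f))
      F-right f (inj₂ (m , _ , m≤ , refl)) = F-off′ f m≤
      result : Triangle W C
      -- Let `r i` and `r j` be the first and last neighbours of `s`. If they coincide, there is a
      -- claw at `r i`, with one arm through `s` and one in each direction of the path. If `j`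
      -- exceeds `suc i`, there is a claw at `s`. Only consecutive neighbours remain.
      result with least (Adj? s) (ℕₚ.≤-pred (Finₚ.toℕ<n k) , sk′)
      ... | i , (i≤ , si) , _ , below with greatest (Adj? s) len i≤ (i≤ , si)
      ...   | j , (_ , sj) , i≤j , j≤ , above with ℕₚ.m≤n⇒m<n∨m≡n i≤j
      ...     | inj₂ refl = ⊥-elim (claw (≢a i) (arm (E-sym G si) F-walk tz)
                  (left-arm-at i≤) (right-arm-at i≤)
                  (F-path (F-left (ℕₚ.m≤n⇒m≤1+n i≤)) s-left) (F-path F-right s-right)
                  (left-right (ℕₚ.n<1+n i) i≤))
        where
        s-left : ∀ {v} → Left i v → Off G s v
        s-left (inj₁ x) = off-sym G (Ep-C x sC)
        s-left (inj₂ (m , m<i , refl)) = s∉ m≤ , λ e → below m<i (m≤ , e)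
          where
          m≤ : m ≤ len
          m≤ = ℕₚ.≤-trans (ℕₚ.<⇒≤ m<i) i≤
        s-right : ∀ {v} → Right (suc i) v → Off G s v
        s-right (inj₁ x) = off-sym G (Eq-C x sC)
        s-right (inj₂ (m , i<m , m≤ , refl)) = s∉ m≤ , λ e → above i<m m≤ (m≤ , e)
      ...     | inj₁ i<j with ℕₚ.m≤n⇒m<n∨m≡n i<j
      ...       | inj₂ refl = record
                  { i = i ; i<len = j≤ ; F = F ; left = si ; right = sj ; only = only′
                  ; s-off = s∉ ; F-off = F-off′ ; inC = inC′ ; term = tz ; walk = F-walk }
        where
        only′ : ∀ {m} → m ≤ len → E G s (r m) → m ≡ i ⊎ m ≡ suc i
        only′ {m} m≤ e with ℕₚ.<-cmp m i
        ... | tri< lt _ _ = contradiction (m≤ , e) (below lt)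
        ... | tri≈ _ eq _ = inj₁ eq
        ... | tri> _ _ gt with ℕₚ.m≤n⇒m<n∨m≡n gt
        ...   | inj₁ lt = contradiction (m≤ , e) (above lt m≤)
        ...   | inj₂ eq = inj₂ (≡-sym eq)
      ...       | inj₁ 1+i<j = ⊥-elim (claw (C≢a sC) F-arm (left-arm i≤ si) (right-arm j≤ sj)
                  (F-left (s≤s i≤)) F-right (left-right 1+i<j (ℕₚ.≤-trans i<j j≤)))
        where
        ¬t : ¬ Term s
        ¬t = not-term si sj (≢a i) (≢a j) (proj₁ (gap i<j j≤))
        F-arm : Arm s F
        F-arm = case from-z of λ where
          (inj₁ z≡s) → contradiction (subst Term z≡s tz) ¬t
          (inj₂ (y , w , e)) → arm (E-sym G e) (reach-sym w) tz

  -- Forks and the frontier of a lobe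

  Touch : V G → (V G → Set) → Set
  Touch w C = ∃[ u ] C u × E G w u

  touch? : ∀ {C} → Decidable C → ∀ w → Dec (Touch w C)
  touch? C? w = Finₚ.any? (λ u → C? u ×-dec E? G w u)

  touch-arm : ∀ {w C} → Lobe C → Touch w C → Arm w C
  touch-arm L (u , c , e) = lobe-arm L c e

  -- The three sides of a seed triangle, with its first vertex left out: that place is open to any
  -- vertex of the frontier of `C₁`, and `C₁` itself will be enlarged while the other sides stay
  -- fixed.
  record Fork (C₁ C₂ C₃ : V G → Set) (b₂ b₃ : V G) : Set where
    field
      C₂?       : Decidable C₂
      C₃?       : Decidable C₃
      conn₁     : ∀ {u v} → C₁ u → C₁ v → Reach G C₁ u v
      conn₂     : ∀ {u v} → C₂ u → C₂ v → Reach G C₂ u v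
      conn₃     : ∀ {u v} → C₃ u → C₃ v → Reach G C₃ u v
      lobe₁     : Lobe C₁
      lobe₂     : Lobe C₂
      lobe₃     : Lobe C₃
      apart₁₂   : Apart G C₁ C₂
      apart₁₃   : Apart G C₁ C₃
      apart₂₃   : Apart G C₂ C₃
      b₂₃       : E G b₂ b₃
      touch₂    : Touch b₂ C₂
      touch₃    : Touch b₃ C₃
      b₂∉C₂     : ¬ C₂ b₂
      b₃∉C₃     : ¬ C₃ b₃
      b₂-C₁     : ∀ {v} → C₁ v → Off G b₂ v
      b₂-C₃     : ∀ {v} → C₃ v → Off G b₂ v
      b₃-C₁     : ∀ {v} → C₁ v → Off G b₃ v
      b₃-C₂     : ∀ {v} → C₂ v → Off G b₃ v

  swap : ∀ {C₁ C₂ C₃ b₂ b₃} → Fork C₁ C₂ C₃ b₂ b₃ → Fork C₁ C₃ C₂ b₃ b₂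
  swap K = record
    { C₂? = C₃? ; C₃? = C₂? ; conn₁ = conn₁ ; conn₂ = conn₃ ; conn₃ = conn₂
    ; lobe₁ = lobe₁ ; lobe₂ = lobe₃ ; lobe₃ = lobe₂ ; apart₁₂ = apart₁₃ ; apart₁₃ = apart₁₂
    ; apart₂₃ = apart-sym G apart₂₃ ; b₂₃ = E-sym G b₂₃ ; touch₂ = touch₃ ; touch₃ = touch₂
    ; b₂∉C₂ = b₃∉C₃ ; b₃∉C₃ = b₂∉C₂ ; b₂-C₁ = b₃-C₁ ; b₂-C₃ = b₃-C₂ ; b₃-C₁ = b₂-C₁ ; b₃-C₂ = b₂-C₃ }
    where open Fork K

  record Frontier (C₁ : V G → Set) (w : V G) : Set where
    field
      ≢a    : w ≢ a
      ∉C₁   : ¬ C₁ w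
      touch : Touch w C₁

  module _ {C₁ C₂ C₃ b₂ b₃} (K : Fork C₁ C₂ C₃ b₂ b₃) where
    open Fork K

    arm₂ : Arm b₂ C₂
    arm₂ = touch-arm lobe₂ touch₂

    arm₃ : Arm b₃ C₃
    arm₃ = touch-arm lobe₃ touch₃

    off-tip : ∀ {w v X} → (∀ {u} → X u → Off G v u) → Arm w X → v ≢ a
    off-tip off A refl = proj₂ (off (reach-end (Arm.walk A))) (Arm.terminal A)

    C₁≢a : ∀ {v} → C₁ v → v ≢ a
    C₁≢a x = off-tip (apart₁₂ x) arm₂

    C₃≢a : ∀ {v} → C₃ v → v ≢ a
    C₃≢a x = off-tip (apart-sym G apart₂₃ x) arm₂

    b₂≢a : b₂ ≢ a
    b₂≢a = off-tip b₂-C₃ arm₃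

    b₃≢a : b₃ ≢ a
    b₃≢a = off-tip b₃-C₂ arm₂

    module _ {w} (W : Frontier C₁ w) where
      open Frontier W

      frontier-∉C₂ : ¬ C₂ w
      frontier-∉C₂ x = proj₂ (apart₁₂ (proj₁ (proj₂ touch)) x) (E-sym G (proj₂ (proj₂ touch)))

      frontier-∉C₃ : ¬ C₃ w
      frontier-∉C₃ x = proj₂ (apart₁₃ (proj₁ (proj₂ touch)) x) (E-sym G (proj₂ (proj₂ touch)))

      frontier-≢b₂ : w ≢ b₂
      frontier-≢b₂ refl = proj₂ (b₂-C₁ (proj₁ (proj₂ touch))) (proj₂ (proj₂ touch))

      frontier-≢b₃ : w ≢ b₃
      frontier-≢b₃ refl = proj₂ (b₃-C₁ (proj₁ (proj₂ touch))) (proj₂ (proj₂ touch))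

      untouched₂ : ¬ Touch w C₂ → ∀ {v} → C₂ v → Off G w v
      untouched₂ ¬t x = (λ { refl → frontier-∉C₂ x }) , λ e → ¬t (_ , x , e)

      untouched₃ : ¬ Touch w C₃ → ∀ {v} → C₃ v → Off G w v
      untouched₃ ¬t x = (λ { refl → frontier-∉C₃ x }) , λ e → ¬t (_ , x , e)

      ¬both : Touch w C₂ → Touch w C₃ → ⊥
      ¬both t₂ t₃ = claw ≢a (touch-arm lobe₁ touch) (touch-arm lobe₂ t₂) (touch-arm lobe₃ t₃)
        apart₁₂ apart₁₃ apart₂₃

      -- Otherwise there is a claw at `w`, into `C₁`, into `C₃` and through `b₂` into `C₂`.
      b₂⇒¬C₃ : E G w b₂ → ¬ Touch w C₃
      b₂⇒¬C₃ e t₃ = claw ≢a (touch-arm lobe₁ touch) (arm-▹ e arm₂) (touch-arm lobe₃ t₃)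
        (apart-sym G (apart-▹ G b₂-C₁ (apart-sym G apart₁₂))) apart₁₃ (apart-▹ G b₂-C₃ apart₂₃)

      -- Otherwise there is a claw at `b₂`, into `C₂`, through `b₃` into `C₃` and through `w` into
      -- `C₁`.
      b₂⇒b₃ : E G w b₂ → ¬ Touch w C₂ → E G w b₃
      b₂⇒b₃ e ¬t₂ = decidable-stable (E? G w b₃) λ ¬e₃ →
        claw b₂≢a arm₂ (arm-▹ b₂₃ arm₃) (arm-▹ (E-sym G e) (touch-arm lobe₁ touch))
          (apart-sym G (apart-▹ G b₃-C₂ (apart-sym G apart₂₃)))
          (apart-sym G (apart-▹ G (untouched₂ ¬t₂) apart₁₂))
          (apart-sym G (apart-▹ G (off-w ¬e₃) λ x → apart-sym G (apart-▹ G b₃-C₁ (apart-sym G apart₁₃)) x))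
        where
        off-w : ¬ E G w b₃ → ∀ {q} → (b₃ ▹ C₃) q → Off G w q
        off-w ¬e₃ (inj₁ refl) = frontier-≢b₃ , ¬e₃
        off-w ¬e₃ (inj₂ x) = untouched₃ (b₂⇒¬C₃ e) x

  -- These vertices relate to the rest of the fork exactly as the missing triangle vertex does.
  record Regular (C₁ C₂ C₃ : V G → Set) (b₂ b₃ w : V G) : Set where
    field
      adj₂  : E G w b₂
      adj₃  : E G w b₃
      free₂ : ∀ {v} → C₂ v → Off G w v
      free₃ : ∀ {v} → C₃ v → Off G w v

  -- This case is real: the line graph of a triangle with a pendant edge at each
  -- vertex, its pendant edges joined to a, contains neither a theta nor a prism.
  record Bypass (C₂ C₃ : V G → Set) (b₂ w : V G) : Set where
    field
      hits₃ : Touch w C₃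
      ≢b₂   : w ≢ b₂
      ¬b₂   : ¬ E G w b₂
      free₂ : ∀ {v} → C₂ v → Off G w v

  module _ {C₁ C₂ C₃ b₂ b₃} (K : Fork C₁ C₂ C₃ b₂ b₃) where
    open Fork K

    regular : ∀ {w} → Frontier C₁ w → E G w b₂ → E G w b₃ → Regular C₁ C₂ C₃ b₂ b₃ w
    regular W e₂ e₃ = record
      { adj₂ = e₂ ; adj₃ = e₃
      ; free₂ = untouched₂ K W (b₂⇒¬C₃ (swap K) W e₃)
      ; free₃ = untouched₃ K W (b₂⇒¬C₃ K W e₂) }

    -- The claws eliminate every pattern of the four adjacencies except those of a vertex adjacent
    -- to both `b₂` and `b₃`, and of one that reaches a single one of `C₂`, `C₃` and is not adjacent
    -- to the root of the other.
    classify : ∀ {w} → Frontier C₁ w → (E G w b₂ ⊎ E G w b₃) ⊎ (Touch w C₂ ⊎ Touch w C₃) →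
      Regular C₁ C₂ C₃ b₂ b₃ w ⊎ Bypass C₂ C₃ b₂ w ⊎ Bypass C₃ C₂ b₃ w
    classify {w} W t with E? G w b₂ | E? G w b₃ | touch? C₂? w | touch? C₃? w
    ... | yes e₂ | yes e₃ | _ | _ = inj₁ (regular W e₂ e₃)
    ... | yes e₂ | no ¬e₃ | _ | yes t₃ = ⊥-elim (b₂⇒¬C₃ K W e₂ t₃)
    ... | yes e₂ | no ¬e₃ | no ¬t₂ | no _ = contradiction (b₂⇒b₃ K W e₂ ¬t₂) ¬e₃
    ... | no ¬e₂ | yes e₃ | yes t₂ | _ = ⊥-elim (b₂⇒¬C₃ (swap K) W e₃ t₂)
    ... | no ¬e₂ | yes e₃ | no _ | no ¬t₃ = contradiction (b₂⇒b₃ (swap K) W e₃ ¬t₃) ¬e₂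
    ... | no ¬e₂ | _ | no ¬t₂ | yes t₃ = inj₂ (inj₁ record
            { hits₃ = t₃ ; ≢b₂ = frontier-≢b₂ K W ; ¬b₂ = ¬e₂ ; free₂ = untouched₂ K W ¬t₂ })
    ... | _ | no ¬e₃ | yes t₂ | no ¬t₃ = inj₂ (inj₂ record
            { hits₃ = t₂ ; ≢b₂ = frontier-≢b₃ K W ; ¬b₂ = ¬e₃ ; free₂ = untouched₃ K W ¬t₃ })
    ... | no _ | no _ | yes t₂ | yes t₃ = ⊥-elim (¬both K W t₂ t₃)
    ... | no ¬e₂ | no ¬e₃ | no ¬t₂ | no ¬t₃ =
            ⊥-elim ([ [ ¬e₂ , ¬e₃ ]′ , [ ¬t₂ , ¬t₃ ]′ ]′ t)

    -- The hole through a regular and a bypassing vertex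

    module _ {b w} (B : Frontier C₁ b) (Rb : Regular C₁ C₂ C₃ b₂ b₃ b)
      (W : Frontier C₁ w) (Bw : Bypass C₂ C₃ b₂ w) (b≁w : ¬ E G b w) where
      private
        module B = Frontier B
        module Rb = Regular Rb
        module W = Frontier W
        module Bw = Bypass Bw

        b≢w : b ≢ w
        b≢w eq = Bw.¬b₂ (subst (λ v → E G v b₂) eq Rb.adj₂)

        R : InducedWalk G (b ▹ w ▹ C₁) b w
        R = induced-walk (step (inj₁ refl) (proj₂ (proj₂ B.touch))
          (reach-snoc (reach-mono (inj₂ ∘ inj₂) (conn₁ (proj₁ (proj₂ B.touch)) (proj₁ (proj₂ W.touch))))
            (E-sym G (proj₂ (proj₂ W.touch))) (inj₂ (inj₁ refl))))

        U : InducedWalk G (w ▹ b₃ ▹ C₃) w b₃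
        U = induced-walk (step (inj₁ refl) (proj₂ (proj₂ Bw.hits₃))
          (reach-snoc (reach-mono (inj₂ ∘ inj₂) (conn₃ (proj₁ (proj₂ Bw.hits₃)) (proj₁ (proj₂ touch₃))))
            (E-sym G (proj₂ (proj₂ touch₃))) (inj₂ (inj₁ refl))))


      -- The hole b … w … b₃ has attachments leading to terminals at three of its edges: at
      -- bb₃ (through b₂), at one in C₁ ∪ {b, w} and at one in C₃ ∪ {w, b₃}.  Two of these
      -- edges are disjoint and give a prism: in `Long` the first two, in `Short` the last two.
      private module Ring (R : InducedWalk G (b ▹ w ▹ C₁) b w) (U : InducedWalk G (w ▹ b₃ ▹ C₃) w b₃) where
        open InducedWalk R using (r; r-0; link; gap) renaming (len to k; r-len to r-k)
        open InducedWalk U using () renaming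
          (r to t; r-0 to t-0; link to t-link; gap to t-gap; len to l; r-len to t-l)

        -- By the non-adjacency of `b` and `w` the path has inner vertices. So `r 1`, a triangle
        -- vertex in `Short`, lies in `C₁` and differs from `w`.
        2≤k : 2 ≤ k
        2≤k = walk-length≥2 b≢w b≁w R

        Z₂-w : ∀ {v} → (b₂ ▹ C₂) v → Off G v w
        Z₂-w (inj₁ refl) = off-sym G (Bw.≢b₂ , Bw.¬b₂)
        Z₂-w (inj₂ x) = off-sym G (Bw.free₂ x)

        Z₂ : V G → Set
        Z₂ = b₂ ▹ C₂

        triangle₁ : Triangle R C₁
        triangle₁ with lobe₁ (proj₁ (proj₂ B.touch))
        ... | z , tz , rz = attachment-triangle R B.≢a W.≢a (C₁≢a K) B.∉C₁ W.∉C₁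
          (reach-sym rz) tz (proj₂ (proj₂ B.touch))
          (arm-▹ Rb.adj₂ (arm₂ K)) (touch-arm lobe₃ Bw.hits₃)
          (apart-▹ G b₂-C₁ (apart-sym G apart₁₂)) (apart-sym G apart₁₃)
          (apart-▹ G b₂-C₃ apart₂₃) Z₂-w (off-sym G ∘ Rb.free₃)

        triangle₃ : Triangle U C₃
        triangle₃ with lobe₃ (proj₁ (proj₂ Bw.hits₃))
        ... | z , tz , rz = attachment-triangle U W.≢a (b₃≢a K) (C₃≢a K) (frontier-∉C₃ K W) b₃∉C₃
          (reach-sym rz) tz (proj₂ (proj₂ Bw.hits₃))
          (touch-arm lobe₁ W.touch) (arm-▹ (E-sym G b₂₃) (arm₂ K))
          apart₁₃ (apart-▹ G b₂-C₃ apart₂₃)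
          (apart-sym G (apart-▹ G b₂-C₁ (apart-sym G apart₁₂)))
          (off-sym G ∘ b₃-C₁) Z₂-w

        module Filled (T₁ : Triangle R C₁) (T₃ : Triangle U C₃) where
          open Triangle T₁ using (i; i<len; s; F; left; right; only; s-off; F-off; inC)

          ¬term-b : ¬ Term b
          ¬term-b = not-term Rb.adj₂ Rb.adj₃ (b₂≢a K) (b₃≢a K) (E⇒≢ G b₂₃)

          ¬term-b₃ : ¬ Term b₃
          ¬term-b₃ = not-term (E-sym G Rb.adj₃) (E-sym G b₂₃) B.≢a (b₂≢a K) (E⇒≢ G Rb.adj₂)

          ¬term-w : ¬ Term w
          ¬term-w = not-term (proj₂ (proj₂ W.touch)) (proj₂ (proj₂ Bw.hits₃))
            (C₁≢a K (proj₁ (proj₂ W.touch))) (C₃≢a K (proj₁ (proj₂ Bw.hits₃)))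
            (proj₁ (apart₁₃ (proj₁ (proj₂ W.touch)) (proj₁ (proj₂ Bw.hits₃))))

          r-C₁ : ∀ {m} → 0 < m → m < k → C₁ (r m)
          r-C₁ = walk-interior R

          t-C₃ : ∀ {m} → 0 < m → m < l → C₃ (t m)
          t-C₃ = walk-interior U

          -- The third path of each prism passes through `a`, so the hole must contain no terminal.
          -- An inner vertex of a path has two neighbours there, one too many for a terminal.
          interior-¬term : ∀ {X p q} (P : InducedWalk G X p q) → (∀ i → InducedWalk.r P i ≢ a) →
            ∀ {m} → 0 < m → m < InducedWalk.len P → ¬ Term (InducedWalk.r P m)
          interior-¬term P ≢a {suc m} _ lt = not-term (E-sym G (InducedWalk.link P (ℕₚ.<⇒≤ lt)))
            (InducedWalk.link P lt) (≢a m) (≢a (suc (suc m)))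
            (proj₁ (InducedWalk.gap P (ℕₚ.m<n⇒m<1+n (ℕₚ.n<1+n m)) lt))

          r≢a : ∀ m → r m ≢ a
          r≢a m eq with InducedWalk.inside R m
          ... | inj₁ e = B.≢a (trans (≡-sym e) eq)
          ... | inj₂ (inj₁ e) = W.≢a (trans (≡-sym e) eq)
          ... | inj₂ (inj₂ x) = C₁≢a K x eq

          t≢a : ∀ m → t m ≢ a
          t≢a m eq with InducedWalk.inside U m
          ... | inj₁ e = W.≢a (trans (≡-sym e) eq)
          ... | inj₂ (inj₁ e) = b₃≢a K (trans (≡-sym e) eq)
          ... | inj₂ (inj₂ x) = C₃≢a K x eq

          off-a : ∀ {v} → v ≢ a → ¬ Term v → Off G v a
          off-a ne nt = ne , nt ∘ E-sym G

          r-off-a : ∀ {m} → 0 < m → m < k → Off G (r m) a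
          r-off-a 0<m m<k = off-a (r≢a _) (interior-¬term R r≢a 0<m m<k)

          t-off-a : ∀ {m} → 0 < m → m < l → Off G (t m) a
          t-off-a 0<m m<l = off-a (t≢a _) (interior-¬term U t≢a 0<m m<l)

          r-cases : ∀ {m} → m ≤ k → r m ≡ b × m ≡ 0 ⊎ (C₁ (r m) × Off G (r m) a) ⊎ r m ≡ w × m ≡ k
          r-cases {zero} _ = inj₁ (r-0 , refl)
          r-cases {suc m} le with ℕₚ.m≤n⇒m<n∨m≡n le
          ... | inj₁ lt = inj₂ (inj₁ (r-C₁ z<s lt , r-off-a z<s lt))
          ... | inj₂ eq = inj₂ (inj₂ (trans (cong r eq) r-k , eq))

          t-cases : ∀ {m} → m ≤ l → t m ≡ w × m ≡ 0 ⊎ (C₃ (t m) × Off G (t m) a) ⊎ t m ≡ b₃ × m ≡ l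
          t-cases {zero} _ = inj₁ (t-0 , refl)
          t-cases {suc m} le with ℕₚ.m≤n⇒m<n∨m≡n le
          ... | inj₁ lt = inj₂ (inj₁ (t-C₃ z<s lt , t-off-a z<s lt))
          ... | inj₂ eq = inj₂ (inj₂ (trans (cong t eq) t-l , eq))

          Sep : (p q u₁ u₂ v₁ v₂ : V G) → Set
          Sep p q u₁ u₂ v₁ v₂ = p ≢ q × (E G p q → (p ≡ u₁ × q ≡ u₂) ⊎ (p ≡ v₁ × q ≡ v₂))

          off⇒sep : ∀ {p q u₁ u₂ v₁ v₂} → Off G p q → Sep p q u₁ u₂ v₁ v₂
          off⇒sep (ne , na) = ne , λ e → contradiction e na

          bot-sep : ∀ {p q u₁ u₂ v₁ v₂} → E G v₁ v₂ → p ≡ v₁ → q ≡ v₂ → Sep p q u₁ u₂ v₁ v₂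
          bot-sep e refl refl = E⇒≢ G e , λ _ → inj₂ (refl , refl)

          module Long (0<i : 0 < i) where
            M₁ M₂ M₃ : V G → Set
            M₁ v = ∃[ m ] m ≤ i × r m ≡ v
            M₂ v = (∃[ m ] i < m × m ≤ k × r m ≡ v) ⊎ v ≡ b₃ ⊎ (C₃ v × Off G v a)
            M₃ = (s ▹ F) ⋓ (a ▹ Z₂)

            i≤k : i ≤ k
            i≤k = ℕₚ.<⇒≤ i<len

            walk₁ : Reach G M₁ (r i) b
            walk₁ = subst (Reach G M₁ (r i)) r-0
              (reach-sym (segment R z≤n i≤k (λ _ m≤i → _ , m≤i , refl)))

            t-in : ∀ m → m ≤ l → M₂ (t m)
            t-in m le with t-cases le
            ... | inj₁ (eq , _) = inj₁ (k , i<len , ℕₚ.≤-refl , trans r-k (≡-sym eq))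
            ... | inj₂ (inj₁ x) = inj₂ (inj₂ x)
            ... | inj₂ (inj₂ (eq , _)) = inj₂ (inj₁ eq)

            walk₂ : Reach G M₂ (r (suc i)) b₃
            walk₂ = reach-trans
              (subst (Reach G M₂ (r (suc i))) (trans r-k (≡-sym t-0))
                (segment R i<len ℕₚ.≤-refl (λ i<m m≤k → inj₁ (_ , i<m , m≤k , refl))))
              (subst (Reach G M₂ (t 0)) t-l (segment U z≤n ℕₚ.≤-refl (λ _ → t-in _)))

            walk₃ : Reach G M₃ s b₂
            walk₃ = reach-trans (reach-mono inj₁ (Triangle.walk T₁))
              (step (inj₁ (reach-end (Triangle.walk T₁))) (E-sym G (Triangle.term T₁))
                (step (inj₂ (inj₁ refl)) (Arm.terminal (arm₂ K))
                  (reach-snoc (reach-sym (reach-mono (inj₂ ∘ inj₂ ∘ inj₂) (Arm.walk (arm₂ K))))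
                    (E-sym G (Arm.attached (arm₂ K))) (inj₂ (inj₂ (inj₁ refl))))))

            rung₁₂ : ∀ {p q} → M₁ p → M₂ q → Sep p q (r i) (r (suc i)) b b₃
            rung₁₂ (m , m≤i , refl) (inj₁ (m′ , i<m′ , m′≤k , refl)) =
              proj₁ (gap m<m′ m′≤k) , λ e → inj₁ (tight (proj₂ (gap m<m′ m′≤k) e))
              where
              m<m′ : m < m′
              m<m′ = ℕₚ.≤-<-trans m≤i i<m′
              tight : m′ ≡ suc m → r m ≡ r i × r m′ ≡ r (suc i)
              tight refl with ℕₚ.≤-antisym m≤i (ℕₚ.≤-pred i<m′)
              ... | refl = refl , refl
            rung₁₂ (m , m≤i , refl) (inj₂ y) with r-cases (ℕₚ.≤-trans m≤i i≤k) | y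
            ... | inj₁ (eq , _) | inj₁ refl = bot-sep Rb.adj₃ eq refl
            ... | inj₁ (eq , _) | inj₂ (x , _) =
                    off⇒sep (subst (λ v → Off G v _) (≡-sym eq) (Rb.free₃ x))
            ... | inj₂ (inj₁ (x , _)) | inj₁ refl = off⇒sep (off-sym G (b₃-C₁ x))
            ... | inj₂ (inj₁ (x , _)) | inj₂ (x′ , _) = off⇒sep (apart₁₃ x x′)
            ... | inj₂ (inj₂ (_ , refl)) | _ = contradiction i<len (ℕₚ.≤⇒≯ m≤i)

            rung₁₃ : ∀ {p q} → M₁ p → M₃ q → Sep p q (r i) s b b₂
            rung₁₃ (m , m≤i , refl) (inj₁ (inj₁ refl)) =
                (λ eq → s-off (ℕₚ.≤-trans m≤i i≤k) (≡-sym eq)) , λ e → inj₁ (top e , refl)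
              where
              top : E G (r m) s → r m ≡ r i
              top e with only (ℕₚ.≤-trans m≤i i≤k) (E-sym G e)
              ... | inj₁ refl = refl
              ... | inj₂ refl = contradiction m≤i (ℕₚ.<⇒≱ (ℕₚ.n<1+n i))
            rung₁₃ (m , m≤i , refl) (inj₁ (inj₂ f)) =
              off⇒sep (off-sym G (F-off f (ℕₚ.≤-trans m≤i i≤k)))
            rung₁₃ (m , m≤i , refl) (inj₂ y) with r-cases (ℕₚ.≤-trans m≤i i≤k) | y
            ... | inj₁ (eq , _) | inj₁ refl =
                    off⇒sep (subst (λ v → Off G v a) (≡-sym eq) (off-a B.≢a ¬term-b))
            ... | inj₁ (eq , _) | inj₂ (inj₁ refl) = bot-sep Rb.adj₂ eq refl
            ... | inj₁ (eq , _) | inj₂ (inj₂ x) =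
                    off⇒sep (subst (λ v → Off G v _) (≡-sym eq) (Rb.free₂ x))
            ... | inj₂ (inj₁ (_ , o)) | inj₁ refl = off⇒sep o
            ... | inj₂ (inj₁ (x , _)) | inj₂ (inj₁ refl) = off⇒sep (off-sym G (b₂-C₁ x))
            ... | inj₂ (inj₁ (x , _)) | inj₂ (inj₂ x′) = off⇒sep (apart₁₂ x x′)
            ... | inj₂ (inj₂ (_ , refl)) | _ = contradiction i<len (ℕₚ.≤⇒≯ m≤i)

            rung₂₃ : ∀ {p q} → M₂ p → M₃ q → Sep p q (r (suc i)) s b₃ b₂
            rung₂₃ (inj₁ (m , i<m , m≤k , refl)) (inj₁ (inj₁ refl)) =
                (λ eq → s-off m≤k (≡-sym eq)) , λ e → inj₁ (top e , refl)
              where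
              top : E G (r m) s → r m ≡ r (suc i)
              top e with only m≤k (E-sym G e)
              ... | inj₁ refl = contradiction i<m (ℕₚ.<-irrefl refl)
              ... | inj₂ refl = refl
            rung₂₃ (inj₁ (m , i<m , m≤k , refl)) (inj₁ (inj₂ f)) = off⇒sep (off-sym G (F-off f m≤k))
            rung₂₃ (inj₁ (m , i<m , m≤k , refl)) (inj₂ y) with r-cases m≤k | y
            ... | inj₁ (_ , refl) | _ = contradiction i<m λ ()
            ... | inj₂ (inj₁ (_ , o)) | inj₁ refl = off⇒sep o
            ... | inj₂ (inj₁ (x , _)) | inj₂ (inj₁ refl) = off⇒sep (off-sym G (b₂-C₁ x))
            ... | inj₂ (inj₁ (x , _)) | inj₂ (inj₂ x′) = off⇒sep (apart₁₂ x x′)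
            ... | inj₂ (inj₂ (eq , _)) | inj₁ refl =
                    off⇒sep (subst (λ v → Off G v a) (≡-sym eq) (off-a W.≢a ¬term-w))
            ... | inj₂ (inj₂ (eq , _)) | inj₂ z = off⇒sep (subst (λ v → Off G v _) (≡-sym eq) (off-sym G (Z₂-w z)))
            rung₂₃ (inj₂ (inj₁ refl)) (inj₁ f) = off⇒sep (b₃-C₁ (inC f))
            rung₂₃ (inj₂ (inj₁ refl)) (inj₂ (inj₁ refl)) = off⇒sep (off-a (b₃≢a K) ¬term-b₃)
            rung₂₃ (inj₂ (inj₁ refl)) (inj₂ (inj₂ (inj₁ refl))) = bot-sep (E-sym G b₂₃) refl refl
            rung₂₃ (inj₂ (inj₁ refl)) (inj₂ (inj₂ (inj₂ x))) = off⇒sep (b₃-C₂ x)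
            rung₂₃ (inj₂ (inj₂ (x , _))) (inj₁ f) = off⇒sep (off-sym G (apart₁₃ (inC f) x))
            rung₂₃ (inj₂ (inj₂ (x , o))) (inj₂ (inj₁ refl)) = off⇒sep o
            rung₂₃ (inj₂ (inj₂ (x , _))) (inj₂ (inj₂ (inj₁ refl))) = off⇒sep (off-sym G (b₂-C₃ x))
            rung₂₃ (inj₂ (inj₂ (x , _))) (inj₂ (inj₂ (inj₂ x′))) = off⇒sep (off-sym G (apart₂₃ x′ x))

            prism : Prism G
            prism = build-prism walk₁ walk₂ walk₃
              (λ eq → proj₁ (gap 0<i i≤k) (trans r-0 (≡-sym eq)))
              u₂≢v₂ (λ eq → proj₁ (b₂-C₁ (inC (inj₁ refl))) (≡-sym eq))
              record { top = link i<len ; bot = Rb.adj₃ ; only = rung₁₂ }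
              record { top = E-sym G left ; bot = Rb.adj₂ ; only = rung₁₃ }
              record { top = E-sym G right ; bot = E-sym G b₂₃ ; only = rung₂₃ }
              where
              u₂≢v₂ : r (suc i) ≢ b₃
              u₂≢v₂ eq with r-cases i<len
              ... | inj₁ (_ , ())
              ... | inj₂ (inj₁ (x , _)) = proj₁ (b₃-C₁ x) (≡-sym eq)
              ... | inj₂ (inj₂ (eq′ , _)) = frontier-≢b₃ K W (trans (≡-sym eq′) eq)

          module Short (i≡0 : i ≡ 0) where
            open Triangle T₃ using () renaming
              (i to j; i<len to j<l; s to s′; F to F′; left to left′; right to right′; only to only′
              ; s-off to s-off′; F-off to F-off′; inC to inC′)

            -- Here the triangles are `b`, `r 1`, `s` and `t (suc j)`, `t j`, `s′`. The first path
            -- goes over the edge from `b` to `b₃`, the second through `w`, the third from `s`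
            -- through `a` to `s′`.
            M₁ M₂ M₃ : V G → Set
            M₁ v = v ≡ b ⊎ ∃[ m ] j < m × m ≤ l × t m ≡ v
            M₂ v = (∃[ m ] 0 < m × m < k × r m ≡ v) ⊎ ∃[ m ] m ≤ j × t m ≡ v
            M₃ = (s ▹ F) ⋓ (a ▹ s′ ▹ F′)

            j≤l : j ≤ l
            j≤l = ℕₚ.<⇒≤ j<l

            s-b : E G s b
            s-b = subst (E G s) (trans (cong r i≡0) r-0) left

            s-r₁ : E G s (r 1)
            s-r₁ = subst (λ m → E G s (r (suc m))) i≡0 right

            b-r₁ : E G b (r 1)
            b-r₁ = subst (λ v → E G v (r 1)) r-0 (link (ℕₚ.<⇒≤ 2≤k))

            walk₁ : Reach G M₁ b (t (suc j))
            walk₁ = step (inj₁ refl) (subst (E G b) (≡-sym t-l) Rb.adj₃)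
              (reach-sym (segment U j<l ℕₚ.≤-refl (λ j<m m≤l → inj₂ (_ , j<m , m≤l , refl))))

            walk₂ : Reach G M₂ (r 1) (t j)
            walk₂ = go 2≤k link r-k (λ {m} 0<m m<k → inj₁ (m , 0<m , m<k , refl))
              where
              go : ∀ {k′} → 2 ≤ k′ → (∀ {m} → m < k′ → E G (r m) (r (suc m))) → r k′ ≡ w →
                (∀ {m} → 0 < m → m < k′ → M₂ (r m)) → Reach G M₂ (r 1) (t j)
              go {suc (suc k′)} (s≤s (s≤s z≤n)) lk eq inM = reach-trans (along (suc k′) z<s ℕₚ.≤-refl)
                (step (inM z<s ℕₚ.≤-refl) (subst (E G _) (trans eq (≡-sym t-0)) (lk ℕₚ.≤-refl))
                  (segment U z≤n j≤l (λ _ m≤j → inj₂ (_ , m≤j , refl))))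
                where
                along : ∀ m → 0 < m → m < suc (suc k′) → Reach G M₂ (r 1) (r m)
                along (suc zero) _ lt = here (inM z<s lt)
                along (suc (suc m)) _ lt =
                  reach-snoc (along (suc m) z<s (ℕₚ.<⇒≤ lt)) (lk (ℕₚ.<⇒≤ lt)) (inM z<s lt)

            walk₃ : Reach G M₃ s s′
            walk₃ = reach-trans (reach-mono inj₁ (Triangle.walk T₁))
              (step (inj₁ (reach-end (Triangle.walk T₁))) (E-sym G (Triangle.term T₁))
                (step (inj₂ (inj₁ refl)) (Triangle.term T₃)
                  (reach-sym (reach-mono (inj₂ ∘ inj₂) (Triangle.walk T₃)))))

            t-right : ∀ {m} → j < m → m ≤ l → (C₃ (t m) × Off G (t m) a) ⊎ t m ≡ b₃
            t-right j<m m≤l with t-cases m≤l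
            ... | inj₁ (_ , refl) = contradiction j<m λ ()
            ... | inj₂ (inj₁ x) = inj₁ x
            ... | inj₂ (inj₂ (eq , _)) = inj₂ eq

            t-left : ∀ {m} → m ≤ j → t m ≡ w ⊎ (C₃ (t m) × Off G (t m) a)
            t-left m≤j with t-cases (ℕₚ.≤-trans m≤j j≤l)
            ... | inj₁ (eq , _) = inj₁ eq
            ... | inj₂ (inj₁ x) = inj₂ x
            ... | inj₂ (inj₂ (_ , refl)) = contradiction j<l (ℕₚ.≤⇒≯ m≤j)

            right-C₁ : ∀ {m v} → j < m → m ≤ l → C₁ v → Off G (t m) v
            right-C₁ j<m m≤l x with t-right j<m m≤l
            ... | inj₁ (y , _) = off-sym G (apart₁₃ x y)
            ... | inj₂ eq = subst (λ v → Off G v _) (≡-sym eq) (b₃-C₁ x)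

            rung₁₂ : ∀ {p q} → M₁ p → M₂ q → Sep p q b (r 1) (t (suc j)) (t j)
            rung₁₂ (inj₁ refl) (inj₁ (m , 0<m , m<k , refl)) =
                subst (λ v → v ≢ r m) r-0 (proj₁ (gap 0<m (ℕₚ.<⇒≤ m<k)))
              , λ e → inj₁ (refl , cong r (proj₂ (gap 0<m (ℕₚ.<⇒≤ m<k)) (subst (λ v → E G v (r m)) (≡-sym r-0) e)))
            rung₁₂ (inj₁ refl) (inj₂ (m , m≤j , refl)) with t-left m≤j
            ... | inj₁ eq = off⇒sep (subst (Off G b) (≡-sym eq) (b≢w , b≁w))
            ... | inj₂ (x , _) = off⇒sep (Rb.free₃ x)
            rung₁₂ (inj₂ (m , j<m , m≤l , refl)) (inj₁ (m′ , 0<m′ , m′<k , refl)) =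
              off⇒sep (right-C₁ j<m m≤l (r-C₁ 0<m′ m′<k))
            rung₁₂ (inj₂ (m , j<m , m≤l , refl)) (inj₂ (m′ , m′≤j , refl)) =
              (λ eq → proj₁ (t-gap m′<m m≤l) (≡-sym eq)) ,
              λ e → inj₂ (tight (proj₂ (t-gap m′<m m≤l) (E-sym G e)))
              where
              m′<m : m′ < m
              m′<m = ℕₚ.≤-<-trans m′≤j j<m
              tight : m ≡ suc m′ → t m ≡ t (suc j) × t m′ ≡ t j
              tight refl with ℕₚ.≤-antisym m′≤j (ℕₚ.≤-pred j<m)
              ... | refl = refl , refl

            rung₁₃ : ∀ {p q} → M₁ p → M₃ q → Sep p q b s (t (suc j)) s′
            rung₁₃ (inj₁ refl) (inj₁ (inj₁ refl)) =
              (λ eq → B.∉C₁ (subst C₁ (≡-sym eq) (inC (inj₁ refl)))) , λ e → inj₁ (refl , refl)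
            rung₁₃ (inj₁ refl) (inj₁ (inj₂ f)) =
              off⇒sep (subst (λ v → Off G v _) r-0 (off-sym G (F-off f z≤n)))
            rung₁₃ (inj₁ refl) (inj₂ (inj₁ refl)) = off⇒sep (off-a B.≢a ¬term-b)
            rung₁₃ (inj₁ refl) (inj₂ (inj₂ f)) = off⇒sep (Rb.free₃ (inC′ f))
            rung₁₃ (inj₂ (m , j<m , m≤l , refl)) (inj₁ f) = off⇒sep (right-C₁ j<m m≤l (inC f))
            rung₁₃ (inj₂ (m , j<m , m≤l , refl)) (inj₂ (inj₁ refl)) with t-right j<m m≤l
            ... | inj₁ (_ , o) = off⇒sep o
            ... | inj₂ eq = off⇒sep (subst (λ v → Off G v a) (≡-sym eq) (off-a (b₃≢a K) ¬term-b₃))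
            rung₁₃ (inj₂ (m , j<m , m≤l , refl)) (inj₂ (inj₂ (inj₁ refl))) =
                (λ eq → s-off′ m≤l (≡-sym eq)) , λ e → inj₂ (bottom e , refl)
              where
              bottom : E G (t m) s′ → t m ≡ t (suc j)
              bottom e with only′ m≤l (E-sym G e)
              ... | inj₁ refl = contradiction j<m (ℕₚ.<-irrefl refl)
              ... | inj₂ refl = refl
            rung₁₃ (inj₂ (m , j<m , m≤l , refl)) (inj₂ (inj₂ (inj₂ f))) =
              off⇒sep (off-sym G (F-off′ f m≤l))

            rung₂₃ : ∀ {p q} → M₂ p → M₃ q → Sep p q (r 1) s (t j) s′
            rung₂₃ (inj₁ (m , 0<m , m<k , refl)) (inj₁ (inj₁ refl)) =
                (λ eq → s-off (ℕₚ.<⇒≤ m<k) (≡-sym eq)) , λ e → inj₁ (top e , refl)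
              where
              top : E G (r m) s → r m ≡ r 1
              top e with only (ℕₚ.<⇒≤ m<k) (E-sym G e)
              ... | inj₁ eq = contradiction (subst (0 <_) (trans eq i≡0) 0<m) λ ()
              ... | inj₂ eq = cong r (trans eq (cong suc i≡0))
            rung₂₃ (inj₁ (m , 0<m , m<k , refl)) (inj₁ (inj₂ f)) =
              off⇒sep (off-sym G (F-off f (ℕₚ.<⇒≤ m<k)))
            rung₂₃ (inj₁ (m , 0<m , m<k , refl)) (inj₂ (inj₁ refl)) = off⇒sep (r-off-a 0<m m<k)
            rung₂₃ (inj₁ (m , 0<m , m<k , refl)) (inj₂ (inj₂ f)) =
              off⇒sep (apart₁₃ (r-C₁ 0<m m<k) (inC′ f))
            rung₂₃ (inj₂ (m , m≤j , refl)) (inj₁ f) with t-left m≤j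
            ... | inj₂ (x , _) = off⇒sep (off-sym G (apart₁₃ (inC f) x))
            ... | inj₁ eq with f
            ...   | inj₂ f′ = off⇒sep (subst (λ v → Off G v _) (trans r-k (≡-sym eq)) (off-sym G (F-off f′ ℕₚ.≤-refl)))
            ...   | inj₁ refl = off⇒sep (subst (λ v → Off G v _) (trans r-k (≡-sym eq))
                      ((λ e → s-off ℕₚ.≤-refl (≡-sym e)) , ¬far))
              where
              ¬far : ¬ E G (r k) s
              ¬far e with only ℕₚ.≤-refl (E-sym G e)
              ... | inj₁ eq′ = contradiction (subst (2 ≤_) (trans eq′ i≡0) 2≤k) λ ()
              ... | inj₂ eq′ = contradiction (subst (2 ≤_) (trans eq′ (cong suc i≡0)) 2≤k) λ { (s≤s ()) }
            rung₂₃ (inj₂ (m , m≤j , refl)) (inj₂ (inj₁ refl)) with t-left m≤j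
            ... | inj₁ eq = off⇒sep (subst (λ v → Off G v a) (≡-sym eq) (off-a W.≢a ¬term-w))
            ... | inj₂ (_ , o) = off⇒sep o
            rung₂₃ (inj₂ (m , m≤j , refl)) (inj₂ (inj₂ (inj₁ refl))) =
                (λ eq → s-off′ (ℕₚ.≤-trans m≤j j≤l) (≡-sym eq)) , λ e → inj₂ (bottom e , refl)
              where
              bottom : E G (t m) s′ → t m ≡ t j
              bottom e with only′ (ℕₚ.≤-trans m≤j j≤l) (E-sym G e)
              ... | inj₁ refl = refl
              ... | inj₂ refl = contradiction m≤j (ℕₚ.<⇒≱ (ℕₚ.n<1+n j))
            rung₂₃ (inj₂ (m , m≤j , refl)) (inj₂ (inj₂ (inj₂ f))) =
              off⇒sep (off-sym G (F-off′ f (ℕₚ.≤-trans m≤j j≤l)))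

            prism : Prism G
            prism = build-prism walk₁ walk₂ walk₃ u₁≢v₁ u₂≢v₂
              (proj₁ (apart₁₃ (inC (inj₁ refl)) (inC′ (inj₁ refl))))
              record { top = b-r₁ ; bot = E-sym G (t-link j<l) ; only = rung₁₂ }
              record { top = E-sym G s-b ; bot = E-sym G right′ ; only = rung₁₃ }
              record { top = E-sym G s-r₁ ; bot = E-sym G left′ ; only = rung₂₃ }
              where
              u₁≢v₁ : b ≢ t (suc j)
              u₁≢v₁ eq with t-right (ℕₚ.n<1+n j) j<l
              ... | inj₁ (x , _) = proj₁ (Rb.free₃ x) eq
              ... | inj₂ eq′ = E⇒≢ G Rb.adj₃ (trans eq eq′)
              u₂≢v₂ : r 1 ≢ t j
              u₂≢v₂ eq with t-left (ℕₚ.≤-refl {j})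
              ... | inj₁ eq′ = W.∉C₁ (subst C₁ (trans eq eq′) (r-C₁ z<s 2≤k))
              ... | inj₂ (x , _) = proj₁ (apart₁₃ (r-C₁ z<s 2≤k) x) eq

          absurd : ⊥
          absurd with i in i≡
          ... | zero = pf (Short.prism i≡)
          ... | suc _ = pf (Long.prism (subst (0 <_) (≡-sym i≡) z<s))

      bypass-nonadjacent-absurd : ⊥
      bypass-nonadjacent-absurd = Filled.absurd triangle₁ triangle₃
        where open Ring R U

    -- The only place where prism-freeness enters. It lets the arms of later claws run along the
    -- edge between `b` and `w`, and it gives bypassing vertices a neighbour in the seed triangle.
    regular-bypass-adjacent : ∀ {b w} → Frontier C₁ b → Regular C₁ C₂ C₃ b₂ b₃ b →
      Frontier C₁ w → Bypass C₂ C₃ b₂ w → E G b w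
    regular-bypass-adjacent {b} {w} B Rb W Bw =
      decidable-stable (E? G b w) (bypass-nonadjacent-absurd B Rb W Bw)

  regular-swap : ∀ {C₁ C₂ C₃ b₂ b₃ w} → Regular C₁ C₂ C₃ b₂ b₃ w → Regular C₁ C₃ C₂ b₃ b₂ w
  regular-swap R = record { adj₂ = adj₃ ; adj₃ = adj₂ ; free₂ = free₃ ; free₃ = free₂ }
    where open Regular R

  -- Complete pairs of separating sets

  frontier? : ∀ {C} → Decidable C → Decidable (Frontier C)
  frontier? C? w = map′ (λ (p , q , r) → record { ≢a = p ; ∉C₁ = q ; touch = r })
    (λ W → Frontier.≢a W , Frontier.∉C₁ W , Frontier.touch W)
    (¬? (w Finₚ.≟ a) ×-dec ¬? (C? w) ×-dec touch? C? w)

  frontier-separates : ∀ {C u v} → Decidable C → C u → ¬ C v →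
    ¬ Reach G (λ w → w ≢ a × ¬ Frontier C w) u v
  frontier-separates C? c ¬c (here _) = ¬c c
  frontier-separates C? c ¬c (step {v = w} _ e r) with C? w
  ... | yes cw = frontier-separates C? cw ¬c r
  ... | no ¬cw with reach-start r
  ...   | w≢a , ¬f = ¬f record { ≢a = w≢a ; ∉C₁ = ¬cw ; touch = _ , c , E-sym G e }

  -- `T` is meant to be the seed triangle. The two `near` fields serve the case in which the vertex
  -- to be cut off belongs to the separator itself.
  record Join (L R T : V G → Set) : Set₁ where
    field
      A B      : V G → Set
      A?       : Decidable A
      B?       : Decidable B
      A≢a      : ∀ {v} → A v → v ≢ a
      B≢a      : ∀ {v} → B v → v ≢ a
      complete : ∀ {p q} → A p → B q → E G p q
      A-sep    : ∀ {z z′} → L z → R z′ → ¬ Reach G (λ v → v ≢ a × ¬ A v) z z′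
      B-sep    : ∀ {z z′} → L z → R z′ → ¬ Reach G (λ v → v ≢ a × ¬ B v) z z′
      A-near   : ∀ {v} → A v → Touch v T
      B-near   : ∀ {v} → B v → Touch v T

  module _ {C₁ C₂ C₃ b₂ b₃} (K : Fork C₁ C₂ C₃ b₂ b₃) where
    open Fork K

    -- `P` leads from a neighbour of `α` to `C₃` and avoids `α′`. If `b₂` has a neighbour in `P`,
    -- the claw is at `b₂`: into `C₂`, through `α′` into `C₁`, and along `P` into `C₃`. If not, it
    -- is at `α`: into `C₁`, through `b₂` into `C₂`, and along `P`.
    connector-claw : ∀ {P v u α α′} → Decidable P → (∀ {y} → P y → Reach G P y u) → P v →
      E G α v → Frontier C₁ α → Regular C₁ C₂ C₃ b₂ b₃ α →
      Frontier C₁ α′ → Regular C₁ C₂ C₃ b₂ b₃ α′ →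
      Apart G C₁ P → (∀ {y} → P y → Off G α′ y) → Apart G C₂ P → (∀ {y} → P y → b₂ ≢ y) →
      Touch u C₃ → ⊥
    connector-claw {P} {v} {u} {α} {α′} P? to-u Pv αv Fα Rα Fα′ Rα′ C₁-P α′-P C₂-P b₂≢ t₃ =
      go (touch? P? b₂)
      where
      P-arm : ∀ {w y} → P y → E G w y → Arm w (P ⋓ C₃)
      P-arm p e with touch-arm lobe₃ t₃
      ... | arm e′ r t = arm e (reach-trans (reach-mono inj₁ (to-u p))
              (step (inj₁ (reach-end (to-u p))) e′ (reach-mono inj₂ r))) t
      off-P : ∀ {X Y : V G → Set} → Apart G X P → Apart G X C₃ → Apart G X (P ⋓ C₃)
      off-P f g x (inj₁ p) = f x p
      off-P f g x (inj₂ c) = g x c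
      go : Dec (Touch b₂ P) → ⊥
      go (yes (y , p , e)) = claw (b₂≢a K) (arm₂ K)
        (arm-▹ (E-sym G (Regular.adj₂ Rα′)) (touch-arm lobe₁ (Frontier.touch Fα′))) (P-arm p e)
        (apart-sym G (apart-▹ G (Regular.free₂ Rα′) apart₁₂))
        (off-P {Y = P} C₂-P apart₂₃)
        (apart-▹ G (λ { (inj₁ p) → α′-P p ; (inj₂ c) → Regular.free₃ Rα′ c }) (off-P {Y = P} C₁-P apart₁₃))
      go (no ¬t) = claw (Frontier.≢a Fα) (touch-arm lobe₁ (Frontier.touch Fα))
        (arm-▹ (Regular.adj₂ Rα) (arm₂ K)) (P-arm Pv αv)
        (apart-sym G (apart-▹ G b₂-C₁ (apart-sym G apart₁₂)))
        (off-P {Y = P} C₁-P apart₁₃)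
        (apart-▹ G (λ { (inj₁ p) → b₂≢ p , (λ e → ¬t (_ , p , e)) ; (inj₂ c) → b₂-C₃ c })
          (off-P {Y = P} C₂-P apart₂₃))

    module _ {D b w y} (D⊆C₁ : ∀ {v} → D v → C₁ v) (y-arm : ∀ {v} → E G v y → Arm v D)
      (D-off : ∀ {v} → Frontier C₁ v → ¬ E G y v → ∀ {u} → D u → Off G u v)
      (Fb : Frontier C₁ b) (Rb : Regular C₁ C₂ C₃ b₂ b₃ b)
      (Fw : Frontier C₁ w) (Bw : Bypass C₂ C₃ b₂ w) where
      private
        module Rb = Regular Rb
        module Bw = Bypass Bw

        bw : E G b w
        bw = regular-bypass-adjacent K Fb Rb Fw Bw

        D-Z : ∀ {p q} → D p → (b₂ ▹ C₂) q → Off G p q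
        D-Z d (inj₁ refl) = off-sym G (b₂-C₁ (D⊆C₁ d))
        D-Z d (inj₂ c) = apart₁₂ (D⊆C₁ d) c

        b₂-w : Off G b₂ w
        b₂-w = off-sym G (Bw.≢b₂ , Bw.¬b₂)

      -- Otherwise there is a claw at `b`: through `y` into `D`, through `b₂` into `C₂` and through
      -- `w` into `C₃`.
      regular⇒bypass : E G y b → E G y w
      regular⇒bypass yb = decidable-stable (E? G y w) λ ¬yw →
        claw (Frontier.≢a Fb) (y-arm (E-sym G yb)) (arm-▹ Rb.adj₂ (arm₂ K))
          (arm-▹ bw (touch-arm lobe₃ Bw.hits₃)) D-Z
          (apart-sym G (apart-▹ G (λ d → off-sym G (D-off Fw ¬yw d)) λ c d → off-sym G (apart₁₃ (D⊆C₁ d) c)))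
          (apart-▹ G {X = C₂} {Y = w ▹ C₃} (λ { (inj₁ refl) → b₂-w ; (inj₂ c) → b₂-C₃ c })
            λ { c (inj₁ refl) → off-sym G (Bw.free₂ c) ; c (inj₂ c′) → apart₂₃ c c′ })

      -- Otherwise there is a claw at `w`: through `y` into `D`, into `C₃`, and through `b` and `b₂`
      -- into `C₂`.
      bypass⇒regular : E G y w → E G y b
      bypass⇒regular yw = decidable-stable (E? G y b) λ ¬yb →
        claw (Frontier.≢a Fw) (y-arm (E-sym G yw)) (touch-arm lobe₃ Bw.hits₃)
          (arm-▹ (E-sym G bw) (arm-▹ Rb.adj₂ (arm₂ K)))
          (λ d → apart₁₃ (D⊆C₁ d))
          (λ { d (inj₁ refl) → D-off Fb ¬yb d ; d (inj₂ z) → D-Z d z })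
          (λ { c (inj₁ refl) → off-sym G (Rb.free₃ c)
             ; c (inj₂ (inj₁ refl)) → off-sym G (b₂-C₃ c)
             ; c (inj₂ (inj₂ x)) → off-sym G (apart₂₃ x c) })

  module _ {K C₂ C₃ b₁ b₂ b₃} (F : Fork K C₂ C₃ b₂ b₃)
    (b₁∈F : Frontier K b₁) (b₁b₂ : E G b₁ b₂) (b₁b₃ : E G b₁ b₃) where
    private module F = Fork F

    private
      k₀ : V G
      k₀ = proj₁ (Frontier.touch b₁∈F)

      Rt : V G → Set
      Rt v = (v ≡ b₂ ⊎ v ≡ b₃) ⊎ (C₂ v ⊎ C₃ v)

      Rt? : Decidable Rt
      Rt? v = ((v Finₚ.≟ b₂) ⊎-dec (v Finₚ.≟ b₃)) ⊎-dec (F.C₂? v ⊎-dec F.C₃? v)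

      X₁ : V G → Set
      X₁ v = v ≢ a × ¬ Rt v × ¬ Touch v Rt

      X₁? : Decidable X₁
      X₁? v = ¬? (v Finₚ.≟ a) ×-dec ¬? (Rt? v) ×-dec ¬? (touch? Rt? v)

      C₁ : V G → Set
      C₁ = Reach G X₁ k₀

      C₁? : Decidable C₁
      C₁? = reach? X₁? k₀

      K-off : ∀ {u v} → K u → Rt v → Off G u v
      K-off k (inj₁ (inj₁ refl)) = off-sym G (F.b₂-C₁ k)
      K-off k (inj₁ (inj₂ refl)) = off-sym G (F.b₃-C₁ k)
      K-off k (inj₂ (inj₁ c)) = F.apart₁₂ k c
      K-off k (inj₂ (inj₂ c)) = F.apart₁₃ k c

      K⊆X₁ : ∀ {v} → K v → X₁ v
      K⊆X₁ k = C₁≢a F k , (λ ρ → proj₁ (K-off k ρ) refl) , λ (_ , ρ , e) → proj₂ (K-off k ρ) e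

      K⊆C₁ : ∀ {v} → K v → C₁ v
      K⊆C₁ k = reach-mono K⊆X₁ (F.conn₁ (proj₁ (proj₂ (Frontier.touch b₁∈F))) k)

      C₁-off : ∀ {u v} → C₁ u → Rt v → Off G u v
      C₁-off c ρ with reach-end c
      ... | _ , ¬ρ , ¬t = (λ { refl → ¬ρ ρ }) , λ e → ¬t (_ , ρ , e)

      fork : Fork C₁ C₂ C₃ b₂ b₃
      fork = record
        { C₂? = F.C₂? ; C₃? = F.C₃?
        ; conn₁ = λ c c′ → reach-trans (reach-sym (reach-within c)) (reach-within c′)
        ; conn₂ = F.conn₂ ; conn₃ = F.conn₃
        ; lobe₁ = λ c → case F.lobe₁ (proj₁ (proj₂ (Frontier.touch b₁∈F))) of λ where
            (z , tz , r) → z , tz , reach-trans (reach-sym (reach-within c)) (reach-mono K⊆C₁ r)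
        ; lobe₂ = F.lobe₂ ; lobe₃ = F.lobe₃
        ; apart₁₂ = λ c x → C₁-off c (inj₂ (inj₁ x)) ; apart₁₃ = λ c x → C₁-off c (inj₂ (inj₂ x))
        ; apart₂₃ = F.apart₂₃ ; b₂₃ = F.b₂₃ ; touch₂ = F.touch₂ ; touch₃ = F.touch₃
        ; b₂∉C₂ = F.b₂∉C₂ ; b₃∉C₃ = F.b₃∉C₃
        ; b₂-C₁ = λ c → off-sym G (C₁-off c (inj₁ (inj₁ refl))) ; b₂-C₃ = F.b₂-C₃
        ; b₃-C₁ = λ c → off-sym G (C₁-off c (inj₁ (inj₂ refl))) ; b₃-C₂ = F.b₃-C₂ }

      A₁ : V G → Set
      A₁ = Frontier C₁

      A₁? : Decidable A₁
      A₁? = frontier? C₁?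

      b₁∈A₁ : A₁ b₁
      b₁∈A₁ = record
        { ≢a = Frontier.≢a b₁∈F ; ∉C₁ = λ c → proj₂ (C₁-off c (inj₁ (inj₁ refl))) b₁b₂
        ; touch = k₀ , K⊆C₁ (proj₁ (proj₂ (Frontier.touch b₁∈F))) , proj₂ (proj₂ (Frontier.touch b₁∈F)) }

      b₁-regular : Regular C₁ C₂ C₃ b₂ b₃ b₁
      b₁-regular = regular fork b₁∈A₁ b₁b₂ b₁b₃

      -- This is where maximality of `C₁` is used: a frontier vertex without a neighbour in `Rt`
      -- would belong to `C₁`.
      kinds : ∀ {w} → A₁ w →
        Regular C₁ C₂ C₃ b₂ b₃ w ⊎ Bypass C₂ C₃ b₂ w ⊎ Bypass C₃ C₂ b₃ w
      kinds {w} W = classify fork W (sort near)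
        where
        open Frontier W
        near : Touch w Rt
        near = decidable-stable (touch? Rt? w) λ ¬t → ∉C₁
          (reach-snoc (proj₁ (proj₂ touch)) (E-sym G (proj₂ (proj₂ touch)))
            (≢a , (λ ρ → proj₂ (C₁-off (proj₁ (proj₂ touch)) ρ) (E-sym G (proj₂ (proj₂ touch)))) , ¬t))
        sort : Touch w Rt → (E G w b₂ ⊎ E G w b₃) ⊎ (Touch w C₂ ⊎ Touch w C₃)
        sort (_ , inj₁ (inj₁ refl) , e) = inj₁ (inj₁ e)
        sort (_ , inj₁ (inj₂ refl) , e) = inj₁ (inj₂ e)
        sort (u , inj₂ (inj₁ c) , e) = inj₂ (inj₁ (u , c , e))
        sort (u , inj₂ (inj₂ c) , e) = inj₂ (inj₂ (u , c , e))

      Left Right Base : V G → Set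
      Left z = Term z × K z
      Right z = Term z × C₃ z
      Base v = v ≡ b₁ ⊎ v ≡ b₂ ⊎ v ≡ b₃

      A₁-sep : ∀ {z z′} → Left z → Right z′ → ¬ Reach G (λ v → v ≢ a × ¬ A₁ v) z z′
      A₁-sep (_ , k) (_ , c) =
        frontier-separates C₁? (K⊆C₁ k) (λ c′ → proj₁ (C₁-off c′ (inj₂ (inj₂ c))) refl)

      near-base : ∀ {w} → A₁ w → Touch w Base
      near-base W with kinds W
      ... | inj₁ R = b₂ , inj₂ (inj₁ refl) , Regular.adj₂ R
      ... | inj₂ (inj₁ B) = b₁ , inj₁ refl , E-sym G (regular-bypass-adjacent fork b₁∈A₁ b₁-regular W B)
      ... | inj₂ (inj₂ B) = b₁ , inj₁ refl ,
              E-sym G (regular-bypass-adjacent (swap fork) b₁∈A₁ (regular-swap b₁-regular) W B)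

      module AllRegular (all : ∀ {w} → A₁ w → Regular C₁ C₂ C₃ b₂ b₃ w) where
        c₃ : V G
        c₃ = proj₁ F.touch₃

        X₃ : V G → Set
        X₃ v = v ≢ a × ¬ C₁ v × ¬ A₁ v × ¬ Touch v A₁

        X₃? : Decidable X₃
        X₃? v = ¬? (v Finₚ.≟ a) ×-dec ¬? (C₁? v) ×-dec ¬? (A₁? v) ×-dec ¬? (touch? A₁? v)

        D₃ : V G → Set
        D₃ = Reach G X₃ c₃

        D₃? : Decidable D₃
        D₃? = reach? X₃? c₃

        -- Regular vertices have no neighbour in `C₃`, so the connected set `C₃` survives the
        -- removal of `A₁` and its neighbours. A bypassing vertex could break this.
        C₃⊆D₃ : ∀ {v} → C₃ v → D₃ v
        C₃⊆D₃ c = reach-mono C₃⊆X₃ (F.conn₃ (proj₁ (proj₂ F.touch₃)) c)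
          where
          C₃⊆X₃ : ∀ {v} → C₃ v → X₃ v
          C₃⊆X₃ c = C₃≢a fork c , (λ c′ → proj₁ (C₁-off c′ (inj₂ (inj₂ c))) refl)
            , (λ W → frontier-∉C₃ fork W c)
            , λ (w , W , e) → proj₂ (Regular.free₃ (all W) c) (E-sym G e)

        C₁-D₃ : Apart G C₁ D₃
        C₁-D₃ c d with reach-end d
        ... | ≢a , ∉C₁ , ∉A₁ , _ = (λ { refl → ∉C₁ c }) , λ e →
                ∉A₁ record { ≢a = ≢a ; ∉C₁ = ∉C₁ ; touch = _ , c , E-sym G e }

        A₁-D₃ : Apart G A₁ D₃
        A₁-D₃ W d with reach-end d
        ... | _ , _ , ∉A₁ , ¬t = (λ { refl → ∉A₁ W }) , λ e → ¬t (_ , W , E-sym G e)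

        module _ {v α′} (B : Frontier D₃ v) (W′ : A₁ α′) (α′≁v : ¬ E G α′ v) where
          private
            module B = Frontier B
            d : V G
            d = proj₁ B.touch
            d∈ : D₃ d
            d∈ = proj₁ (proj₂ B.touch)
            vd : E G v d
            vd = proj₂ (proj₂ B.touch)

            v∉C₁ : ¬ C₁ v
            v∉C₁ c = proj₂ (C₁-D₃ c d∈) vd

            v∉A₁ : ¬ A₁ v
            v∉A₁ W = proj₂ (A₁-D₃ W d∈) vd

            -- Only a neighbour in `A₁` can keep `v` out of the component `D₃`.
            v-touch : Touch v A₁
            v-touch = decidable-stable (touch? A₁? v) λ ¬t →
              B.∉C₁ (reach-snoc d∈ (E-sym G vd) (B.≢a , v∉C₁ , v∉A₁ , ¬t))

            α : V G
            α = proj₁ v-touch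
            W : A₁ α
            W = proj₁ (proj₂ v-touch)
            vα : E G v α
            vα = proj₂ (proj₂ v-touch)

            C₁-v : ∀ {c} → C₁ c → Off G c v
            C₁-v c = (λ { refl → v∉C₁ c }) , λ e →
              v∉A₁ record { ≢a = B.≢a ; ∉C₁ = v∉C₁ ; touch = _ , c , E-sym G e }

            C₂₃ : V G → Set
            C₂₃ = C₂ ⋓ C₃

            C₂₃? : Decidable C₂₃
            C₂₃? u = F.C₂? u ⊎-dec F.C₃? u

            α-free : ∀ {u} → C₂₃ u → Off G α u
            α-free (inj₁ c) = Regular.free₂ (all W) c
            α-free (inj₂ c) = Regular.free₃ (all W) c

            v∉C₂₃ : ¬ C₂₃ v
            v∉C₂₃ c = proj₂ (α-free c) (E-sym G vα)

            Hit : V G → Set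
            Hit u = C₂₃ u ⊎ Touch u C₂₃

            hit? : Decidable Hit
            hit? u = C₂₃? u ⊎-dec touch? C₂₃? u

            Free : V G → Set
            Free u = (v ▹ D₃) u × ¬ Hit u

            Q : V G → Set
            Q = Reach G Free v

            Q? : Decidable Q
            Q? = reach? (λ u → ((u Finₚ.≟ v) ⊎-dec D₃? u) ×-dec ¬? (hit? u)) v

            module _ {u} (u∈ : (v ▹ D₃) u) (u∉ : ¬ C₂₃ u)
              (origin : v ≡ u ⊎ ∃[ q ] Q q × E G q u) where

              P : V G → Set
              P = u ▹ Q

              P? : Decidable P
              P? y = (y Finₚ.≟ u) ⊎-dec Q? y

              P⊆ : ∀ {y} → P y → (v ▹ D₃) y
              P⊆ (inj₁ refl) = u∈
              P⊆ (inj₂ q) = proj₁ (reach-end q)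

              v∈P : P v
              v∈P = case origin of λ where
                (inj₁ v≡u) → inj₁ v≡u
                (inj₂ (q , r , _)) → inj₂ (here (reach-start r))

              P-walk : ∀ {y} → P y → Reach G P y u
              P-walk (inj₁ refl) = here (inj₁ refl)
              P-walk (inj₂ q) = reach-trans (reach-mono inj₂ (reach-sym (reach-within q))) from-v
                where
                from-v : Reach G P v u
                from-v = case origin of λ where
                  (inj₁ v≡u) → subst (Reach G P v) v≡u (here v∈P)
                  (inj₂ (_ , r , e)) → reach-snoc (reach-mono inj₂ (reach-within r)) e (inj₁ refl)

              C₁-P : Apart G C₁ P
              C₁-P c p with P⊆ p
              ... | inj₁ refl = C₁-v c
              ... | inj₂ d = C₁-D₃ c d

              α′-P : ∀ {y} → P y → Off G α′ y
              α′-P p with P⊆ p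
              ... | inj₁ refl = (λ { refl → v∉A₁ W′ }) , α′≁v
              ... | inj₂ d = A₁-D₃ W′ d

              P≢b₂ : ∀ {y} → P y → b₂ ≢ y
              P≢b₂ p refl with P⊆ p
              ... | inj₁ refl = α′≁v (Regular.adj₂ (all W′))
              ... | inj₂ d = proj₂ (A₁-D₃ W′ d) (Regular.adj₂ (all W′))

              P≢b₃ : ∀ {y} → P y → b₃ ≢ y
              P≢b₃ p refl with P⊆ p
              ... | inj₁ refl = α′≁v (Regular.adj₃ (all W′))
              ... | inj₂ d = proj₂ (A₁-D₃ W′ d) (Regular.adj₃ (all W′))

              Q-off : ∀ {c} → C₂₃ c → ∀ {y} → Q y → Off G c y
              Q-off c q = (λ { refl → proj₂ (reach-end q) (inj₁ c) }) ,
                λ e → proj₂ (reach-end q) (inj₂ (_ , c , E-sym G e))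

              P-off : ∀ {c} → C₂₃ c → ¬ E G u c → ∀ {y} → P y → Off G c y
              P-off c ¬e (inj₁ refl) = (λ { refl → u∉ c }) , ¬e ∘ E-sym G
              P-off c ¬e (inj₂ q) = Q-off c q

              both-absurd : Touch u C₂ → Touch u C₃ → ⊥
              both-absurd t₂ t₃ = claw u≢a (touch-arm F.lobe₂ t₂) (touch-arm F.lobe₃ t₃) back F.apart₂₃
                (back-off inj₁ (Fork.apart₁₂ fork)) (back-off inj₂ (Fork.apart₁₃ fork))
                where
                u≢a : u ≢ a
                u≢a = case u∈ of λ where
                  (inj₁ eq) → subst (_≢ a) (≡-sym eq) B.≢a
                  (inj₂ d) → proj₁ (reach-end d)
                α-arm : Arm v (α ▹ C₁)
                α-arm = arm-▹ vα (touch-arm (Fork.lobe₁ fork) (Frontier.touch W))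
                back : Arm u (Q ⋓ (α ▹ C₁))
                back = case origin of λ where
                  (inj₁ v≡u) → subst (λ x → Arm x (Q ⋓ (α ▹ C₁))) v≡u (arm-mono inj₂ α-arm)
                  (inj₂ (q , r , e)) → case α-arm of λ where
                    (arm e′ w t) → arm (E-sym G e)
                      (reach-trans (reach-mono inj₁ (reach-sym (reach-within r)))
                        (step (inj₁ (here (reach-start r))) e′ (reach-mono inj₂ w))) t
                back-off : ∀ {C} → (∀ {c} → C c → C₂₃ c) → Apart G C₁ C → Apart G C (Q ⋓ (α ▹ C₁))
                back-off f g c (inj₁ q) = Q-off (f c) q
                back-off f g c (inj₂ (inj₁ refl)) = off-sym G (α-free (f c))
                back-off f g c (inj₂ (inj₂ x)) = off-sym G (g x c)

              end-absurd : Touch u C₂₃ → ⊥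
              end-absurd t with touch? F.C₂? u | touch? F.C₃? u
              ... | yes t₂ | yes t₃ = both-absurd t₂ t₃
              ... | no ¬t₂ | yes t₃ = connector-claw fork P? P-walk v∈P (E-sym G vα) W (all W)
                      W′ (all W′) C₁-P α′-P
                      (λ c p → P-off (inj₁ c) (λ e → ¬t₂ (_ , c , e)) p) P≢b₂ t₃
              ... | yes t₂ | no ¬t₃ = connector-claw (swap fork) P? P-walk v∈P (E-sym G vα) W
                      (regular-swap (all W)) W′ (regular-swap (all W′)) C₁-P α′-P
                      (λ c p → P-off (inj₂ c) (λ e → ¬t₃ (_ , c , e)) p) P≢b₃ t₂
              ... | no ¬t₂ | no ¬t₃ with t
              ...   | x , inj₁ c , e = ¬t₂ (x , c , e)
              ...   | x , inj₂ c , e = ¬t₃ (x , c , e)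

          -- Walking from `v` through `D₃` towards `C₃`, let `u` be the first vertex with a
          -- neighbour in `C₂` or `C₃`. If it has neighbours in both, there is a claw at `u` whose
          -- third arm returns through `v` and `α` to `C₁`. If in one only, the stretch from `v` to
          -- `u` is the connection needed in `connector-claw`.
          incomplete-absurd : ⊥
          incomplete-absurd
            with first-hit hit? (step (inj₁ refl) vd
                   (reach-mono inj₂ (reach-sym (reach-within d∈)))) (inj₁ (inj₂ (proj₁ (proj₂ F.touch₃))))
          ... | u , u∈ , inj₂ t , origin = end-absurd u∈ u∉ origin t
            where
            u∉ : ¬ C₂₃ u
            u∉ c = case origin of λ where
              (inj₁ v≡u) → v∉C₂₃ (subst C₂₃ (≡-sym v≡u) c)
              (inj₂ (q , r , e)) → proj₂ (reach-end r) (inj₂ (u , c , e))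
          ... | u , u∈ , inj₁ c , inj₁ refl = v∉C₂₃ c
          ... | u , u∈ , inj₁ c , inj₂ (q , r , e) = proj₂ (reach-end r) (inj₂ (u , c , e))

        join : Join Left Right Base
        join = record
          { A = A₁ ; B = Frontier D₃ ; A? = A₁? ; B? = frontier? D₃?
          ; A≢a = Frontier.≢a ; B≢a = Frontier.≢a ; complete = complete ; A-sep = A₁-sep
          ; B-sep = λ (_ , k) (_ , c) r → frontier-separates D₃? (C₃⊆D₃ c)
              (λ d → proj₁ (C₁-D₃ (K⊆C₁ k) d) refl) (reach-sym r)
          ; A-near = near-base
          ; B-near = λ B → b₁ , inj₁ refl , E-sym G (complete b₁∈A₁ B) }
          where
          complete : ∀ {p q} → A₁ p → Frontier D₃ q → E G p q
          complete {p} {q} W B = decidable-stable (E? G p q) (incomplete-absurd B W)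

      module SomeBypass {w₀} (W₀ : A₁ w₀) (B₀ : Bypass C₂ C₃ b₂ w₀ ⊎ Bypass C₃ C₂ b₃ w₀) where
        Below : V G → V G → Set
        Below y v = C₁ v × (v ≡ y ⊎ ¬ Touch v A₁)

        -- The vertices next to `A₁` that walks inside `C₁` starting at terminals meet first.
        -- `Below y` contains such a walk ending in `y`; apart from `y` it is anticomplete to `A₁`,
        -- which makes it fit for an arm.
        Y : V G → Set
        Y y = Touch y A₁ × ∃[ z ] Term z × Reach G (Below y) z y

        Y? : Decidable Y
        Y? y = touch? A₁? y ×-dec Finₚ.any? (λ z → E? G a z ×-dec
          reach? (λ v → C₁? v ×-dec ((v Finₚ.≟ y) ⊎-dec ¬? (touch? A₁? v))) z y)

        -- A walk to the right must leave `C₁`, and it leaves from a vertex with a neighbour in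
        -- `A₁`. The first such vertex on the walk is in `Y`.
        Y-sep : ∀ {z z′} → Left z → Right z′ → ¬ Reach G (λ v → v ≢ a × ¬ Y v) z z′
        Y-sep {z} {z′} (tz , k) (_ , c) r with touch? A₁? z
        ... | yes t = proj₂ (reach-start r) (t , z , tz , here (K⊆C₁ k , inj₁ refl))
        ... | no ¬t = go r (here (K⊆C₁ k , ¬t))
          where
          go : ∀ {p} → Reach G (λ v → v ≢ a × ¬ Y v) p z′ →
            Reach G (λ v → C₁ v × ¬ Touch v A₁) z p → ⊥
          go (here _) s = proj₁ (C₁-off (proj₁ (reach-end s)) (inj₂ (inj₂ c))) refl
          go (step {v = q} _ e r) s with C₁? q
          ... | no ¬c = proj₂ (reach-end s) (q , record
                  { ≢a = proj₁ (reach-start r) ; ∉C₁ = ¬c ; touch = _ , proj₁ (reach-end s) , E-sym G e } , e)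
          ... | yes cq with touch? A₁? q
          ...   | no ¬t = go r (reach-snoc s e (cq , ¬t))
          ...   | yes t = proj₂ (reach-start r) (t , z , tz ,
                    reach-snoc (reach-mono (λ (x , y) → x , inj₂ y) s) e (cq , inj₁ refl))

        module _ {y} (Yy : Y y) where
          y-arm : ∀ {v} → E G v y → Arm v (Below y)
          y-arm e = arm e (reach-sym (proj₂ (proj₂ (proj₂ Yy)))) (proj₁ (proj₂ (proj₂ Yy)))

          below-off : ∀ {v} → A₁ v → ¬ E G y v → ∀ {u} → Below y u → Off G u v
          below-off W ¬e (c , inj₁ refl) = (λ { refl → Frontier.∉C₁ W c }) , ¬e
          below-off W ¬e (c , inj₂ ¬t) = (λ { refl → Frontier.∉C₁ W c }) , λ e → ¬t (_ , W , e)

          to-bypass : ∀ {b w} → A₁ b → Regular C₁ C₂ C₃ b₂ b₃ b → A₁ w →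
            Bypass C₂ C₃ b₂ w ⊎ Bypass C₃ C₂ b₃ w → E G y b → E G y w
          to-bypass B R W (inj₁ Bw) = regular⇒bypass fork proj₁ y-arm below-off B R W Bw
          to-bypass B R W (inj₂ Bw) =
            regular⇒bypass (swap fork) proj₁ y-arm below-off B (regular-swap R) W Bw

          to-regular : ∀ {b w} → A₁ b → Regular C₁ C₂ C₃ b₂ b₃ b → A₁ w →
            Bypass C₂ C₃ b₂ w ⊎ Bypass C₃ C₂ b₃ w → E G y w → E G y b
          to-regular B R W (inj₁ Bw) = bypass⇒regular fork proj₁ y-arm below-off B R W Bw
          to-regular B R W (inj₂ Bw) =
            bypass⇒regular (swap fork) proj₁ y-arm below-off B (regular-swap R) W Bw

          -- Adjacency to `y` passes only between a regular and a bypassing vertex. Two vertices of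
          -- one kind are therefore compared through a fixed vertex of the other: `w₀` for regular
          -- ones, `b₁` for bypassing ones.
          y-b₁ : E G y b₁
          y-b₁ = via (proj₁ Yy)
            where
            via : Touch y A₁ → E G y b₁
            via (w , W , e) with kinds W
            ... | inj₁ R = to-regular b₁∈A₁ b₁-regular W₀ B₀ (to-bypass W R W₀ B₀ e)
            ... | inj₂ B = to-regular b₁∈A₁ b₁-regular W B e

          Y-complete : ∀ {w} → A₁ w → E G y w
          Y-complete W with kinds W
          ... | inj₁ R = to-regular W R W₀ B₀ (to-bypass b₁∈A₁ b₁-regular W₀ B₀ y-b₁)
          ... | inj₂ B = to-bypass b₁∈A₁ b₁-regular W B y-b₁

        join : Join Left Right Base
        join = record
          { A = Y ; B = A₁ ; A? = Y? ; B? = A₁?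
          ; A≢a = λ (_ , _ , _ , r) → C₁≢a fork (proj₁ (reach-end r)) ; B≢a = Frontier.≢a
          ; complete = λ y W → Y-complete y W ; A-sep = Y-sep ; B-sep = A₁-sep
          ; A-near = λ y → b₁ , inj₁ refl , Y-complete y b₁∈A₁ ; B-near = near-base }

    join : Join (λ z → Term z × K z) (λ z → Term z × C₃ z) (λ v → v ≡ b₁ ⊎ v ≡ b₂ ⊎ v ≡ b₃)
    join with Finₚ.any? (λ w → A₁? w ×-dec ¬? (E? G w b₂ ×-dec E? G w b₃))
    ... | yes (w , W , ¬r) = bypassed (kinds W)
      where
      bypassed : Regular C₁ C₂ C₃ b₂ b₃ w ⊎ Bypass C₂ C₃ b₂ w ⊎ Bypass C₃ C₂ b₃ w →
        Join Left Right Base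
      bypassed (inj₁ R) = contradiction (Regular.adj₂ R , Regular.adj₃ R) ¬r
      bypassed (inj₂ B) = SomeBypass.join W B
    ... | no ¬bypass = AllRegular.join all-regular
      where
      all-regular : ∀ {w} → A₁ w → Regular C₁ C₂ C₃ b₂ b₃ w
      all-regular {w} W =
        let e₂ , e₃ = decidable-stable (E? G w b₂ ×-dec E? G w b₃) (λ ¬r → ¬bypass (w , W , ¬r))
        in regular fork W e₂ e₃

  -- Small separators from complete pairs

  Avoiding : List (V G) → V G → Set
  Avoiding M v = v ≢ a × v ∉ₗ M

  record Separator (L R T : V G → Set) (c : ℕ) : Set where
    field
      M        : List (V G)
      small    : length M ≤ c
      M≢a      : All (_≢ a) M
      near     : All (λ v → Touch v T) M
      separate : ∀ {z z′} → L z → R z′ → ¬ Reach G (Avoiding M) z z′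

  small-separator : ∀ {L R T t} → ¬ HasClique G t → Join L R T → Separator L R T (ramsey t)
  small-separator {t = t} nc J with complete-pair-small G {t} tf nc (Join.A? J) (Join.B? J) (Join.complete J)
  ... | inj₁ le = record
    { M = members G A? ; small = le ; M≢a = All.map A≢a (members-all G A?)
    ; near = All.map A-near (members-all G A?)
    ; separate = λ l r w → A-sep l r (reach-mono (λ (≢a , ∉M) → ≢a , ∉M ∘ ∈-members G A?) w) }
    where open Join J
  ... | inj₂ le = record
    { M = members G B? ; small = le ; M≢a = All.map B≢a (members-all G B?)
    ; near = All.map B-near (members-all G B?)
    ; separate = λ l r w → B-sep l r (reach-mono (λ (≢a , ∉M) → ≢a , ∉M ∘ ∈-members G B?) w) }
    where open Join J

-- Counting neighbours and numbering a path

length-filter-tabulate : ∀ {A : Set} (f : A → Bool) {m} (g : Fin m → A) →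
  length (filter (λ x → T? (f x)) (List.tabulate g)) ≡ ∣ Vec.tabulate (f ∘ g) ∣
length-filter-tabulate f {zero} g = refl
length-filter-tabulate f {suc m} g with f (g Fin.zero)
... | true = cong suc (length-filter-tabulate f (g ∘ Fin.suc))
... | false = length-filter-tabulate f (g ∘ Fin.suc)

length-neighbours : ∀ G v → length (members G (E? G v)) ≡ deg G v
length-neighbours G v = length-filter-tabulate (adj G v) id

pigeonhole₃ : ∀ {A : Set} {x y z : A} xs → length xs ≤ 2 → x ∈ₗ xs → y ∈ₗ xs → z ∈ₗ xs →
  x ≡ y ⊎ x ≡ z ⊎ y ≡ z
pigeonhole₃ (_ ∷ _) _ (hereₐ refl) (hereₐ refl) _ = inj₁ refl
pigeonhole₃ (_ ∷ _) _ (hereₐ refl) (thereₐ _) (hereₐ refl) = inj₂ (inj₁ refl)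
pigeonhole₃ (_ ∷ _) _ (thereₐ _) (hereₐ refl) (hereₐ refl) = inj₂ (inj₂ refl)
pigeonhole₃ (_ ∷ _ ∷ []) _ (thereₐ (hereₐ refl)) (thereₐ (hereₐ refl)) _ = inj₁ refl
pigeonhole₃ (_ ∷ _ ∷ []) _ (thereₐ (hereₐ refl)) (hereₐ _) (thereₐ (hereₐ refl)) = inj₂ (inj₁ refl)
pigeonhole₃ (_ ∷ _ ∷ []) _ (hereₐ _) (thereₐ (hereₐ refl)) (thereₐ (hereₐ refl)) = inj₂ (inj₂ refl)
pigeonhole₃ (_ ∷ _ ∷ _ ∷ _) (s≤s (s≤s ()))

record Sequence {A : Set} (R : A → A → Set) (k : ℕ) (P : Path R k) : Set where
  field
    p     : ℕ → A
    p-vtx : ∀ i → vtx P i ≡ p (toℕ i)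
    p-inj : ∀ {i j} → i ≤ k → j ≤ k → p i ≡ p j → i ≡ j
    p-rel : ∀ {i} → i < k → R (p i) (p (suc i))

sequence : ∀ {A : Set} {R : A → A → Set} {k} (P : Path R k) → Sequence R k P
sequence {A} {R} {k} P = record
  { p = vtx P ∘ clamp ; p-vtx = λ i → cong (vtx P) (≡-sym (clamp-toℕ i))
  ; p-inj = λ i≤ j≤ eq → trans (≡-sym (toℕ-clamp i≤)) (trans (cong toℕ (inj P eq)) (toℕ-clamp j≤))
  ; p-rel = λ lt → cons P _ _ (inj₂ (trans (toℕ-clamp lt) (cong suc (≡-sym (toℕ-clamp (ℕₚ.<⇒≤ lt)))))) }
  where
  -- Positions beyond `k` are sent to the last vertex, which makes `p` total.
  clamp : ℕ → Fin (suc k)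
  clamp i = Fin.fromℕ< (s≤s (ℕₚ.m⊓n≤n i k))
  toℕ-clamp : ∀ {i} → i ≤ k → toℕ (clamp i) ≡ i
  toℕ-clamp le = trans (Finₚ.toℕ-fromℕ< _) (ℕₚ.m≤n⇒m⊓n≡m le)
  clamp-toℕ : ∀ i → clamp (toℕ i) ≡ i
  clamp-toℕ i = Finₚ.toℕ-injective (toℕ-clamp (ℕₚ.≤-pred (Finₚ.toℕ<n i)))

path-reach : ∀ {F k} (P : Path (E F) k) → Reach F (λ _ → ⊤) (first P) (last P)
path-reach {F} {k} P = subst₂ (Reach F _) (≡-sym (p-vtx Fin.zero))
    (≡-sym (trans (p-vtx (fromℕ k)) (cong p (Finₚ.toℕ-fromℕ k)))) (go k ℕₚ.≤-refl)
  where
  open Sequence (sequence P)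
  go : ∀ m → m ≤ k → Reach F (λ _ → ⊤) (p 0) (p m)
  go zero _ = here tt
  go (suc m) le = reach-snoc (go m (ℕₚ.<⇒≤ le)) (p-rel le) tt

-- Branches and legs of the caterpillar

module Caterpillar (F : Graph) (cat : IsCaterpillar F) where

  -- The component of `u` after deletion of `v`; it is used for neighbours `u` of `v`.
  Branch : V F → V F → V F → Set
  Branch v u = Reach F (_≢ v) u

  branch? : ∀ v u → Decidable (Branch v u)
  branch? v u = reach? (λ w → ¬? (w Finₚ.≟ v)) u

  branch-root : ∀ {v u} → E F v u → Branch v u u
  branch-root e = here (λ eq → E⇒≢ F e (≡-sym eq))

  branch-step : ∀ {v u x y} → Branch v u x → E F x y → y ≢ v → Branch v u y
  branch-step = reach-snoc

  private
    module _ {v u q} (vu : E F v u) (vq : E F v q) (u≢q : u ≢ q) (W : InducedWalk F (_≢ v) u q) where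
      open InducedWalk W

      ring : Cycle F
      ring = record
        { k = suc len ; len = s≤s (1≤ len r-len)
        ; P = record { vtx = vertex ; inj = λ {i} {j} → injective i j ; cons = edges }
        ; close = subst (λ w → E F w v) (≡-sym (proj₂ (to-path-ends W))) (E-sym F vq) }
        where
        1≤ : ∀ m → r m ≡ q → 1 ≤ m
        1≤ zero eq = contradiction (trans (≡-sym r-0) eq) u≢q
        1≤ (suc m) _ = s≤s z≤n
        vertex : Fin (suc (suc len)) → V F
        vertex Fin.zero = v
        vertex (Fin.suc i) = r (toℕ i)
        injective : ∀ i j → vertex i ≡ vertex j → i ≡ j
        injective Fin.zero Fin.zero _ = refl
        injective Fin.zero (Fin.suc j) eq = contradiction (≡-sym eq) (inside (toℕ j))
        injective (Fin.suc i) Fin.zero eq = contradiction eq (inside (toℕ i))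
        injective (Fin.suc i) (Fin.suc j) eq = cong Fin.suc (inj (path (to-path W)) eq)
        edge₀ : ∀ i → 0 ≡ toℕ i → E F v (r (toℕ i))
        edge₀ Fin.zero _ = subst (E F v) (≡-sym r-0) vu
        edges : ∀ i j → Consecutive i j → E F (vertex i) (vertex j)
        edges Fin.zero Fin.zero (inj₁ ())
        edges Fin.zero Fin.zero (inj₂ ())
        edges Fin.zero (Fin.suc j) (inj₂ eq) = edge₀ j (ℕₚ.suc-injective (≡-sym eq))
        edges (Fin.suc i) Fin.zero (inj₁ eq) = E-sym F (edge₀ i (ℕₚ.suc-injective (≡-sym eq)))
        edges (Fin.suc i) (Fin.suc j) (inj₁ eq) = cons (path (to-path W)) i j (inj₁ (ℕₚ.suc-injective eq))
        edges (Fin.suc i) (Fin.suc j) (inj₂ eq) = cons (path (to-path W)) i j (inj₂ (ℕₚ.suc-injective eq))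

  -- A walk from `u` to `q` avoiding `v` would close up through `v` to a cycle.
  branches-disjoint : ∀ {v u q x} → E F v u → E F v q → u ≢ q → Branch v u x → ¬ Branch v q x
  branches-disjoint vu vq u≢q b b′ =
    proj₂ (proj₂ (proj₁ cat)) (ring vu vq u≢q (induced-walk (reach-trans b (reach-sym b′))))

  k : ℕ
  k = proj₁ (proj₂ (proj₂ cat))

  spine : Path (E F) k
  spine = proj₁ (proj₂ (proj₂ (proj₂ cat)))

  open Sequence (sequence spine) public

  Spine : V F → Set
  Spine v = ∃[ i ] vtx spine i ≡ v

  spine? : Decidable Spine
  spine? v = Finₚ.any? (λ i → vtx spine i Finₚ.≟ v)

  p-spine : ∀ {j} → j ≤ k → Spine (p j)
  p-spine {j} le = Fin.fromℕ< (s≤s le) , trans (p-vtx _) (cong p (Finₚ.toℕ-fromℕ< (s≤s le)))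

  spine-index : ∀ {v} → Spine v → ∃[ j ] j ≤ k × p j ≡ v
  spine-index (i , eq) = toℕ i , ℕₚ.≤-pred (Finₚ.toℕ<n i) , trans (≡-sym (p-vtx i)) eq

  -- The component of `p j` after deletion of all other spine vertices.
  Hang : ℕ → V F → Set
  Hang j = Reach F (λ v → v ≡ p j ⊎ ¬ Spine v) (p j)

  hang? : ∀ j → Decidable (Hang j)
  hang? j = reach? (λ v → (v Finₚ.≟ p j) ⊎-dec ¬? (spine? v)) (p j)

  hang-root : ∀ {j} → Hang j (p j)
  hang-root = here (inj₁ refl)

  -- Follow a path from `p 0` to `v` and remember the last spine vertex passed.
  hangs : ∀ v → ∃[ j ] j ≤ k × Hang j v
  hangs v with proj₁ (proj₂ (proj₁ cat)) (p 0) v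
  ... | _ , P , eq , refl = go (0 , z≤n , subst (Hang 0) (≡-sym eq) (hang-root {0})) (path-reach P)
    where
    go : ∀ {u v} → ∃[ j ] j ≤ k × Hang j u → Reach F (λ _ → ⊤) u v → ∃[ j ] j ≤ k × Hang j v
    go h (here _) = h
    go (j , le , h) (step {v = w} _ e r) with spine? w
    ... | no ¬s = go (j , le , reach-snoc h e (inj₂ ¬s)) r
    ... | yes s with spine-index s
    ...   | i , le′ , refl = go (i , le′ , hang-root) r

  hang-avoids : ∀ {i j} → i ≤ k → j ≤ k → i ≢ j → ∀ {v} → Hang i v → Branch (p j) (p i) v
  hang-avoids i≤ j≤ i≢j = reach-mono λ where
    (inj₁ refl) eq → i≢j (p-inj i≤ j≤ eq)
    (inj₂ ¬s) refl → ¬s (p-spine j≤)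

  -- Together with `hang-right` this translates positions along the spine into sides of the triangle
  -- at a spine vertex.
  hang-left : ∀ {i j v} → i ≤ j → j < k → Hang i v → Branch (p (suc j)) (p j) v
  hang-left {i} {j} i≤j j<k h =
    reach-trans (down j i≤j ℕₚ.≤-refl) (hang-avoids (ℕₚ.≤-trans i≤j (ℕₚ.<⇒≤ j<k)) j<k (ℕₚ.<⇒≢ (s≤s i≤j)) h)
    where
    ≢ : ∀ {m} → m ≤ j → p m ≢ p (suc j)
    ≢ m≤j eq = ℕₚ.<⇒≢ (s≤s m≤j) (p-inj (ℕₚ.≤-trans m≤j (ℕₚ.<⇒≤ j<k)) j<k eq)
    down : ∀ m → i ≤ m → m ≤ j → Branch (p (suc j)) (p m) (p i)
    down m i≤m m≤j with ℕₚ.m≤n⇒m<n∨m≡n i≤m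
    ... | inj₂ refl = here (≢ m≤j)
    down (suc m) i≤m m≤j | inj₁ (s≤s i≤m′) =
      step (≢ m≤j) (E-sym F (p-rel (ℕₚ.≤-trans m≤j (ℕₚ.<⇒≤ j<k)))) (down m i≤m′ (ℕₚ.<⇒≤ m≤j))

  hang-right : ∀ {i j v} → j < i → i ≤ k → Hang i v → Branch (p j) (p (suc j)) v
  hang-right {i} {j} j<i i≤k h = reach-trans (up i j<i i≤k)
    (hang-avoids i≤k (ℕₚ.<⇒≤ (ℕₚ.<-≤-trans j<i i≤k)) (ℕₚ.>⇒≢ j<i) h)
    where
    ≢ : ∀ {m} → j < m → m ≤ k → p m ≢ p j
    ≢ j<m m≤k eq = ℕₚ.>⇒≢ j<m (p-inj m≤k (ℕₚ.≤-trans (ℕₚ.<⇒≤ j<m) m≤k) eq)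
    up : ∀ m → j < m → m ≤ k → Branch (p j) (p (suc j)) (p m)
    up m j<m m≤k with ℕₚ.m≤n⇒m<n∨m≡n j<m
    ... | inj₂ refl = here (≢ j<m m≤k)
    up (suc m) j<m m≤k | inj₁ (s≤s j<m′) =
      reach-snoc (up m j<m′ (ℕₚ.<⇒≤ m≤k)) (p-rel m≤k) (≢ j<m m≤k)

  hang-leg : ∀ {j v} → Hang j v → p j ≢ v → ∃[ q ] E F (p j) q × Reach F (¬_ ∘ Spine) q v
  hang-leg h ne with last-exit h ne
  ... | q , e , r = q , e , reach-mono (λ { (inj₁ eq , ne′) → contradiction eq ne′ ; (inj₂ ¬s , _) → ¬s }) r

  Leaf : V F → V F → Set
  Leaf ℓ y = E F ℓ y × (∀ {y′} → E F ℓ y′ → y′ ≡ y)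

  off-spine-degree : ∀ {v x y z} → ¬ Spine v → E F v x → E F v y → E F v z →
    x ≢ y → x ≢ z → y ≡ z
  off-spine-degree {v} ¬s vx vy vz x≢y x≢z
    with pigeonhole₃ (members F (E? F v)) small
           (∈-members F (E? F v) vx) (∈-members F (E? F v) vy) (∈-members F (E? F v) vz)
    where
    small : length (members F (E? F v)) ≤ 2
    small = subst (_≤ 2) (≡-sym (length-neighbours F v))
      (ℕₚ.≮⇒≥ λ lt → ¬s (proj₂ (proj₂ (proj₂ (proj₂ cat))) v lt))
  ... | inj₁ eq = contradiction eq x≢y
  ... | inj₂ (inj₁ eq) = contradiction eq x≢z
  ... | inj₂ (inj₂ eq) = eq

  -- Off the spine degrees are at most two, so a walk leaving the spine is forced.
  forced : ∀ {w u} xs ys → E F w u → All (_≢ w) xs → All (_≢ w) ys →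
    Ind F u xs → Ind F u ys → All (¬_ ∘ Spine) (u ∷ xs) →
    ∃[ y ] Leaf (end u xs) y → ∃[ y ] Leaf (end u ys) y → end u xs ≡ end u ys
  forced [] [] _ _ _ _ _ _ _ _ = refl
  forced [] (y ∷ ys) wu _ (y≢w ∷ _) _ (uy , _) _ (_ , _ , leaf) _ =
    contradiction (trans (leaf uy) (≡-sym (leaf (E-sym F wu)))) y≢w
  forced (x ∷ xs) [] wu (x≢w ∷ _) _ (ux , _) _ _ _ (_ , _ , leaf) =
    contradiction (trans (leaf ux) (≡-sym (leaf (E-sym F wu)))) x≢w
  forced {w} {u} (x ∷ xs) (y ∷ ys) wu (x≢w ∷ _) (y≢w ∷ _) (ux , offx , indx) (uy , offy , indy) (¬s ∷ ¬ss) lx ly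
    with off-spine-degree ¬s (E-sym F wu) ux uy (x≢w ∘ ≡-sym) (y≢w ∘ ≡-sym)
  ... | refl = forced xs ys ux (All.map (λ o → proj₁ o ∘ ≡-sym) offx) (All.map (λ o → proj₁ o ∘ ≡-sym) offy)
                 indx indy ¬ss lx ly

  leg-leaf-unique : ∀ {j q ℓ ℓ′ y y′} → j ≤ k → E F (p j) q →
    Reach F (¬_ ∘ Spine) q ℓ → Reach F (¬_ ∘ Spine) q ℓ′ → Leaf ℓ y → Leaf ℓ′ y′ → ℓ ≡ ℓ′
  leg-leaf-unique j≤k e r r′ l l′ with induced-list r | induced-list r′
  ... | xs , ind , refl , al | ys , ind′ , refl , al′ =
    forced xs ys e (avoid al) (avoid al′) ind ind′ al (_ , l) (_ , l′)
    where
    avoid : ∀ {u xs} → All (¬_ ∘ Spine) (u ∷ xs) → All (_≢ p _) xs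
    avoid (_ ∷ al) = All.map (λ { ¬s refl → ¬s (p-spine j≤k) }) al

-- The line graph of the subdivision in terms of darts

module _ (F : Graph) where

  -- A `UEdge` stores its ends in increasing order; this relation forgets the order.
  Ends : UEdge F → V F → V F → Set
  Ends (u , v , _) x y = (x ≡ u × y ≡ v) ⊎ (x ≡ v × y ≡ u)

  ends-swap : ∀ f {x y} → Ends f x y → Ends f y x
  ends-swap f (inj₁ (a , b)) = inj₂ (b , a)
  ends-swap f (inj₂ (a , b)) = inj₁ (b , a)

  ends-determined : ∀ f {x y x′ y′} → Ends f x y → Ends f x′ y′ →
    (x ≡ x′ × y ≡ y′) ⊎ (x ≡ y′ × y ≡ x′)
  ends-determined f (inj₁ (refl , refl)) (inj₁ (refl , refl)) = inj₁ (refl , refl)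
  ends-determined f (inj₁ (refl , refl)) (inj₂ (refl , refl)) = inj₂ (refl , refl)
  ends-determined f (inj₂ (refl , refl)) (inj₁ (refl , refl)) = inj₂ (refl , refl)
  ends-determined f (inj₂ (refl , refl)) (inj₂ (refl , refl)) = inj₁ (refl , refl)

  ends-injective : ∀ f g {x y} → Ends f x y → Ends g x y → f ≡ g
  ends-injective (u , v , lt , e) (_ , _ , lt′ , e′) (inj₁ (refl , refl)) (inj₁ (refl , refl)) =
    cong₂ (λ l d → u , v , l , d) (Finₚ.<-irrelevant lt lt′) (T-irrelevant e e′)
  ends-injective (_ , _ , lt , _) (_ , _ , lt′ , _) (inj₁ (refl , refl)) (inj₂ (refl , refl)) =
    contradiction lt′ (ℕₚ.<-asym lt)
  ends-injective (_ , _ , lt , _) (_ , _ , lt′ , _) (inj₂ (refl , refl)) (inj₁ (refl , refl)) =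
    contradiction lt′ (ℕₚ.<-asym lt)
  ends-injective (u , v , lt , e) (_ , _ , lt′ , e′) (inj₂ (refl , refl)) (inj₂ (refl , refl)) =
    cong₂ (λ l d → u , v , l , d) (Finₚ.<-irrelevant lt lt′) (T-irrelevant e e′)

  edge : ∀ {x y} → E F x y → Σ (UEdge F) λ f → Ends f x y
  edge {x} {y} e with Finₚ.<-cmp x y
  ... | tri< lt _ _ = (x , y , lt , e) , inj₁ (refl , refl)
  ... | tri≈ _ refl _ = ⊥-elim (E-irrefl F e)
  ... | tri> _ _ gt = (y , x , gt , E-sym F e) , inj₂ (refl , refl)

  ends-adj : ∀ f {x y} → Ends f x y → E F x y
  ends-adj (_ , _ , _ , e) (inj₁ (refl , refl)) = e
  ends-adj (_ , _ , _ , e) (inj₂ (refl , refl)) = E-sym F e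

-- The edges of the 1-subdivision of F are the darts of F: the dart from x to y
-- is the half of the edge xy at x.
record Darts (F G : Graph) (H : Subset (n G)) : Set where
  field
    h      : ∀ {x y} → E F x y → V G
    h∈H    : ∀ {x y} (e : E F x y) → h e ∈ H
    h-onto : ∀ {v} → v ∈ H → ∃₂ λ x y → Σ (E F x y) λ e → v ≡ h e
    h-inj  : ∀ {x y x′ y′} {e : E F x y} {e′ : E F x′ y′} → h e ≡ h e′ → x ≡ x′ × y ≡ y′
    h-adj  : ∀ {x y x′ y′} {e : E F x y} {e′ : E F x′ y′} → E G (h e) (h e′) →
             (x ≡ x′ × y ≢ y′) ⊎ (x ≡ y′ × y ≡ x′)
    h-star : ∀ {x y y′} {e : E F x y} {e′ : E F x y′} → y ≢ y′ → E G (h e) (h e′)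
    h-flip : ∀ {x y} {e : E F x y} {e′ : E F y x} → E G (h e) (h e′)

darts : ∀ F G H → IsoToLineGraph (InducedV G H) (InducedE G H) (Subdivision F) → Darts F G H
darts F G H (φ , φ-inj , φ-onto , φ-adj) = record
  { h = λ e → proj₁ (w e) ; h∈H = λ e → proj₂ (w e) ; h-onto = onto
  ; h-inj = λ {_} {_} {_} {_} {e} {e′} eq → w-inj e e′ (vertex-≡ (w e) (w e′) eq)
  ; h-adj = λ {_} {_} {_} {_} {e} {e′} → adjacent e e′
  ; h-star = λ {_} {_} {_} {e} {e′} → star e e′
  ; h-flip = λ {_} {_} {e} {e′} → flip e e′ }
  where
  K : SGraph
  K = Subdivision F

  -- The vertex w corresponds to the edge between x and the midpoint of f.
  Flag : InducedV G H → V F → UEdge F → Set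
  Flag w x f = (src {K} (φ w) ≡ inj₁ x × tgt {K} (φ w) ≡ inj₂ f)
             ⊎ (src {K} (φ w) ≡ inj₂ f × tgt {K} (φ w) ≡ inj₁ x)

  flag-same : ∀ {w w′ x f} → Flag w x f → Flag w′ x f → SameEdge {K} (φ w) (φ w′)
  flag-same (inj₁ (a , b)) (inj₁ (c , d)) = inj₁ (trans a (≡-sym c) , trans b (≡-sym d))
  flag-same (inj₁ (a , b)) (inj₂ (c , d)) = inj₂ (trans a (≡-sym d) , trans b (≡-sym c))
  flag-same (inj₂ (a , b)) (inj₁ (c , d)) = inj₂ (trans a (≡-sym d) , trans b (≡-sym c))
  flag-same (inj₂ (a , b)) (inj₂ (c , d)) = inj₁ (trans a (≡-sym c) , trans b (≡-sym d))

  -- The subdivision is bipartite: a common end is either an original vertex for both edges or a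
  -- midpoint for both, and the mixed equations are void.
  flag-share : ∀ {w w′ x f x′ f′} → Flag w x f → Flag w′ x′ f′ →
    ShareEnd {K} (φ w) (φ w′) → x ≡ x′ ⊎ f ≡ f′
  flag-share {w} {w′} F₁ F₂ sh with φ w | φ w′
  flag-share (inj₁ (refl , refl)) (inj₁ (refl , refl)) (inj₁ refl) | _ | _ = inj₁ refl
  flag-share (inj₁ (refl , refl)) (inj₁ (refl , refl)) (inj₂ (inj₁ ())) | _ | _
  flag-share (inj₁ (refl , refl)) (inj₁ (refl , refl)) (inj₂ (inj₂ (inj₁ ()))) | _ | _
  flag-share (inj₁ (refl , refl)) (inj₁ (refl , refl)) (inj₂ (inj₂ (inj₂ refl))) | _ | _ = inj₂ refl
  flag-share (inj₁ (refl , refl)) (inj₂ (refl , refl)) (inj₁ ()) | _ | _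
  flag-share (inj₁ (refl , refl)) (inj₂ (refl , refl)) (inj₂ (inj₁ refl)) | _ | _ = inj₁ refl
  flag-share (inj₁ (refl , refl)) (inj₂ (refl , refl)) (inj₂ (inj₂ (inj₁ refl))) | _ | _ = inj₂ refl
  flag-share (inj₁ (refl , refl)) (inj₂ (refl , refl)) (inj₂ (inj₂ (inj₂ ()))) | _ | _
  flag-share (inj₂ (refl , refl)) (inj₁ (refl , refl)) (inj₁ ()) | _ | _
  flag-share (inj₂ (refl , refl)) (inj₁ (refl , refl)) (inj₂ (inj₁ refl)) | _ | _ = inj₂ refl
  flag-share (inj₂ (refl , refl)) (inj₁ (refl , refl)) (inj₂ (inj₂ (inj₁ refl))) | _ | _ = inj₁ refl
  flag-share (inj₂ (refl , refl)) (inj₁ (refl , refl)) (inj₂ (inj₂ (inj₂ ()))) | _ | _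
  flag-share (inj₂ (refl , refl)) (inj₂ (refl , refl)) (inj₁ refl) | _ | _ = inj₂ refl
  flag-share (inj₂ (refl , refl)) (inj₂ (refl , refl)) (inj₂ (inj₁ ())) | _ | _
  flag-share (inj₂ (refl , refl)) (inj₂ (refl , refl)) (inj₂ (inj₂ (inj₁ ()))) | _ | _
  flag-share (inj₂ (refl , refl)) (inj₂ (refl , refl)) (inj₂ (inj₂ (inj₂ refl))) | _ | _ = inj₁ refl

  share-vertex : ∀ {w w′ x f f′} → Flag w x f → Flag w′ x f′ → ShareEnd {K} (φ w) (φ w′)
  share-vertex (inj₁ (a , _)) (inj₁ (c , _)) = inj₁ (trans a (≡-sym c))
  share-vertex (inj₁ (a , _)) (inj₂ (_ , d)) = inj₂ (inj₁ (trans a (≡-sym d)))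
  share-vertex (inj₂ (_ , b)) (inj₁ (c , _)) = inj₂ (inj₂ (inj₁ (trans b (≡-sym c))))
  share-vertex (inj₂ (_ , b)) (inj₂ (_ , d)) = inj₂ (inj₂ (inj₂ (trans b (≡-sym d))))

  share-edge : ∀ {w w′ x x′ f} → Flag w x f → Flag w′ x′ f → ShareEnd {K} (φ w) (φ w′)
  share-edge (inj₁ (_ , b)) (inj₁ (_ , d)) = inj₂ (inj₂ (inj₂ (trans b (≡-sym d))))
  share-edge (inj₁ (_ , b)) (inj₂ (c , _)) = inj₂ (inj₂ (inj₁ (trans b (≡-sym c))))
  share-edge (inj₂ (a , _)) (inj₁ (_ , d)) = inj₂ (inj₁ (trans a (≡-sym d)))
  share-edge (inj₂ (a , _)) (inj₂ (c , _)) = inj₁ (trans a (≡-sym c))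

  flag-unique : ∀ {w x f x′ f′} → Flag w x f → Flag w x′ f′ → x ≡ x′ × f ≡ f′
  flag-unique (inj₁ (a , b)) (inj₁ (c , d)) with trans (≡-sym a) c | trans (≡-sym b) d
  ... | refl | refl = refl , refl
  flag-unique (inj₁ (a , b)) (inj₂ (c , d)) with trans (≡-sym a) c
  ... | ()
  flag-unique (inj₂ (a , b)) (inj₁ (c , d)) with trans (≡-sym a) c
  ... | ()
  flag-unique (inj₂ (a , b)) (inj₂ (c , d)) with trans (≡-sym a) c | trans (≡-sym b) d
  ... | refl | refl = refl , refl

  arc : ∀ {x y} → E F x y → Arc K
  arc {x} e with edge F e
  ... | (u , v , l) , inj₁ (x≡u , _) = inj₁ x , inj₂ (u , v , l) , inj₁ x≡u
  ... | (u , v , l) , inj₂ (x≡v , _) = inj₁ x , inj₂ (u , v , l) , inj₂ x≡v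

  w : ∀ {x y} → E F x y → InducedV G H
  w e = proj₁ (φ-onto (arc e))

  flag : ∀ {x y} (e : E F x y) → Flag (w e) x (proj₁ (edge F e))
  flag e with edge F e | φ-onto (arc e)
  flag e | (u , v , l) , inj₁ _ | _ , inj₁ (a , b) = inj₁ (a , b)
  flag e | (u , v , l) , inj₁ _ | _ , inj₂ (a , b) = inj₂ (a , b)
  flag e | (u , v , l) , inj₂ _ | _ , inj₁ (a , b) = inj₁ (a , b)
  flag e | (u , v , l) , inj₂ _ | _ , inj₂ (a , b) = inj₂ (a , b)

  vertex-≡ : ∀ (v v′ : InducedV G H) → proj₁ v ≡ proj₁ v′ → v ≡ v′
  vertex-≡ (v , i) (_ , i′) refl = cong (v ,_) ([]=-irrelevant i i′)

  same-edge : ∀ {x y x′ y′} (e : E F x y) (e′ : E F x′ y′) → proj₁ (edge F e) ≡ proj₁ (edge F e′) →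
    (x ≡ x′ × y ≡ y′) ⊎ (x ≡ y′ × y ≡ x′)
  same-edge e e′ eq = ends-determined F (proj₁ (edge F e)) (proj₂ (edge F e))
    (subst (λ f → Ends F f _ _) (≡-sym eq) (proj₂ (edge F e′)))

  w-inj : ∀ {x y x′ y′} (e : E F x y) (e′ : E F x′ y′) → w e ≡ w e′ → x ≡ x′ × y ≡ y′
  w-inj e e′ eq with flag-unique {w e} (flag e) (subst (λ v → Flag v _ _) (≡-sym eq) (flag e′))
  ... | x≡x′ , f≡f′ with same-edge e e′ f≡f′
  ...   | inj₁ both = both
  -- The tails agree already, so equal edges read in opposite directions would make `e′` a loop.
  ...   | inj₂ (x≡y′ , _) = ⊥-elim (E-irrefl F (subst (λ z → E F z _) (trans (≡-sym x≡x′) x≡y′) e′))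

  flag-dart : ∀ {v x f} → subAdj F (inj₁ x) (inj₂ f) → Flag v x f →
    ∃₂ λ x y → Σ (E F x y) λ e → proj₁ v ≡ proj₁ (w e)
  flag-dart {v} {x} {f} x∈f fl with other x∈f
    where
    other : subAdj F (inj₁ x) (inj₂ f) → ∃[ y ] Ends F f x y
    other (inj₁ refl) = _ , inj₁ (refl , refl)
    other (inj₂ refl) = _ , inj₂ (refl , refl)
  ... | y , ends = x , y , e , cong proj₁ (φ-inj v (w e)
          (flag-same fl (subst (Flag (w e) x) (ends-injective F _ f (proj₂ (edge F e)) ends) (flag e))))
    where
    e : E F x y
    e = ends-adj F f ends

  onto : ∀ {v} → v ∈ H → ∃₂ λ x y → Σ (E F x y) λ e → v ≡ proj₁ (w e)
  onto {v} v∈H with φ (v , v∈H) in eq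
  ... | inj₁ _ , inj₁ _ , ()
  ... | inj₂ _ , inj₂ _ , ()
  ... | inj₁ x , inj₂ f , x∈f = flag-dart {v , v∈H} x∈f (inj₁ (cong (src {K}) eq , cong (tgt {K}) eq))
  ... | inj₂ f , inj₁ x , x∈f = flag-dart {v , v∈H} x∈f (inj₂ (cong (src {K}) eq , cong (tgt {K}) eq))

  adjacent : ∀ {x y x′ y′} (e : E F x y) (e′ : E F x′ y′) → E G (proj₁ (w e)) (proj₁ (w e′)) →
    (x ≡ x′ × y ≢ y′) ⊎ (x ≡ y′ × y ≡ x′)
  adjacent e e′ a with proj₁ (φ-adj (w e) (w e′)) a
  ... | ne , sh with flag-share (flag e) (flag e′) sh
  ...   | inj₁ refl = inj₁ (refl , λ { refl → ne (cong w (T-irrelevant e e′)) })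
  ...   | inj₂ f≡f′ with same-edge e e′ f≡f′
  ...     | inj₁ (refl , refl) = contradiction (cong w (T-irrelevant e e′)) ne
  ...     | inj₂ crossed = inj₂ crossed

  star : ∀ {x y y′} (e : E F x y) (e′ : E F x y′) → y ≢ y′ → E G (proj₁ (w e)) (proj₁ (w e′))
  star e e′ y≢y′ = proj₂ (φ-adj (w e) (w e′))
    ((λ eq → y≢y′ (proj₂ (w-inj e e′ eq))) , share-vertex (flag e) (flag e′))

  flip : ∀ {x y} (e : E F x y) (e′ : E F y x) → E G (proj₁ (w e)) (proj₁ (w e′))
  flip e e′ = proj₂ (φ-adj (w e) (w e′))
    ((λ eq → E⇒≢ F e (proj₁ (w-inj e e′ eq))) ,
      share-edge (flag e) (subst (Flag (w e′) _)
        (ends-injective F _ _ (ends-swap F (proj₁ (edge F e′)) (proj₂ (edge F e′))) (proj₂ (edge F e))) (flag e′)))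

-- Terminals as darts at leaves

module SeedTerminals {F G : Graph} {H : Subset (n G)} (D : Darts F G H) (a : V G)
  (simplicial : ∀ {v} → E G a v → Simplicial G H v)
  (close : ∀ u → Dist≤2 G a u → u ∈ H ∪ ⁅ a ⁆) where
  open Darts D

  -- A dart at `ℓ` is adjacent to its reverse and to all other darts at `ℓ`. The reverse is adjacent
  -- to none of the latter, so at a simplicial dart there are no others and `ℓ` is a leaf.
  terminal-leaf : ∀ {z} → E G a z →
    ∃₂ λ ℓ y → Σ (E F ℓ y) λ e → z ≡ h e × (∀ {y′} → E F ℓ y′ → y′ ≡ y)
  terminal-leaf az with simplicial az
  ... | z∈H , clique with h-onto z∈H
  ...   | ℓ , y , e , refl = ℓ , y , e , refl , only
    where
    only : ∀ {y′} → E F ℓ y′ → y′ ≡ y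
    only {y′} e′ with y′ Finₚ.≟ y
    ... | yes eq = eq
    ... | no ne with h-adj (clique (h e′) (h (E-sym F e)) (h∈H e′) (h∈H (E-sym F e))
                       (λ eq → E⇒≢ F e (proj₁ (h-inj eq))) (h-star (ne ∘ ≡-sym)) h-flip)
    ...   | inj₁ (eq , _) = contradiction eq (E⇒≢ F e)
    ...   | inj₂ (_ , eq) = contradiction eq ne

  -- The neighbours of a terminal are within distance two of `a`, hence in the seed or equal to `a`;
  -- in the seed, a dart at a leaf is adjacent to its reverse alone.
  pendant : ∀ {z u v} → E G a z → E G z u → E G z v → u ≢ a → v ≢ a → u ≡ v
  pendant {z} az zu zv u≢a v≢a with terminal-leaf az
  ... | ℓ , y , e , refl , only = trans (partner zu u≢a) (≡-sym (partner zv v≢a))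
    where
    partner : ∀ {u} → E G (h e) u → u ≢ a → u ≡ h (E-sym F e)
    partner {u} zu u≢a with x∈p∪q⁻ H ⁅ a ⁆ (close u (inj₂ (inj₂ (h e , az , zu))))
    ... | inj₂ u∈a = contradiction (x∈⁅y⁆⇒x≡y a u∈a) u≢a
    ... | inj₁ u∈H with h-onto u∈H
    ...   | x , y′ , e′ , refl with h-adj zu
    ...     | inj₁ (refl , ne) = contradiction (≡-sym (only e′)) ne
    ...     | inj₂ (refl , refl) = cong h (T-irrelevant e′ (E-sym F e))

-- Branches of the caterpillar as sides of a fork

module Seed {F G : Graph} {H : Subset (n G)} (D : Darts F G H) (cat : IsCaterpillar F)
  (tf : ThetaFree G) (pf : PrismFree G) (a : V G) (a∉H : a ∉ H)
  (pendant : ∀ {z u v} → E G a z → E G z u → E G z v → u ≢ a → v ≢ a → u ≡ v)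
  (terminal-leaf : ∀ {z} → E G a z →
    ∃₂ λ ℓ y → Σ (E F ℓ y) λ e → z ≡ Darts.h D e × (∀ {y′} → E F ℓ y′ → y′ ≡ y))
  {t : ℕ} (nc : ¬ HasClique G t) {x : V G} (x≢a : x ≢ a) (x≁a : ¬ E G a x) where
  open Darts D
  open Caterpillar F cat
  open Rooted G tf pf a pendant
  open DecMembership (Finₚ._≟_ {n G}) using () renaming (_∈?_ to _∈ₗ?_)

  -- Carries a vertex set of the caterpillar over to the seed by the tails of darts. An edge leaving
  -- the set contributes just the half at its end inside.
  DartsAt : (V F → Set) → V G → Set
  DartsAt X g = ∃₂ λ x y → Σ (E F x y) λ e → X x × g ≡ h e

  dartsAt? : ∀ {X} → Decidable X → Decidable (DartsAt X)
  dartsAt? {X} X? g = Finₚ.any? λ x → Finₚ.any? λ y → dart? x y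
    where
    dart? : ∀ x y → Dec (Σ (E F x y) λ e → X x × g ≡ h e)
    dart? x y with E? F x y
    ... | no ¬e = no (¬e ∘ proj₁)
    ... | yes e = map′ (e ,_) (λ (e′ , Xx , eq) → Xx , trans eq (cong h (T-irrelevant e′ e)))
                    (X? x ×-dec (g Finₚ.≟ h e))

  dartsAt-mono : ∀ {X Y : V F → Set} → (∀ {v} → X v → Y v) → ∀ {g} → DartsAt X g → DartsAt Y g
  dartsAt-mono f (x , y , e , Xx , eq) = x , y , e , f Xx , eq

  h≢a : ∀ {x y} (e : E F x y) → h e ≢ a
  h≢a e eq = a∉H (subst (_∈ H) eq (h∈H e))

  -- A step along an edge of `F` becomes a move to the dart leaving along it, followed by a move to
  -- the reverse dart.
  dart-walk : ∀ {X x x′ y y′} → Reach F X x x′ → (e : E F x y) (e′ : E F x′ y′) →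
    Reach G (DartsAt X) (h e) (h e′)
  dart-walk {X} r e e′ = go r e
    where
    star-walk : ∀ {x y y″} → X x → (e : E F x y) (e″ : E F x y″) → Reach G (DartsAt X) (h e) (h e″)
    star-walk {y = y} {y″} Xx e e″ with y Finₚ.≟ y″
    ... | yes refl = subst (Reach G _ (h e)) (cong h (T-irrelevant e e″)) (here (_ , _ , e , Xx , refl))
    ... | no ne = step (_ , _ , e , Xx , refl) (h-star ne) (here (_ , _ , e″ , Xx , refl))
    go : ∀ {x y} → Reach F X x _ → (e : E F x y) → Reach G (DartsAt X) (h e) (h e′)
    go (here Xx) e = star-walk Xx e e′
    go (step Xx e₁ r) e =
      reach-trans (star-walk Xx e e₁) (step (_ , _ , e₁ , Xx , refl) h-flip (go r (E-sym F e₁)))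

  leaf-of : ∀ {ℓ y} {e : E F ℓ y} → Term (h e) → Leaf ℓ y
  leaf-of {e = e} tz with terminal-leaf tz
  ... | _ , _ , _ , eq , only with h-inj eq
  ...   | refl , refl = e , only

  Inhabited : (V G → Set) → Set
  Inhabited X = ∃[ z ] Term z × X z

  inhabited? : ∀ {X} → Decidable X → Dec (Inhabited X)
  inhabited? X? = Finₚ.any? (λ z → E? G a z ×-dec X? z)

  branch-apart : ∀ {v u q} → E F v u → E F v q → u ≢ q →
    Apart G (DartsAt (Branch v u)) (DartsAt (Branch v q))
  branch-apart vu vq u≢q (x , y , e , b , refl) (x′ , y′ , e′ , b′ , refl) =
    (λ eq → disjoint (proj₁ (h-inj eq))) , adjacent
    where
    disjoint : x ≢ x′
    disjoint refl = branches-disjoint vu vq u≢q b b′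
    adjacent : ¬ E G (h e) (h e′)
    adjacent g with h-adj g
    ... | inj₁ (eq , _) = disjoint eq
    ... | inj₂ (refl , refl) = branches-disjoint vu vq u≢q (branch-step b e (reach-end b′)) b′

  root-off : ∀ {v u q} (vu : E F v u) → E F v q → u ≢ q →
    ∀ {g} → DartsAt (Branch v q) g → Off G (h vu) g
  root-off vu vq u≢q (x , y , e , b , refl) =
    (λ eq → reach-end b (≡-sym (proj₁ (h-inj eq)))) , adjacent
    where
    adjacent : ¬ E G (h vu) (h e)
    adjacent g with h-adj g
    ... | inj₁ (eq , _) = reach-end b (≡-sym eq)
    ... | inj₂ (refl , refl) = branches-disjoint vu vq u≢q (branch-root vu) b

  root-∉ : ∀ {v u q} (vu : E F v u) → ¬ DartsAt (Branch v q) (h vu)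
  root-∉ vu (x , y , e , b , eq) = reach-end b (≡-sym (proj₁ (h-inj eq)))

  root-touch : ∀ {v u} (vu : E F v u) → Touch (h vu) (DartsAt (Branch v u))
  root-touch vu = h (E-sym F vu) , (_ , _ , E-sym F vu , branch-root vu , refl) , h-flip

  branch-connected : ∀ {v u f g} → DartsAt (Branch v u) f → DartsAt (Branch v u) g →
    Reach G (DartsAt (Branch v u)) f g
  branch-connected (_ , _ , e , b , refl) (_ , _ , e′ , b′ , refl) =
    dart-walk (reach-trans (reach-sym (reach-within b)) (reach-within b′)) e e′

  branch-lobe : ∀ {v u} → Inhabited (DartsAt (Branch v u)) → Lobe (DartsAt (Branch v u))
  branch-lobe (z , tz , c) c′ = z , tz , branch-connected c′ c

  module _ {v u₁ u₂ u₃} (e₁ : E F v u₁) (e₂ : E F v u₂) (e₃ : E F v u₃)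
    (u₁≢u₂ : u₁ ≢ u₂) (u₁≢u₃ : u₁ ≢ u₃) (u₂≢u₃ : u₂ ≢ u₃)
    (i₁ : Inhabited (DartsAt (Branch v u₁))) (i₂ : Inhabited (DartsAt (Branch v u₂)))
    (i₃ : Inhabited (DartsAt (Branch v u₃))) where

    branch-fork : Fork (DartsAt (Branch v u₁)) (DartsAt (Branch v u₂)) (DartsAt (Branch v u₃)) (h e₂) (h e₃)
    branch-fork = record
      { C₂? = dartsAt? (branch? v u₂) ; C₃? = dartsAt? (branch? v u₃)
      ; conn₁ = branch-connected ; conn₂ = branch-connected ; conn₃ = branch-connected
      ; lobe₁ = branch-lobe i₁ ; lobe₂ = branch-lobe i₂ ; lobe₃ = branch-lobe i₃
      ; apart₁₂ = branch-apart e₁ e₂ u₁≢u₂ ; apart₁₃ = branch-apart e₁ e₃ u₁≢u₃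
      ; apart₂₃ = branch-apart e₂ e₃ u₂≢u₃ ; b₂₃ = h-star u₂≢u₃
      ; touch₂ = root-touch e₂ ; touch₃ = root-touch e₃ ; b₂∉C₂ = root-∉ e₂ ; b₃∉C₃ = root-∉ e₃
      ; b₂-C₁ = root-off e₂ e₁ (u₁≢u₂ ∘ ≡-sym) ; b₂-C₃ = root-off e₂ e₃ u₂≢u₃
      ; b₃-C₁ = root-off e₃ e₁ (u₁≢u₃ ∘ ≡-sym) ; b₃-C₂ = root-off e₃ e₂ (u₂≢u₃ ∘ ≡-sym) }

    -- The first and the third branch get separated, so the two directions of the spine will be put
    -- there and the leg second.
    branch-separator : Separator (λ z → Term z × DartsAt (Branch v u₁) z)
      (λ z → Term z × DartsAt (Branch v u₃) z) (λ g → g ≡ h e₁ ⊎ g ≡ h e₂ ⊎ g ≡ h e₃) (ramsey t)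
    branch-separator = small-separator nc (join branch-fork
      record { ≢a = h≢a e₁ ; ∉C₁ = root-∉ e₁ ; touch = root-touch e₁ } (h-star u₁≢u₂) (h-star u₁≢u₃))

    base-at : ∀ {w} → Touch w (λ g → g ≡ h e₁ ⊎ g ≡ h e₂ ⊎ g ≡ h e₃) → Touch w (DartsAt (_≡ v))
    base-at (g , inj₁ eq , e) = g , (_ , _ , e₁ , refl , eq) , e
    base-at (g , inj₂ (inj₁ eq) , e) = g , (_ , _ , e₂ , refl , eq) , e
    base-at (g , inj₂ (inj₂ eq) , e) = g , (_ , _ , e₃ , refl , eq) , e

  -- Cuts at the spine vertices

  At : ℕ → V G → Set
  At j = DartsAt (Hang j)

  position : ∀ {z} → Term z → ∃[ j ] j ≤ k × At j z
  position tz with terminal-leaf tz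
  ... | ℓ , y , e , refl , _ with hangs ℓ
  ...   | j , le , hg = j , le , ℓ , y , e , hg , refl

  record Cut (W : V G → Set) : Set where
    field
      M     : List (V G)
      small : length M ≤ ramsey t
      M≢a   : All (_≢ a) M
      x∉M   : x ∉ₗ M
      cut   : ∀ {z} → Term z → W z → ¬ Reach G (Avoiding M) x z

  empty-cut : ∀ {W} → (∀ {z} → Term z → ¬ W z) → Cut W
  empty-cut none = record
    { M = [] ; small = z≤n ; M≢a = [] ; x∉M = λ () ; cut = λ tz w → contradiction w (none tz) }

  -- The position `j` belongs to neither; its terminals enter the final separator through
  -- `hanging j`.
  Before After : ℕ → V G → Set
  Before j z = ∃[ i ] i < j × At i z
  After j z = ∃[ i ] j < i × i ≤ k × At i z

  Near : ℕ → Set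
  Near j = Touch x (DartsAt (_≡ p j)) × Inhabited (At j)

  -- A cut on either side makes the position usable. `near` is the failure in which `x` lies in the
  -- separator, hence next to the triangle; `empty` positions cost nothing.
  data Status (j : ℕ) : Set where
    before : Cut (Before j) → Status j
    after  : Cut (After j) → Status j
    near   : Near j → Status j
    empty  : ¬ Inhabited (At j) → Status j

  module _ {j} (1+j<k : suc j < k) where
    private
      v u₁ u₃ : V F
      v = p (suc j)
      u₁ = p j
      u₃ = p (suc (suc j))

      j<k : j < k
      j<k = ℕₚ.<⇒≤ 1+j<k

      e₁ : E F v u₁
      e₁ = E-sym F (p-rel j<k)

      e₃ : E F v u₃
      e₃ = p-rel 1+j<k

      u₁≢u₃ : u₁ ≢ u₃
      u₁≢u₃ eq = ℕₚ.<⇒≢ (ℕₚ.m<n⇒m<1+n (ℕₚ.n<1+n j)) (p-inj (ℕₚ.<⇒≤ j<k) 1+j<k eq)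

      to-left : ∀ {z} → Before (suc j) z → DartsAt (Branch v u₁) z
      to-left (i , s≤s i≤j , pos) = dartsAt-mono (hang-left i≤j j<k) pos

      to-right : ∀ {z} → After (suc j) z → DartsAt (Branch v u₃) z
      to-right (i , j<i , i≤k , pos) = dartsAt-mono (hang-right j<i i≤k) pos

      module _ {q} (e₂ : E F v q) (q∉ : ¬ Spine q) (i₂ : Inhabited (DartsAt (Branch v q)))
        (mid : Inhabited (At (suc j))) (i₁ : Inhabited (DartsAt (Branch v u₁)))
        (i₃ : Inhabited (DartsAt (Branch v u₃))) where

        u₁≢q : u₁ ≢ q
        u₁≢q refl = q∉ (p-spine (ℕₚ.<⇒≤ j<k))

        q≢u₃ : q ≢ u₃
        q≢u₃ refl = q∉ (p-spine 1+j<k)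

        sides : Separator (λ z → Term z × DartsAt (Branch v u₁) z) (λ z → Term z × DartsAt (Branch v u₃) z)
          (λ g → g ≡ h e₁ ⊎ g ≡ h e₂ ⊎ g ≡ h e₃) (ramsey t) → Status (suc j)
        sides S with x ∈ₗ? Separator.M S
        ... | yes x∈M = near (base-at e₁ e₂ e₃ u₁≢q u₁≢u₃ q≢u₃ i₁ i₂ i₃ (All.lookup (Separator.near S) x∈M) , mid)
        -- If `x` reaches some left terminal while avoiding `M`, it can reach no right one, since
        -- `M` separates the two sides.
        ... | no x∉M with Finₚ.any? (λ z → (E? G a z ×-dec dartsAt? (branch? v u₁) z) ×-dec
                            reach? (λ w → ¬? (w Finₚ.≟ a) ×-dec ¬? (w ∈ₗ? Separator.M S)) x z)
        ...   | yes (z , l , r) = after record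
                { M = M ; small = small ; M≢a = M≢a ; x∉M = x∉M
                ; cut = λ tz aft r′ → separate l (tz , to-right aft) (reach-trans (reach-sym r) r′) }
          where open Separator S
        ...   | no none = before record
                { M = M ; small = small ; M≢a = M≢a ; x∉M = x∉M
                ; cut = λ tz bef r → none (_ , (tz , to-left bef) , r) }
          where open Separator S

        decided : Status (suc j)
        decided = sides (branch-separator e₁ e₂ e₃ u₁≢q u₁≢u₃ q≢u₃ i₁ i₂ i₃)

    status : Status (suc j)
    status with inhabited? (dartsAt? (hang? (suc j)))
    ... | no none = empty none
    -- An inner spine vertex has two neighbours and is no leaf, so the terminal sits on a leg.
    ... | yes (z , tz , ℓ , y , e , hg , refl) with hang-leg hg (λ eq → u₁≢u₃ (trans
              (proj₂ (leaf-of tz) (subst (λ w → E F w u₁) eq e₁))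
              (≡-sym (proj₂ (leaf-of tz) (subst (λ w → E F w u₃) eq e₃)))))
    ...   | q , e₂ , r with inhabited? (dartsAt? (branch? v u₁)) | inhabited? (dartsAt? (branch? v u₃))
    -- A side without terminals is cut off by the empty list.
    ...     | no none | _ = before (empty-cut λ tz bef → none (_ , tz , to-left bef))
    ...     | yes _ | no none = after (empty-cut λ tz aft → none (_ , tz , to-right aft))
    ...     | yes i₁ | yes i₃ = decided e₂ (reach-start r)
              (_ , tz , ℓ , y , e , reach-mono (λ { ¬s refl → ¬s (p-spine j<k) }) r , refl)
              (_ , tz , ℓ , y , e , hg , refl) i₁ i₃

  -- `p (suc i)` has the two positions in different branches. Adjacent positions would not do: the
  -- two darts of the spine edge joining them are adjacent.
  hang-apart : ∀ {i j} → suc i < j → j ≤ k → Apart G (At i) (At j)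
  hang-apart {i} {j} lt j≤k c c′ = branch-apart
    (E-sym F (p-rel (ℕₚ.<⇒≤ i+1<k))) (p-rel i+1<k)
    (λ eq → ℕₚ.<⇒≢ (ℕₚ.m<n⇒m<1+n (ℕₚ.n<1+n i)) (p-inj (ℕₚ.<⇒≤ (ℕₚ.<⇒≤ i+1<k)) i+1<k eq))
    (dartsAt-mono (hang-left ℕₚ.≤-refl (ℕₚ.<⇒≤ i+1<k)) c) (dartsAt-mono (hang-right lt j≤k) c′)
    where
    i+1<k : suc i < k
    i+1<k = ℕₚ.<-≤-trans lt j≤k

  near-arm : ∀ {j} → Near j → Arm x (At j)
  near-arm ((u , (_ , _ , e , refl , refl) , xu) , (z , tz , ℓ , y , e′ , hg , refl)) =
    arm xu (dart-walk (reach-within hg) e e′) tz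

  spread-near-absurd : ∀ {i j l} → suc i < j → suc j < l → l ≤ k → Near i → Near j → Near l → ⊥
  spread-near-absurd i<j j<l l≤k ni nj nl = claw x≢a (near-arm ni) (near-arm nj) (near-arm nl)
    (hang-apart i<j (ℕₚ.≤-trans (ℕₚ.<⇒≤ (ℕₚ.<⇒≤ j<l)) l≤k))
    (hang-apart (ℕₚ.<-trans i<j (ℕₚ.<⇒≤ j<l)) l≤k) (hang-apart j<l l≤k)

  -- The terminals hanging at a spine vertex

  pick : ∀ {X} → Decidable X → List (V G)
  pick X? with inhabited? X?
  ... | yes (z , _) = z ∷ []
  ... | no _ = []

  pick-length : ∀ {X} (X? : Decidable X) → length (pick X?) ≤ 1
  pick-length X? with inhabited? X?
  ... | yes _ = s≤s z≤n
  ... | no _ = z≤n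

  pick-terminal : ∀ {X} (X? : Decidable X) → All Term (pick X?)
  pick-terminal X? with inhabited? X?
  ... | yes (_ , tz , _) = tz ∷ []
  ... | no _ = []

  ∈-pick : ∀ {X} (X? : Decidable X) → (∀ {z z′} → Term z → X z → Term z′ → X z′ → z ≡ z′) →
    ∀ {z} → Term z → X z → z ∈ₗ pick X?
  ∈-pick X? unique tz Xz with inhabited? X?
  ... | yes (_ , tz′ , Xz′) = hereₐ (unique tz Xz tz′ Xz′)
  ... | no none = contradiction (_ , tz , Xz) none

  OnLeg : V F → V F → Set
  OnLeg q = Reach F (¬_ ∘ Spine) q

  onLeg? : ∀ q → Decidable (OnLeg q)
  onLeg? = reach? (λ v → ¬? (spine? v))

  -- At most four: one if `p j` is itself a leaf, and one for each of at most three neighbours, as a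
  -- leg has a single leaf. A neighbour on the spine contributes nothing, for `OnLeg` is empty
  -- there.
  hanging : ℕ → List (V G)
  hanging j = pick (dartsAt? (Finₚ._≟ p j)) ++
    concatMap (λ q → pick (dartsAt? (onLeg? q))) (members F (E? F (p j)))

  concatMap-length : ∀ {A : Set} (f : A → List (V G)) → (∀ x → length (f x) ≤ 1) →
    ∀ xs → length (concatMap f xs) ≤ length xs
  concatMap-length f f≤1 [] = z≤n
  concatMap-length f f≤1 (x ∷ xs) = subst (_≤ suc (length xs)) (≡-sym (length-++ (f x)))
    (ℕₚ.+-mono-≤ (f≤1 x) (concatMap-length f f≤1 xs))

  hanging-length : ∀ j → length (hanging j) ≤ 4
  hanging-length j = subst (_≤ 4) (≡-sym (length-++ (pick (dartsAt? (Finₚ._≟ p j)))))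
    (ℕₚ.+-mono-≤ (pick-length (dartsAt? (Finₚ._≟ p j)))
      (ℕₚ.≤-trans (concatMap-length _ (λ q → pick-length (dartsAt? (onLeg? q))) (members F (E? F (p j))))
        (subst (_≤ 3) (≡-sym (length-neighbours F (p j))) (proj₁ (proj₂ cat) (p j)))))

  hanging-terminal : ∀ j → All Term (hanging j)
  hanging-terminal j = Allₚ.++⁺ (pick-terminal (dartsAt? (Finₚ._≟ p j))) (legs (members F (E? F (p j))))
    where
    legs : ∀ qs → All Term (concatMap (λ q → pick (dartsAt? (onLeg? q))) qs)
    legs [] = []
    legs (q ∷ qs) = Allₚ.++⁺ (pick-terminal (dartsAt? (onLeg? q))) (legs qs)

  same-leaf : ∀ {ℓ y ℓ′ y′} {e : E F ℓ y} {e′ : E F ℓ′ y′} → ℓ ≡ ℓ′ → Leaf ℓ y → h e ≡ h e′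
  same-leaf {e = e} {e′} refl (_ , only) with only e′
  ... | refl = cong h (T-irrelevant e e′)

  ∈-hanging : ∀ {j z} → j ≤ k → Term z → At j z → z ∈ₗ hanging j
  ∈-hanging {j} {z} j≤k tz (ℓ , y , e , hg , refl) with p j Finₚ.≟ ℓ
  ... | yes eq = ∈-++⁺ˡ (∈-pick (dartsAt? (Finₚ._≟ p j)) unique tz (ℓ , y , e , ≡-sym eq , refl))
    where
    unique : ∀ {z z′} → Term z → DartsAt (_≡ p j) z → Term z′ → DartsAt (_≡ p j) z′ → z ≡ z′
    unique tz (_ , _ , _ , refl , refl) _ (_ , _ , _ , refl , refl) = same-leaf refl (leaf-of tz)
  ... | no ne with hang-leg hg ne
  ...   | q , e₂ , r = ∈-++⁺ʳ _ (∈-concatMap⁺ (λ q → pick (dartsAt? (onLeg? q)))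
            (Any.map (λ { refl → ∈-pick (dartsAt? (onLeg? q)) unique tz (ℓ , y , e , r , refl) })
              (∈-members F (E? F (p j)) e₂)))
    where
    unique : ∀ {z z′} → Term z → DartsAt (OnLeg q) z → Term z′ → DartsAt (OnLeg q) z′ → z ≡ z′
    unique tz (_ , _ , _ , r , refl) tz′ (_ , _ , _ , r′ , refl) =
      same-leaf (leg-leaf-unique j≤k e₂ r r′ (leaf-of tz) (leaf-of tz′)) (leaf-of tz)

  -- Scanning the spine

  -- The 24 counts four terminals at each of six positions: the base, up to four near positions and
  -- the closing one. The rest are two cuts.
  record Barrier : Set where
    field
      S     : List (V G)
      small : length S ≤ ramsey t + (24 + ramsey t)
      S≢a   : All (_≢ a) S
      x∉S   : x ∉ₗ S
      cut   : ∀ {z} → Term z → ¬ Reach G (Avoiding S) x z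

  -- Scanning the spine up to j: a cut from the terminals hanging before `base`
  -- together with all terminals hanging between base and j.
  record Scan (j : ℕ) : Set where
    field
      base     : ℕ
      cut      : Cut (Before base)
      S        : List (V G)
      terminal : All Term S
      cover    : ∀ {i z} → base ≤ i → i < j → i ≤ k → Term z → At i z → z ∈ₗ S
      nears    : List ℕ
      all-near : All Near nears
      below    : All (_< j) nears
      sorted   : AllPairs _>_ nears
      few      : length nears ≤ 4
      -- The leading 4 pays for the terminals at `base`, which is not listed among `nears`.
      weight   : length S ≤ 4 + 4 * length nears

  few-nears : ∀ {j ns} → j ≤ k → Near j → All Near ns → All (_< j) ns → AllPairs _>_ ns →
    length ns ≤ 4 → suc (length ns) ≤ 4
  few-nears {ns = []} _ _ _ _ _ _ = s≤s z≤n
  few-nears {ns = _ ∷ []} _ _ _ _ _ _ = s≤s (s≤s z≤n)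
  few-nears {ns = _ ∷ _ ∷ []} _ _ _ _ _ _ = s≤s (s≤s (s≤s z≤n))
  few-nears {ns = _ ∷ _ ∷ _ ∷ []} _ _ _ _ _ _ = s≤s (s≤s (s≤s (s≤s z≤n)))
  -- Among five near positions in order, the lowest, the third and the new one `j` are two or more
  -- apart, which gives a claw at `x`.
  few-nears {ns = _ ∷ _ ∷ _ ∷ _ ∷ []} j≤k nj (_ ∷ n₂ ∷ _ ∷ n₄ ∷ []) (b₁<j ∷ _)
    ((b₂<b₁ ∷ _) ∷ (b₃<b₂ ∷ _) ∷ (b₄<b₃ ∷ _) ∷ _) _ =
    ⊥-elim (spread-near-absurd (ℕₚ.≤-<-trans b₄<b₃ b₃<b₂) (ℕₚ.≤-<-trans b₂<b₁ b₁<j) j≤k n₄ n₂ nj)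
  few-nears {ns = _ ∷ _ ∷ _ ∷ _ ∷ _ ∷ _} _ _ _ _ _ (s≤s (s≤s (s≤s (s≤s ()))))

  split-≤ : ∀ {i j} → i < suc j → i < j ⊎ i ≡ j
  split-≤ (s≤s le) = ℕₚ.m≤n⇒m<n∨m≡n le

  scan-start : Scan 0
  scan-start = record
    { base = 0 ; cut = empty-cut λ { _ (_ , () , _) } ; S = [] ; terminal = [] ; cover = λ _ ()
    ; nears = [] ; all-near = [] ; below = [] ; sorted = [] ; few = z≤n ; weight = z≤n }

  -- The new cut takes care of all earlier terminals, so those collected are dropped and the near
  -- positions are counted afresh.
  scan-reset : ∀ {j} → j ≤ k → Cut (Before j) → Scan (suc j)
  scan-reset {j} j≤k c = record
    { base = j ; cut = c ; S = hanging j ; terminal = hanging-terminal j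
    ; cover = λ j≤i i<1+j i≤k tz pos →
        ∈-hanging j≤k tz (subst (λ i → At i _) (ℕₚ.≤-antisym (ℕₚ.≤-pred i<1+j) j≤i) pos)
    ; nears = [] ; all-near = [] ; below = [] ; sorted = [] ; few = z≤n ; weight = hanging-length j }

  scan-near : ∀ {j} → j ≤ k → Near j → Scan j → Scan (suc j)
  scan-near {j} j≤k nj s = record
    { base = base ; cut = cut ; S = hanging j ++ S
    ; terminal = Allₚ.++⁺ (hanging-terminal j) terminal
    ; cover = λ b≤i i<1+j i≤k tz pos → case split-≤ i<1+j of λ where
        (inj₁ i<j) → ∈-++⁺ʳ (hanging j) (cover b≤i i<j i≤k tz pos)
        (inj₂ refl) → ∈-++⁺ˡ (∈-hanging i≤k tz pos)
    ; nears = j ∷ nears ; all-near = nj ∷ all-near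
    ; below = ℕₚ.n<1+n j ∷ All.map ℕₚ.m<n⇒m<1+n below ; sorted = below ∷ sorted
    ; few = few-nears j≤k nj all-near below sorted few
    ; weight = heavier }
    where
    open Scan s
    open ℕₚ.≤-Reasoning
    heavier : length (hanging j ++ S) ≤ 4 + 4 * suc (length nears)
    heavier = begin
      length (hanging j ++ S) ≡⟨ length-++ (hanging j) ⟩
      length (hanging j) + length S ≤⟨ ℕₚ.+-mono-≤ (hanging-length j) weight ⟩
      4 + (4 + 4 * length nears) ≡⟨ cong (4 +_) (ℕₚ.*-suc 4 (length nears)) ⟨
      4 + 4 * suc (length nears) ∎

  scan-empty : ∀ {j} → ¬ Inhabited (At j) → Scan j → Scan (suc j)
  scan-empty none s = record
    { base = base ; cut = cut ; S = S ; terminal = terminal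
    ; cover = λ b≤i i<1+j i≤k tz pos → case split-≤ i<1+j of λ where
        (inj₁ i<j) → cover b≤i i<j i≤k tz pos
        (inj₂ refl) → contradiction (_ , tz , pos) none
    ; nears = nears ; all-near = all-near ; below = All.map ℕₚ.m<n⇒m<1+n below
    ; sorted = sorted ; few = few ; weight = weight }
    where open Scan s

  scan-finish : ∀ {j} → j ≤ k → Cut (After j) → Scan j → Barrier
  scan-finish {j} j≤k c s = record
    { S = L.M ++ (hanging j ++ S) ++ R.M
    ; small = bound
    ; S≢a = Allₚ.++⁺ L.M≢a (Allₚ.++⁺ (All.map term≢a terminals) R.M≢a)
    ; x∉S = λ x∈ → case ∈-++⁻ L.M x∈ of λ where
        (inj₁ x∈L) → L.x∉M x∈L
        (inj₂ x∈′) → case ∈-++⁻ (hanging j ++ S) x∈′ of λ where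
          -- Everything in this part is a terminal, and `x` is none.
          (inj₁ x∈S) → x≁a (All.lookup terminals x∈S)
          (inj₂ x∈R) → R.x∉M x∈R
    ; cut = separated }
    where
    open Scan s
    module L = Cut cut
    module R = Cut c
    terminals : All Term (hanging j ++ S)
    terminals = Allₚ.++⁺ (hanging-terminal j) terminal
    term≢a : ∀ {z} → Term z → z ≢ a
    term≢a tz refl = E-irrefl G tz
    bound : length (L.M ++ (hanging j ++ S) ++ R.M) ≤ ramsey t + (24 + ramsey t)
    bound = begin
      length (L.M ++ (hanging j ++ S) ++ R.M) ≡⟨ length-++ L.M ⟩
      length L.M + length ((hanging j ++ S) ++ R.M) ≡⟨ cong (length L.M +_) (length-++ (hanging j ++ S)) ⟩
      length L.M + (length (hanging j ++ S) + length R.M)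
        ≡⟨ cong (λ m → length L.M + (m + length R.M)) (length-++ (hanging j)) ⟩
      length L.M + ((length (hanging j) + length S) + length R.M)
        ≤⟨ ℕₚ.+-mono-≤ L.small (ℕₚ.+-mono-≤ (ℕₚ.+-mono-≤ (hanging-length j)
             (ℕₚ.≤-trans weight (ℕₚ.+-monoʳ-≤ 4 (ℕₚ.*-monoʳ-≤ 4 few)))) R.small) ⟩
      ramsey t + (24 + ramsey t) ∎
      where open ℕₚ.≤-Reasoning
    separated : ∀ {z} → Term z → ¬ Reach G (Avoiding (L.M ++ (hanging j ++ S) ++ R.M)) x z
    separated {z} tz r with position tz
    ... | i , i≤k , pos with ℕₚ.<-cmp i j | ℕₚ.≤-<-connex base i
    ...   | tri> _ _ j<i | _ = R.cut tz (i , j<i , i≤k , pos) (reach-mono (λ (≢a , ∉) →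
              ≢a , ∉ ∘ ∈-++⁺ʳ L.M ∘ ∈-++⁺ʳ (hanging j ++ S)) r)
    ...   | tri≈ _ refl _ | _ = proj₂ (reach-end r)
              (∈-++⁺ʳ L.M (∈-++⁺ˡ (∈-++⁺ˡ (∈-hanging i≤k tz pos))))
    ...   | tri< i<j _ _ | inj₁ b≤i = proj₂ (reach-end r)
              (∈-++⁺ʳ L.M (∈-++⁺ˡ (∈-++⁺ʳ (hanging j) (cover b≤i i<j i≤k tz pos))))
    ...   | tri< _ _ _ | inj₂ i<b = L.cut tz (i , i<b , pos)
              (reach-mono (λ (≢a , ∉) → ≢a , ∉ ∘ ∈-++⁺ˡ) r)

  scan : ∀ m j → j + m ≡ k → Scan j → Barrier
  -- Nothing hangs after position `k`, so the empty cut closes the scan there.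
  scan zero j eq s = scan-finish j≤k (empty-cut λ { _ (i , j<i , i≤k , _) →
      ℕₚ.<-irrefl refl (ℕₚ.<-≤-trans j<i (subst (i ≤_) (trans (≡-sym eq) (ℕₚ.+-identityʳ j)) i≤k)) }) s
    where
    j≤k : j ≤ k
    j≤k = ℕₚ.≤-reflexive (trans (≡-sym (ℕₚ.+-identityʳ j)) eq)
  -- Position 0 has no spine neighbour on its left and gets no status; nothing hangs before it, so
  -- it serves as the first base.
  scan (suc m) zero eq s = scan m 1 eq (scan-reset z≤n (Scan.cut scan-start))
  scan (suc m) (suc j) eq s with status {j} j<k
    where
    j<k : suc j < k
    j<k = subst (suc j <_) eq (ℕₚ.m<m+n (suc j) z<s)
  ... | before c = scan m (suc (suc j)) (trans (≡-sym (ℕₚ.+-suc (suc j) m)) eq)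
                     (scan-reset (subst (suc j ≤_) eq (ℕₚ.m≤m+n (suc j) (suc m))) c)
  ... | after c = scan-finish (subst (suc j ≤_) eq (ℕₚ.m≤m+n (suc j) (suc m))) c s
  ... | near nj = scan m (suc (suc j)) (trans (≡-sym (ℕₚ.+-suc (suc j) m)) eq)
                     (scan-near (subst (suc j ≤_) eq (ℕₚ.m≤m+n (suc j) (suc m))) nj s)
  ... | empty none = scan m (suc (suc j)) (trans (≡-sym (ℕₚ.+-suc (suc j) m)) eq) (scan-empty none s)

  barrier : Barrier
  barrier = scan k 0 refl scan-start

-- From lists to subsets and partitions

∣p∪q∣≤∣p∣+∣q∣ : ∀ {m} (p q : Subset m) → ∣ p ∪ q ∣ ≤ ∣ p ∣ + ∣ q ∣
∣p∪q∣≤∣p∣+∣q∣ Vec.[] Vec.[] = z≤n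
∣p∪q∣≤∣p∣+∣q∣ (false Vec.∷ p) (false Vec.∷ q) = ∣p∪q∣≤∣p∣+∣q∣ p q
∣p∪q∣≤∣p∣+∣q∣ (false Vec.∷ p) (true Vec.∷ q) =
  subst (suc ∣ p ∪ q ∣ ≤_) (≡-sym (ℕₚ.+-suc ∣ p ∣ ∣ q ∣)) (s≤s (∣p∪q∣≤∣p∣+∣q∣ p q))
∣p∪q∣≤∣p∣+∣q∣ (true Vec.∷ p) (false Vec.∷ q) = s≤s (∣p∪q∣≤∣p∣+∣q∣ p q)
∣p∪q∣≤∣p∣+∣q∣ (true Vec.∷ p) (true Vec.∷ q) =
  s≤s (ℕₚ.≤-trans (∣p∪q∣≤∣p∣+∣q∣ p q) (ℕₚ.+-monoʳ-≤ ∣ p ∣ (ℕₚ.n≤1+n ∣ q ∣)))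

module _ {m : ℕ} where

  fromList : List (Fin m) → Subset m
  fromList [] = ∅
  fromList (x ∷ xs) = ⁅ x ⁆ ∪ fromList xs

  fromList-size : ∀ xs → ∣ fromList xs ∣ ≤ length xs
  fromList-size [] = ℕₚ.≤-reflexive (∣⊥∣≡0 m)
  fromList-size (x ∷ xs) = ℕₚ.≤-trans (∣p∪q∣≤∣p∣+∣q∣ ⁅ x ⁆ (fromList xs))
    (ℕₚ.+-mono-≤ (ℕₚ.≤-reflexive (∣⁅x⁆∣≡1 x)) (fromList-size xs))

  ∈-fromList⁺ : ∀ {v} xs → v ∈ₗ xs → v ∈ fromList xs
  ∈-fromList⁺ (x ∷ xs) (hereₐ refl) = x∈p∪q⁺ (inj₁ (x∈⁅x⁆ x))
  ∈-fromList⁺ (x ∷ xs) (thereₐ v∈) = x∈p∪q⁺ (inj₂ (∈-fromList⁺ xs v∈))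

  ∈-fromList⁻ : ∀ {v} xs → v ∈ fromList xs → v ∈ₗ xs
  ∈-fromList⁻ [] v∈ = contradiction v∈ ∉⊥
  ∈-fromList⁻ (x ∷ xs) v∈ with x∈p∪q⁻ ⁅ x ⁆ (fromList xs) v∈
  ... | inj₁ v∈x = hereₐ (x∈⁅y⁆⇒x≡y x v∈x)
  ... | inj₂ v∈xs = thereₐ (∈-fromList⁻ xs v∈xs)

  module _ {P : Fin m → Set} (P? : Decidable P) where

    comprehension : Subset m
    comprehension = Vec.tabulate (does ∘ P?)

    ∈-comprehension⁺ : ∀ {v} → P v → v ∈ comprehension
    ∈-comprehension⁺ {v} p = Vecₚ.lookup⇒[]= v _
      (trans (Vecₚ.lookup∘tabulate (does ∘ P?) v) (dec-true (P? v) p))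

    ∈-comprehension⁻ : ∀ {v} → v ∈ comprehension → P v
    ∈-comprehension⁻ {v} v∈ with P? v in eq
    ... | yes p = p
    ... | no _ with trans (≡-sym (Vecₚ.[]=⇒lookup v∈))
                     (trans (Vecₚ.lookup∘tabulate (does ∘ P?) v) (cong does eq))
    ...   | ()

-- The left part is the component of `a` after deletion of `S`, the right part everything else
-- outside `S`.
separates : ∀ G {S a x} → a ∉ S → x ∉ S → ¬ Reach G (_∉ S) a x → Separates G S a x
separates G {S} {a} {x} a∉S x∉S ¬r =
    a∉S , x∉S , comprehension L? , comprehension R? , partition
  , ∈-comprehension⁺ L? (here a∉S) , ∈-comprehension⁺ R? (x∉S , ¬r)
  , λ u v u∈L v∈R e → proj₂ (∈-comprehension⁻ R? v∈R)
      (reach-snoc (∈-comprehension⁻ L? u∈L) e (proj₁ (∈-comprehension⁻ R? v∈R)))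
  where
  L? : Decidable (Reach G (_∉ S) a)
  L? = reach? (λ v → ¬? (v ∈? S)) a
  R? : Decidable (λ v → v ∉ S × ¬ Reach G (_∉ S) a v)
  R? v = ¬? (v ∈? S) ×-dec ¬? (L? v)
  partition : ∀ v → (v ∈ comprehension L? × v ∉ S × v ∉ comprehension R?)
    ⊎ (v ∉ comprehension L? × v ∈ S × v ∉ comprehension R?)
    ⊎ (v ∉ comprehension L? × v ∉ S × v ∈ comprehension R?)
  partition v with v ∈? S | L? v
  ... | yes v∈ | _ = inj₂ (inj₁ ((λ l → reach-end (∈-comprehension⁻ L? l) v∈) , v∈ ,
          λ r → proj₁ (∈-comprehension⁻ R? r) v∈))
  ... | no v∉ | yes l = inj₁ (∈-comprehension⁺ L? l , v∉ , λ r → proj₂ (∈-comprehension⁻ R? r) l)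
  ... | no v∉ | no ¬l = inj₂ (inj₂ ((λ l → ¬l (∈-comprehension⁻ L? l)) , v∉ ,
          ∈-comprehension⁺ R? (v∉ , ¬l)))

theorem6p2 : (t : ℕ) → 1 ≤ t →
    Σ ℕ λ s → 1 ≤ s ×
    ((G : Graph) → ThetaFree G → PrismFree G → ¬ HasClique G t →
    (a : V G) → (Σ (Subset (n G)) λ H → IsSeed G a H) →
    (x : V G) → x ≢ a → ¬ E G a x →
    Σ (Subset (n G)) λ S → a ∉ S × x ∉ S × ∣ S ∣ < s × Separates G S a x)
theorem6p2 t _ = suc (ramsey t + (24 + ramsey t)) , s≤s z≤n , cut
  where
  cut : (G : Graph) → ThetaFree G → PrismFree G → ¬ HasClique G t →
    (a : V G) → (Σ (Subset (n G)) λ H → IsSeed G a H) →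
    (x : V G) → x ≢ a → ¬ E G a x →
    Σ (Subset (n G)) λ S → a ∉ S × x ∉ S × ∣ S ∣ < suc (ramsey t + (24 + ramsey t)) × Separates G S a x
  cut G tf pf nc a (H , a∉H , (F , cat , iso) , simp , close , _) x x≢a x≁a =
    fromList S , a∉S , x∉S′ , s≤s (ℕₚ.≤-trans (fromList-size S) small) , separates G a∉S x∉S′ unreachable
    where
    D : Darts F G H
    D = darts F G H iso
    open SeedTerminals D a (λ {v} → proj₁ (simp v)) close using (pendant; terminal-leaf)
    open Seed D cat tf pf a a∉H pendant terminal-leaf nc x≢a x≁a using (Barrier; barrier)
    open Barrier barrier renaming (cut to separated)
    a∉S : a ∉ fromList S
    a∉S a∈ = All.lookup S≢a (∈-fromList⁻ S a∈) refl
    x∉S′ : x ∉ fromList S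
    x∉S′ x∈ = x∉S (∈-fromList⁻ S x∈)
    unreachable : ¬ Reach G (_∉ fromList S) a x
    -- Traversed from `x`, the walk has a first visit to `a`. The vertex before it is a terminal
    -- that `x` reaches without using `a`.
    unreachable r with first-hit (Finₚ._≟ a) (reach-sym r) refl
    ... | _ , _ , refl , inj₁ x≡a = x≢a x≡a
    ... | _ , _ , refl , inj₂ (z , r′ , e) = separated (E-sym G e)
            (reach-mono (λ (∉S , ≢a) → ≢a , ∉S ∘ ∈-fromList⁺ S) r′)
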